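{- (1) For all non-negative integers $c,d,e,f$, there is no $CW(v,n)$ for any of the following pairs $(v,n)$: $(2^c, 7^{2e+2})$; $(3\cdot 7^d, 2^{2e+6})$; $(3^c13^d, 3^{2f+4})$; $(2^c5^d, 2^{2e+2}5^{2f+2})$; $(2^c11^d, 2^{2e+2}5^{2f+2})$; $(2^c3^d, 2^{2e+2}5^{2f+2})$. (2) Let $c\ge1$ and $e\ge 0$ be integers. There is no $G$-invariant $IW(v,n)$ for any finite abelian group $G$ of order $v$ whose exponent is divisible by $w$, in each of the following cases: $(v,n)=(2^c,2^{2e+6})$ with $w=2^{c-1}$; $(v,n)=(3^c,7^{2e+2})$ with $w=3^{c-1}$.
   Context: For a finite abelian group $G$ of order $v$, a $G$-invariant $IW(v,n)$ (weighing matrix) is an element $D=\sum_{g}a_g g\in\mathbb{Z}[G]$ with all $a_g\in\{0,\pm1\}$ and $DD^{(-1)}=n$, where $D^{(-1)}=\sum_g a_g g^{ -1}$. A $CW(v,n)$ (circulant weighing matrix) is a $C_v$-invariant $IW(v,n)$, where $C_v$ is the cyclic group of order $v$. -}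

module Defs where

open import Data.Nat as ℕ using (ℕ; zero; suc; _%_; _>_)
open import Data.Nat.DivMod using (m%n<n)
open import Data.Nat.Divisibility using (_∣_)
open import Data.Integer as ℤ using (ℤ; +_; 0ℤ; 1ℤ; -1ℤ)
open import Data.Fin as Fin using (Fin; toℕ; fromℕ<)
open import Data.Product using (Σ; ∃; _×_)
open import Data.Sum using (_⊎_)
open import Data.Empty using (⊥)
open import Data.Bool using (if_then_else_)
open import Relation.Nullary.Decidable using (⌊_⌋)
open import Relation.Binary.PropositionalEquality using (_≡_)
open import Algebra.Structures using (IsAbelianGroup)

sumFin : ∀ {v} → (Fin v → ℤ) → ℤ
sumFin {zero}  f = 0ℤ
sumFin {suc v} f = f Fin.zero ℤ.+ sumFin (λ i → f (Fin.suc i))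

Trit : ℤ → Set
Trit x = x ≡ 0ℤ ⊎ x ≡ 1ℤ ⊎ x ≡ -1ℤ

-- A finite abelian group of order v, with carrier Fin v
-- (every finite group of order v is isomorphic to one of this form).
record FinAbGroup (v : ℕ) : Set where
  field
    _∙_ : Fin v → Fin v → Fin v
    ε   : Fin v
    _⁻¹ : Fin v → Fin v
    isAbelianGroup : IsAbelianGroup _≡_ _∙_ ε _⁻¹

  pow : Fin v → ℕ → Fin v
  pow g zero    = ε
  pow g (suc k) = g ∙ pow g k

IsExponent : ∀ {v} → FinAbGroup v → ℕ → Set
IsExponent G m =
  m > 0 × (∀ g → pow g m ≡ ε) ×
  (∀ m' → m' > 0 → (∀ g → pow g m' ≡ ε) → m ℕ.≤ m')
  where open FinAbGroup G

ExponentDivisibleBy : ∀ {v} → FinAbGroup v → ℕ → Set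
ExponentDivisibleBy G w = ∃ λ m → IsExponent G m × w ∣ m

-- Coefficient of h in D D^{(-1)} for D = Σ_g a_g g: Σ_g a_g a_{h⁻¹ g}.
-- Generic in the operation giving (h, g) ↦ h⁻¹ g.
corr : ∀ {v} → (Fin v → Fin v → Fin v) → (Fin v → ℤ) → Fin v → ℤ
corr ldiv a h = sumFin (λ g → a g ℤ.* a (ldiv h g))

-- D D^{(-1)} = n, i.e. coefficient n at the identity e and 0 elsewhere.
WeighingCond : ∀ {v} → (Fin v → Fin v → Fin v) → Fin v → ℕ → (Fin v → ℤ) → Set
WeighingCond ldiv e n a =
  (∀ g → Trit (a g)) ×
  (∀ h → corr ldiv a h ≡ (if ⌊ h Fin.≟ e ⌋ then + n else 0ℤ))

IW : ∀ {v} → FinAbGroup v → ℕ → Set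
IW {v} G n = Σ (Fin v → ℤ) (WeighingCond (λ h g → (h ⁻¹) ∙ g) ε n)
  where open FinAbGroup G

-- Cyclic group C_v on Fin v (v ≥ 1), written additively mod v:
-- h⁻¹ g corresponds to (g - h) mod v = (g + (v - h)) mod v.
cycSub : ∀ {k} → Fin (suc k) → Fin (suc k) → Fin (suc k)
cycSub {k} h g =
  fromℕ< (m%n<n (toℕ g ℕ.+ (suc k ℕ.∸ toℕ h)) (suc k))

-- CW(v,n): a C_v-invariant IW(v,n). There is no cyclic group of order 0.
CW : ℕ → ℕ → Set
CW zero    n = ⊥
CW (suc k) n = Σ (Fin (suc k) → ℤ) (WeighingCond cycSub Fin.zero n)

{-# OPTIONS --safe #-}
module Submission where

-- A weighing matrix is an element x of an integral group ring with x x̄ = n.  Let σ be induced by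
-- g ↦ g^t, where t is chosen so that σ fixes all prime ideals above n in a suitable cyclotomic
-- quotient of the group ring.  Then n divides σ(x) x̄, so σ(x) = E x with E Ē = 1, and a comparison
-- of norms shows that E is up to sign a group element.  Hence the projection of x onto the
-- characters of maximal order is invariant up to sign under an affine map y ↦ t y + s of a cyclic
-- group.  The orbit of a point which is not fixed contains its translate by an element of prime
-- order, so this projection is supported on the set B of fixed points.  Taking norms,
-- n ∏ (1 - 1/p) ≤ |B| κ², where κ bounds the coefficients of x and p runs over the primes dividing
-- the order of the group.  This fails in all the cases considered.  In the noncyclic cases the
-- group first has to be mapped to a cyclic one with small fibres.

open import Defs
open import Data.Nat using (ℕ; _+_; _*_; _^_; _∸_; _≤_)
open import Data.Product using (_×_)
open import Relation.Nullary using (¬_)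
open import Data.Nat as ℕ using (zero; suc; NonZero; _<_)
open import Data.Nat.Divisibility as ℕ∣ using (divides)
open import Data.Nat.Primality using (Prime; euclidsLemma; prime⇒nonZero; prime⇒nonTrivial; prime⇒irreducible; prime?)
open import Data.Product using (∃; _,_; proj₁; proj₂; ∃₂; uncurry)
open import Data.Sum using (_⊎_; inj₁; inj₂; [_,_]′)
open import Data.Fin as Fin using (Fin; toℕ; fromℕ<; combine; remQuot)
open import Data.Empty using (⊥)
open import Relation.Nullary using (Dec; yes; no; contradiction; ¬?)
open import Relation.Binary.PropositionalEquality as ≡ using (_≡_; refl; cong; cong₂; sym; trans; subst; _≢_)
open import Algebra.Bundles using (CommutativeRing; AbelianGroup)
open import Level using (_⊔_; 0ℓ)
open import Data.Integer as ℤ using (ℤ; +_; -[1+_]; 0ℤ; 1ℤ; -1ℤ)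
open import Data.List using (List; []; _∷_; _++_; map; replicate)
open import Data.List.Relation.Unary.All as All using (All; []; _∷_)
open import Data.Nat.DivMod using (_%_; _/_; m≡m%n+[m/n]*n; m%n<n; [m+kn]%n≡m%n; m<n⇒m%n≡m)
open import Data.Bool using (if_then_else_)
open import Relation.Nullary.Decidable using (⌊_⌋; toWitness; True; decidable-stable)
open import Data.Nat.ListAction using (product)
open import Data.Nat.Coprimality as Coprimality using (Coprime; coprime-Bézout; coprime-divisor; coprime?)
open import Data.Nat.GCD using (module Bézout)
open import Data.List.Membership.Propositional using (_∈_)
open import Data.Fin.Permutation using (permutation)
open import Data.List.Relation.Unary.Any using (here; there)
open import Data.Nat.ListAction.Properties using (product-++)
open import Function.Definitions using (Injective)
open import Relation.Binary.Definitions using (tri<; tri≈; tri>)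
open import Data.Nat.Combinatorics using (nCn≡1; nC1≡n; nCk+nC[k+1]≡[n+1]C[k+1]) renaming (_C_ to _choose_)
import Data.Nat.Properties as ℕₚ
import Data.Nat.Tactic.RingSolver as ℕ-Solver
import Data.Fin.Properties as Finₚ
import Algebra.Properties.CommutativeSemiring.Binomial as Binomial
import Algebra.Properties.Semiring.Exp as Exp
import Algebra.Properties.CommutativeSemiring.Exp as CExp
import Algebra.Properties.Semiring.Mult as Mult
import Algebra.Properties.CommutativeMonoid.Sum as Sum
import Algebra.Solver.Ring.NaturalCoefficients.Default as NatCoefficients
import Algebra.Properties.Ring as RingProperties
import Relation.Binary.Reasoning.Setoid as SetoidReasoning
import Data.Integer.Properties as ℤₚ
import Data.Integer.Tactic.RingSolver as ℤ-Solver
import Data.List.Properties as Listₚ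
import Algebra.Properties.Group as GroupProperties
import Data.List.Relation.Unary.All.Properties as Allₚ
import Algebra.Solver.CommutativeMonoid as CommutativeMonoidSolver

-- Congruences in a commutative ring

nC0≡1 : ∀ n → n choose 0 ≡ 1
nC0≡1 zero    = refl
nC0≡1 (suc n) = refl

C-absorb : ∀ n k → suc k * (suc n choose suc k) ≡ suc n * (n choose k)
C-absorb zero zero    = refl
C-absorb zero (suc k) = ℕₚ.*-zeroʳ k
C-absorb (suc n) zero =
  trans (ℕₚ.*-identityˡ _) (trans (nC1≡n (suc (suc n)))
    (sym (trans (cong (suc (suc n) ℕ.*_) (nC0≡1 (suc n))) (ℕₚ.*-identityʳ _))))
C-absorb (suc n) (suc k) = begin
  suc (suc k) * (suc (suc n) choose suc (suc k))
    ≡⟨ cong (suc (suc k) ℕ.*_) (sym (nCk+nC[k+1]≡[n+1]C[k+1] (suc n) (suc k))) ⟩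
  suc (suc k) * (a + (suc n choose suc (suc k)))
    ≡⟨ ℕₚ.*-distribˡ-+ (suc (suc k)) a _ ⟩
  (a + suc k * a) + suc (suc k) * (suc n choose suc (suc k))
    ≡⟨ cong₂ (λ u v → (a + u) + v) (C-absorb n k) (C-absorb n (suc k)) ⟩
  (a + suc n * (n choose k)) + suc n * (n choose suc k)
    ≡⟨ ℕₚ.+-assoc a _ _ ⟩
  a + (suc n * (n choose k) + suc n * (n choose suc k))
    ≡⟨ cong (a ℕ.+_) (sym (ℕₚ.*-distribˡ-+ (suc n) (n choose k) (n choose suc k))) ⟩
  a + suc n * ((n choose k) + (n choose suc k))
    ≡⟨ cong (λ u → a + suc n * u) (nCk+nC[k+1]≡[n+1]C[k+1] n k) ⟩
  suc (suc n) * a ∎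
  where
  open ≡.≡-Reasoning
  a = suc n choose suc k

prime∣C : ∀ {n k} → Prime (suc n) → k < n → suc n ℕ∣.∣ (suc n choose suc k)
prime∣C {n} {k} pr k<n
  with euclidsLemma (suc k) (suc n choose suc k) pr
         (ℕ∣.divides (n choose k) (trans (C-absorb n k) (ℕₚ.*-comm (suc n) (n choose k))))
... | inj₁ h = contradiction (ℕ∣.∣⇒≤ h) (ℕₚ.<⇒≱ (ℕ.s≤s k<n))
... | inj₂ h = h

module RingCongruence {a ℓ} (A : CommutativeRing a ℓ) where
  open CommutativeRing A
    renaming (_+_ to _⊕_; _*_ to _⊗_; -_ to ⊖_; refl to ≈-refl; sym to ≈-sym; trans to ≈-trans)
  open Exp semiring renaming (_^_ to _↑_)
  open Mult semiring renaming (_×_ to _·_)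
  open Sum +-commutativeMonoid using (sum; sum-init-last; sum-cong-≋)

  open NatCoefficients commutativeSemiring using (solve; _:+_; _:*_; _:=_; con)
  open RingProperties ring using (-‿+-comm; -‿distribʳ-*; -‿distribˡ-*)

  infix 4 _≡_[_] _∣_

  record _≡_[_] (x y m : Carrier) : Set (a ⊔ ℓ) where
    constructor _,_
    field
      cofactor : Carrier
      equality : x ≈ y ⊕ m ⊗ cofactor
  open _≡_[_] public

  _∣_ : Carrier → Carrier → Set _
  m ∣ x = x ≡ 0# [ m ]

  private
    module Aux where
      refl[] : ∀ y m → y ≈ y ⊕ m ⊗ 0#
      refl[] = solve 2 (λ y m → y := y :+ m :* con 0) ≈-refl
      trans[] : ∀ y m c d → (y ⊕ m ⊗ c) ⊕ m ⊗ d ≈ y ⊕ m ⊗ (c ⊕ d)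
      trans[] = solve 4 (λ y m c d → (y :+ m :* c) :+ m :* d := y :+ m :* (c :+ d)) ≈-refl
      sym[] : ∀ y m c → y ≈ (y ⊕ m ⊗ c) ⊕ m ⊗ (⊖ c)
      sym[] y m c = ≈-sym (≈-trans (trans[] y m c (⊖ c))
        (≈-trans (+-congˡ (*-congˡ (-‿inverseʳ c))) (≈-sym (refl[] y m))))
      +[] : ∀ x y m c d → (x ⊕ m ⊗ c) ⊕ (y ⊕ m ⊗ d) ≈ (x ⊕ y) ⊕ m ⊗ (c ⊕ d)
      +[] = solve 5 (λ x y m c d → (x :+ m :* c) :+ (y :+ m :* d) := (x :+ y) :+ m :* (c :+ d)) ≈-refl
      *[] : ∀ x y m c d → (x ⊕ m ⊗ c) ⊗ (y ⊕ m ⊗ d) ≈ (x ⊗ y) ⊕ m ⊗ (c ⊗ (y ⊕ m ⊗ d) ⊕ x ⊗ d)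
      *[] = solve 5 (λ x y m c d → (x :+ m :* c) :* (y :+ m :* d)
                := (x :* y) :+ m :* (c :* (y :+ m :* d) :+ x :* d)) ≈-refl
      -[] : ∀ x m c → ⊖ (x ⊕ m ⊗ c) ≈ (⊖ x) ⊕ m ⊗ (⊖ c)
      -[] x m c = ≈-trans (≈-sym (-‿+-comm x (m ⊗ c))) (+-congˡ (-‿distribʳ-* m c))

  ≈⇒≡[] : ∀ {x y} m → x ≈ y → x ≡ y [ m ]
  ≈⇒≡[] {x} {y} m e = 0# , ≈-trans e (Aux.refl[] y m)

  quotientRing : Carrier → CommutativeRing a _
  quotientRing m = record
    { Carrier = Carrier ; _≈_ = λ x y → x ≡ y [ m ] ; _+_ = _⊕_ ; _*_ = _⊗_ ; -_ = ⊖_ ; 0# = 0# ; 1# = 1#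
    ; isCommutativeRing = record
      { isRing = record
        { +-isAbelianGroup = record
          { isGroup = record
            { isMonoid = record
              { isSemigroup = record
                { isMagma = record
                  { isEquivalence = record
                    { refl  = ≈⇒≡[] m ≈-refl
                    ; sym   = λ { {x} {y} (c , e) → ⊖ c , ≈-trans (Aux.sym[] y m c) (+-congʳ (≈-sym e)) }
                    ; trans = λ { {x} {y} {z} (c , e) (d , f) →
                        d ⊕ c , ≈-trans e (≈-trans (+-congʳ f) (Aux.trans[] z m d c)) }
                    }
                  ; ∙-cong = λ { (c , e) (d , f) → c ⊕ d , ≈-trans (+-cong e f) (Aux.+[] _ _ m c d) }
                  }
                ; assoc = λ x y z → ≈⇒≡[] m (+-assoc x y z)
                }
              ; identity = (λ x → ≈⇒≡[] m (+-identityˡ x)) , (λ x → ≈⇒≡[] m (+-identityʳ x))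
              }
            ; inverse = (λ x → ≈⇒≡[] m (-‿inverseˡ x)) , (λ x → ≈⇒≡[] m (-‿inverseʳ x))
            ; ⁻¹-cong = λ { (c , e) → ⊖ c , ≈-trans (-‿cong e) (Aux.-[] _ m c) }
            }
          ; comm = λ x y → ≈⇒≡[] m (+-comm x y)
          }
        ; *-cong = λ { {x} {y} {u} {v} (c , e) (d , f) → c ⊗ (v ⊕ m ⊗ d) ⊕ y ⊗ d , ≈-trans (*-cong e f) (Aux.*[] _ _ m c d) }
        ; *-assoc = λ x y z → ≈⇒≡[] m (*-assoc x y z)
        ; *-identity = (λ x → ≈⇒≡[] m (*-identityˡ x)) , (λ x → ≈⇒≡[] m (*-identityʳ x))
        ; distrib = (λ x y z → ≈⇒≡[] m (distribˡ x y z)) , (λ x y z → ≈⇒≡[] m (distribʳ x y z))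
        }
      ; *-comm = λ x y → ≈⇒≡[] m (*-comm x y)
      }
    }

  ≡[]-mono : ∀ {x y m n} → m ∣ n → x ≡ y [ n ] → x ≡ y [ m ]
  ≡[]-mono {x} {y} {m} {n} (c , e) (d , f) = c ⊗ d , ≈-trans f (+-congˡ (≈-trans (*-congʳ e) (aux m c d)))
    where
    aux : ∀ m c d → (0# ⊕ m ⊗ c) ⊗ d ≈ m ⊗ (c ⊗ d)
    aux = solve 3 (λ m c d → (con 0 :+ m :* c) :* d := m :* (c :* d)) ≈-refl

  ∣-sum : ∀ {n} m (t : Fin n → Carrier) → (∀ i → m ∣ t i) → m ∣ sum t
  ∣-sum {zero}  m t h = ≈⇒≡[] m ≈-refl
  ∣-sum {suc n} m t h with h Fin.zero | ∣-sum m (λ i → t (Fin.suc i)) (λ i → h (Fin.suc i))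
  ... | c , e | d , f = c ⊕ d , ≈-trans (+-cong e f) (aux m c d)
    where
    aux : ∀ m c d → (0# ⊕ m ⊗ c) ⊕ (0# ⊕ m ⊗ d) ≈ 0# ⊕ m ⊗ (c ⊕ d)
    aux = solve 3 (λ m c d → (con 0 :+ m :* c) :+ (con 0 :+ m :* d) := con 0 :+ m :* (c :+ d)) ≈-refl

  -- The coefficients are kept abstract: unfolding _choose_ is prohibitively expensive.
  module _ (n : ℕ) (c : ℕ → ℕ) (c0≡1 : c 0 ≡ 1) (cp≡1 : c (suc n) ≡ 1)
           (p∣c : ∀ {k} → k < n → suc n ℕ∣.∣ c (suc k)) (u w : Carrier) where
    open SetoidReasoning setoid

    private
      p = suc n

      binomialTerm : Fin (suc p) → Carrier
      binomialTerm i = c (toℕ i) · ((w ↑ toℕ i) ⊗ (u ↑ (p ∸ toℕ i)))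

      middle : Fin n → Carrier
      middle i = c (suc (toℕ i)) · ((w ↑ suc (toℕ i)) ⊗ (u ↑ (n ∸ toℕ i)))

      middle∣ : ∀ i → ((p · 1#) ⊗ w) ∣ middle i
      middle∣ i with p∣c (Finₚ.toℕ<n i)
      ... | divides q e = (q · 1#) ⊗ (w ↑ toℕ i ⊗ u ↑ (n ∸ toℕ i)) , (begin
        c (suc (toℕ i)) · z            ≈⟨ ×-congˡ e ⟩
        (q * p) · z                  ≈⟨ ×-congʳ (q * p) (≈-sym (*-identityˡ z)) ⟩
        (q * p) · (1# ⊗ z)           ≈⟨ ≈-sym (×-assoc-* (q * p) 1# z) ⟩
        ((q * p) · 1#) ⊗ z           ≈⟨ *-congʳ (×1-homo-* q p) ⟩
        ((q · 1#) ⊗ (p · 1#)) ⊗ z      ≈⟨ rearrange _ _ _ _ _ ⟩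
        0# ⊕ ((p · 1#) ⊗ w) ⊗ ((q · 1#) ⊗ (w ↑ toℕ i ⊗ u ↑ (n ∸ toℕ i))) ∎)
        where
        z = (w ↑ suc (toℕ i)) ⊗ (u ↑ (n ∸ toℕ i))
        rearrange : ∀ a b w x y → (a ⊗ b) ⊗ ((w ⊗ x) ⊗ y) ≈ 0# ⊕ (b ⊗ w) ⊗ (a ⊗ (x ⊗ y))
        rearrange = solve 5 (λ a b w x y → (a :* b) :* ((w :* x) :* y) := con 0 :+ (b :* w) :* (a :* (x :* y))) ≈-refl

      first : binomialTerm Fin.zero ≈ u ↑ p
      first = ≈-trans (×-congˡ c0≡1) (≈-trans (×-homo-1 _) (*-identityˡ _))

      mid : ∀ i → binomialTerm (Fin.suc (Fin.inject₁ i)) ≈ middle i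
      mid i = reflexive (cong (λ j → c (suc j) · ((w ↑ suc j) ⊗ (u ↑ (n ∸ j)))) (Finₚ.toℕ-inject₁ i))

      last : binomialTerm (Fin.suc (Fin.fromℕ n)) ≈ w ↑ p
      last = begin
        binomialTerm (Fin.suc (Fin.fromℕ n))
          ≈⟨ reflexive (cong (λ j → c (suc j) · ((w ↑ suc j) ⊗ (u ↑ (n ∸ j)))) (Finₚ.toℕ-fromℕ n)) ⟩
        c p · ((w ↑ p) ⊗ (u ↑ (n ∸ n)))
          ≈⟨ ×-cong cp≡1 (*-congˡ (^-congʳ u (ℕₚ.n∸n≡0 n))) ⟩
        1 · ((w ↑ p) ⊗ 1#) ≈⟨ ≈-trans (×-homo-1 _) (*-identityʳ _) ⟩
        w ↑ p ∎

    binomialSum : sum binomialTerm ≡ u ↑ p ⊕ w ↑ p [ (p · 1#) ⊗ w ]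
    binomialSum with ∣-sum ((p · 1#) ⊗ w) middle middle∣
    ... | d , e = d , (begin
      binomialTerm Fin.zero ⊕ sum (λ i → binomialTerm (Fin.suc i))
        ≈⟨ +-cong first (≈-trans (sum-init-last (λ i → binomialTerm (Fin.suc i)))
             (+-cong (≈-trans (sum-cong-≋ mid) e) last)) ⟩
      u ↑ p ⊕ ((0# ⊕ ((p · 1#) ⊗ w) ⊗ d) ⊕ w ↑ p) ≈⟨ rearrange _ _ _ _ ⟩
      (u ↑ p ⊕ w ↑ p) ⊕ ((p · 1#) ⊗ w) ⊗ d ∎)
      where
      rearrange : ∀ a b m c → a ⊕ ((0# ⊕ m ⊗ c) ⊕ b) ≈ (a ⊕ b) ⊕ m ⊗ c
      rearrange = solve 4 (λ a b m c → a :+ ((con 0 :+ m :* c) :+ b) := (a :+ b) :+ m :* c) ≈-refl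

  [u+w]^p : ∀ {p} → Prime p → ∀ u w → (u ⊕ w) ↑ p ≡ u ↑ p ⊕ w ↑ p [ (p · 1#) ⊗ w ]
  [u+w]^p {suc n} pr u w = cofactor expansion , ≈-trans (^-congˡ (suc n) (+-comm u w))
                      (≈-trans (Binomial.theorem commutativeSemiring (suc n) w u) (equality expansion))
    where expansion = binomialSum n (suc n choose_) (nC0≡1 (suc n)) (nCn≡1 (suc n)) (prime∣C pr) u w

  ∣-⊗ʳ : ∀ {m x} y → m ∣ x → m ∣ x ⊗ y
  ∣-⊗ʳ {m} y (c , e) = c ⊗ y , ≈-trans (*-congʳ e) (aux m c y)
    where
    aux : ∀ m c y → (0# ⊕ m ⊗ c) ⊗ y ≈ 0# ⊕ m ⊗ (c ⊗ y)
    aux = solve 3 (λ m c y → (con 0 :+ m :* c) :* y := con 0 :+ m :* (c :* y)) ≈-refl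

  ∣-⊗ : ∀ {m n x y} → m ∣ x → n ∣ y → m ⊗ n ∣ x ⊗ y
  ∣-⊗ {m} {n} (c , e) (d , f) = c ⊗ d , ≈-trans (*-cong e f) (aux m n c d)
    where
    aux : ∀ m n c d → (0# ⊕ m ⊗ c) ⊗ (0# ⊕ n ⊗ d) ≈ 0# ⊕ (m ⊗ n) ⊗ (c ⊗ d)
    aux = solve 4 (λ m n c d → (con 0 :+ m :* c) :* (con 0 :+ n :* d) := con 0 :+ (m :* n) :* (c :* d)) ≈-refl

  ∣-↑ : ∀ {m x} n → m ∣ x → m ↑ n ∣ x ↑ n
  ∣-↑ {m} {x} zero    h = 1# , solve 0 (con 1 := con 0 :+ con 1 :* con 1) ≈-refl
  ∣-↑ {m} {x} (suc n) h = ∣-⊗ h (∣-↑ n h)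

  ∣-refl : ∀ m → m ∣ m
  ∣-refl m = 1# , solve 1 (λ m → m := con 0 :+ m :* con 1) ≈-refl m

  ∣-resp : ∀ {m x y} → x ≈ y → m ∣ x → m ∣ y
  ∣-resp e (c , f) = c , ≈-trans (≈-sym e) f

  ∣-trans : ∀ {m n x} → m ∣ n → n ∣ x → m ∣ x
  ∣-trans = ≡[]-mono

  module PowerLift {p} (pr : Prime p) (π : Carrier) (π∣p : π ∣ p · 1#) where

    pow-lift : ∀ {a b} i → a ≡ b [ π ↑ suc i ] → a ↑ p ≡ b ↑ p [ π ↑ suc (suc i) ]
    pow-lift {a} {b} i (c , e) =
      trans[] (≈⇒≡[] (π ↑ suc (suc i)) (^-congˡ p e))
        (trans[] (≡[]-mono (∣-⊗ π∣p (∣-w c)) ([u+w]^p pr b w))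
          (trans[] (+-cong[] (refl[] {b ↑ p}) (w^p∣ pr)) (≈⇒≡[] _ (+-identityʳ _))))
      where
      open CommutativeRing (quotientRing (π ↑ suc (suc i))) using ()
        renaming (trans to trans[]; refl to refl[]; +-cong to +-cong[])
      w = π ↑ suc i ⊗ c
      ∣-w : ∀ c → π ↑ suc i ∣ π ↑ suc i ⊗ c
      ∣-w c = ∣-⊗ʳ c (∣-refl _)
      w^p∣ : ∀ {p} → Prime p → π ↑ suc (suc i) ∣ w ↑ p
      w^p∣ {suc (suc n)} _ = ∣-resp (*-assoc _ _ _) (∣-⊗ʳ (w ↑ n) (∣-⊗ π∣w (∣-w c)))
        where π∣w = ∣-⊗ʳ c (∣-⊗ʳ (π ↑ i) (∣-refl π))

    pow-lifts : ∀ {a b} j → a ≡ b [ π ] → a ↑ (p ^ j) ≡ b ↑ (p ^ j) [ π ↑ suc j ]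
    pow-lifts {a} {b} zero h =
      trans[] (≈⇒≡[] _ (*-identityʳ a)) (trans[] (≡[]-mono (1# , aux π) h) (≈⇒≡[] _ (≈-sym (*-identityʳ b))))
      where
      open CommutativeRing (quotientRing (π ↑ 1)) using () renaming (trans to trans[])
      aux : ∀ x → x ≈ 0# ⊕ (x ⊗ 1#) ⊗ 1#
      aux = solve 1 (λ x → x := con 0 :+ (x :* con 1) :* con 1) ≈-refl
    pow-lifts {a} {b} (suc j) h =
      trans[] (≈⇒≡[] _ (power a)) (trans[] (pow-lift j (pow-lifts j h)) (≈⇒≡[] _ (≈-sym (power b))))
      where
      open CommutativeRing (quotientRing (π ↑ suc (suc j))) using () renaming (trans to trans[])
      power : ∀ x → x ↑ (p ^ suc j) ≈ (x ↑ (p ^ j)) ↑ p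
      power x = ≈-trans (^-congʳ x (ℕₚ.*-comm p (p ^ j))) (≈-sym (^-assocʳ x (p ^ j) p))

  module Frobenius {p} (pr : Prime p) where
    open CommutativeRing (quotientRing (p · 1#)) using ()
      renaming (trans to trans[]; refl to refl[]; sym to sym[]; +-cong to +-cong[])

    frobenius-⊕ : ∀ u w → (u ⊕ w) ↑ p ≡ u ↑ p ⊕ w ↑ p [ p · 1# ]
    frobenius-⊕ u w = ≡[]-mono (∣-⊗ʳ w (∣-refl (p · 1#))) ([u+w]^p pr u w)

    Fixed : Carrier → Set _
    Fixed u = u ↑ p ≡ u [ p · 1# ]

    fixed-0 : Fixed 0#
    fixed-0 = zero-power pr
      where
      zero-power : ∀ {n m} → Prime n → 0# ↑ n ≡ 0# [ m ]
      zero-power {suc n} _ = ≈⇒≡[] _ (zeroˡ _)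

    fixed-1 : Fixed 1#
    fixed-1 = ≈⇒≡[] _ (one-power p)
      where
      one-power : ∀ n → 1# ↑ n ≈ 1#
      one-power zero    = ≈-refl
      one-power (suc n) = ≈-trans (*-identityˡ _) (one-power n)

    fixed-⊕ : ∀ {u w} → Fixed u → Fixed w → Fixed (u ⊕ w)
    fixed-⊕ {u} {w} fu fw = trans[] (frobenius-⊕ u w) (+-cong[] fu fw)

    fixed-· : ∀ n → Fixed (n · 1#)
    fixed-· zero    = fixed-0
    fixed-· (suc n) = fixed-⊕ fixed-1 (fixed-· n)

    fixed-⊖ : ∀ {u} → Fixed u → Fixed (⊖ u)
    fixed-⊖ {u} fu =
      trans[] (≈⇒≡[] _ (cancel u _))
        (trans[] (+-cong[] refl[] (trans[] (+-cong[] (sym[] fu) refl[])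
          (trans[] (sym[] (frobenius-⊕ u (⊖ u))) (trans[] (≈⇒≡[] _ (^-congˡ p (-‿inverseʳ u))) fixed-0))))
          (≈⇒≡[] _ (+-identityʳ _)))
      where
      cancel : ∀ u v → v ≈ (⊖ u) ⊕ (u ⊕ v)
      cancel u v = ≈-sym (≈-trans (≈-sym (+-assoc _ u v)) (≈-trans (+-congʳ (-‿inverseˡ u)) (+-identityˡ v)))

  -- If q ∣ xy then x is, residue field by residue field, either a unit or divisible by π.
  -- The power W of 1 - x^(Q-1) is an approximate idempotent selecting the fields of the second
  -- kind: it fixes y modulo q, its class is fixed by σ, and W x = π x″.  Hence (x , y) may be
  -- traded for (x″ , π y), until π has become divisible by q.
  module MultiplierLemma
    (σ : Carrier → Carrier)
    (σ-cong : ∀ {x y} → x ≈ y → σ x ≈ σ y)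
    (σ-* : ∀ x y → σ (x ⊗ y) ≈ σ x ⊗ σ y)
    (σ-1 : σ 1# ≈ 1#)
    (π q : Carrier)
    (π∣σπ : π ∣ σ π)
    (Q N s : ℕ)
    (x^Q≡x : ∀ x → x ↑ suc (suc Q) ≡ x [ π ])
    (σx≡x^s : ∀ x → σ x ≡ x ↑ s [ π ])
    (pow-N : ∀ {a b} → a ≡ b [ π ] → a ↑ suc N ≡ b ↑ suc N [ q ])
    where
    open CommutativeRing (quotientRing q) using ()
      renaming (_≈_ to _≋_; setoid to setoid[]; *-cong to *-cong[]; refl to refl[]; sym to sym[]; trans to trans[])
    open SetoidReasoning setoid[]

    private
      σ-↑ : ∀ x n → σ (x ↑ n) ≈ σ x ↑ n
      σ-↑ x zero    = σ-1
      σ-↑ x (suc n) = ≈-trans (σ-* x (x ↑ n)) (*-congˡ (σ-↑ x n))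

    multiplier-step : ∀ j {x y} → q ∣ π ↑ j ⊗ y → q ∣ x ⊗ y → q ∣ σ x ⊗ y
    multiplier-step zero {x} {y} q∣y _ =
      trans[] (≈⇒≡[] q (*-comm (σ x) y)) (∣-⊗ʳ (σ x) (∣-resp (*-identityˡ y) q∣y))
    multiplier-step (suc j) {x} {y} q∣πy q∣xy = begin
      σ x ⊗ y                     ≈⟨ *-cong[] refl[] (sym[] (w-fixes (s * suc N))) ⟩
      σ x ⊗ (w ↑ (s * suc N) ⊗ y) ≈⟨ *-cong[] refl[] (*-cong[] (sym[] σW≡) refl[]) ⟩
      σ x ⊗ (σ W ⊗ y)             ≈⟨ ≈⇒≡[] q (swap (σ x) (σ W) y) ⟩
      (σ W ⊗ σ x) ⊗ y             ≈⟨ ≈⇒≡[] q (*-congʳ (≈-trans (≈-sym (σ-* W x)) (≈-trans (σ-cong Wx≈) (σ-* π x″)))) ⟩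
      (σ π ⊗ σ x″) ⊗ y            ≈⟨ ≈⇒≡[] q (*-congʳ (*-congʳ (equality π∣σπ))) ⟩
      ((0# ⊕ π ⊗ ε) ⊗ σ x″) ⊗ y   ≈⟨ ≈⇒≡[] q (regroup π ε (σ x″) y) ⟩
      (σ x″ ⊗ (π ⊗ y)) ⊗ ε        ≈⟨ ∣-⊗ʳ ε (multiplier-step j q∣π^j[πy] q∣x″[πy]) ⟩
      0# ∎
      where
      ε = cofactor π∣σπ
      w = 1# ⊕ (⊖ (x ↑ suc Q))
      W = w ↑ suc N
      c = cofactor (x^Q≡x x)
      x″ = (⊖ c) ⊗ w ↑ N

      swap : ∀ a b y → a ⊗ (b ⊗ y) ≈ (b ⊗ a) ⊗ y
      swap = solve 3 (λ a b y → a :* (b :* y) := (b :* a) :* y) ≈-refl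
      regroup : ∀ π ε a y → ((0# ⊕ π ⊗ ε) ⊗ a) ⊗ y ≈ (a ⊗ (π ⊗ y)) ⊗ ε
      regroup = solve 4 (λ π ε a y → ((con 0 :+ π :* ε) :* a) :* y := (a :* (π :* y)) :* ε) ≈-refl

      w⊗ : ∀ z → w ⊗ z ≈ z ⊕ (⊖ (x ↑ suc Q ⊗ z))
      w⊗ z = ≈-trans (distribʳ z 1# _) (+-cong (*-identityˡ z) (≈-sym (-‿distribˡ-* _ z)))

      wx≈ : w ⊗ x ≈ π ⊗ (⊖ c)
      wx≈ = ≈-trans (w⊗ x) (≈-trans (+-congˡ (-‿cong (≈-trans (*-comm _ x) (equality (x^Q≡x x)))))
        (≈-trans (+-congˡ (≈-sym (-‿+-comm x (π ⊗ c)))) (≈-trans (≈-sym (+-assoc x (⊖ x) _))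
          (≈-trans (+-congʳ (-‿inverseʳ x)) (≈-trans (+-identityˡ _) (-‿distribʳ-* π c))))))

      Wx≈ : W ⊗ x ≈ π ⊗ x″
      Wx≈ = ≈-trans (aux w (w ↑ N) x) (≈-trans (*-congʳ wx≈) (*-assoc π (⊖ c) _))
        where
        aux : ∀ a b x → (a ⊗ b) ⊗ x ≈ (a ⊗ x) ⊗ b
        aux = solve 3 (λ a b x → (a :* b) :* x := (a :* x) :* b) ≈-refl

      wy≡y : w ⊗ y ≋ y
      wy≡y = ⊖ (cofactor xQy) , ≈-trans (w⊗ y) (+-congˡ (≈-trans (-‿cong (≈-trans (equality xQy) (+-identityˡ _)))
                                                    (-‿distribʳ-* q _)))
        where
        xQy : q ∣ x ↑ suc Q ⊗ y
        xQy = ∣-resp (aux x (x ↑ Q) y) (∣-⊗ʳ (x ↑ Q) q∣xy)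
          where
          aux : ∀ x b y → (x ⊗ y) ⊗ b ≈ (x ⊗ b) ⊗ y
          aux = solve 3 (λ x b y → (x :* y) :* b := (x :* b) :* y) ≈-refl

      w-fixes : ∀ i → w ↑ i ⊗ y ≋ y
      w-fixes zero    = ≈⇒≡[] q (*-identityˡ y)
      w-fixes (suc i) = trans[] (≈⇒≡[] q (*-assoc w (w ↑ i) y)) (trans[] (*-cong[] refl[] (w-fixes i)) wy≡y)

      σW≡ : σ W ≋ w ↑ (s * suc N)
      σW≡ = trans[] (≈⇒≡[] q (σ-↑ w (suc N)))
              (trans[] (pow-N (σx≡x^s w)) (≈⇒≡[] q (^-assocʳ w s (suc N))))

      q∣π^j[πy] : q ∣ π ↑ j ⊗ (π ⊗ y)
      q∣π^j[πy] = ∣-resp (aux π (π ↑ j) y) q∣πy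
        where
        aux : ∀ π b y → (π ⊗ b) ⊗ y ≈ b ⊗ (π ⊗ y)
        aux = solve 3 (λ π b y → (π :* b) :* y := b :* (π :* y)) ≈-refl

      q∣x″[πy] : q ∣ x″ ⊗ (π ⊗ y)
      q∣x″[πy] = ∣-resp (≈-trans (aux x y W) (≈-trans (*-congʳ Wx≈) (aux′ π x″ y))) (∣-⊗ʳ W q∣xy)
        where
        aux : ∀ x y w → (x ⊗ y) ⊗ w ≈ (w ⊗ x) ⊗ y
        aux = solve 3 (λ x y w → (x :* y) :* w := (w :* x) :* y) ≈-refl
        aux′ : ∀ π x y → (π ⊗ x) ⊗ y ≈ x ⊗ (π ⊗ y)
        aux′ = solve 3 (λ π x y → (π :* x) :* y := x :* (π :* y)) ≈-refl

    multiplier : ∀ j → q ∣ π ↑ j → ∀ {x y} → q ∣ x ⊗ y → q ∣ σ x ⊗ y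
    multiplier j q∣π^j {x} {y} = multiplier-step j (∣-⊗ʳ y q∣π^j)

-- Integer combinations of shifts of sequences

-- (c , k) stands for c Sᵏ, where S is the shift (S f) y = f (1 + y).
Op : Set
Op = List (ℤ × ℕ)

Seq : Set
Seq = ℕ → ℤ

⟦_⟧ : Op → Seq → Seq
⟦ [] ⟧          f y = 0ℤ
⟦ (c , k) ∷ x ⟧ f y = c ℤ.* f (k + y) ℤ.+ ⟦ x ⟧ f y

infixl 7 _⋆_
_⋆_ : Op → Op → Op
[]            ⋆ z = []
((c , k) ∷ x) ⋆ z = map (λ (d , l) → c ℤ.* d , l + k) z ++ x ⋆ z

neg : Op → Op
neg = map (λ (c , k) → ℤ.- c , k)

dilate : ℕ → Op → Op
dilate t = map (λ (c , k) → c , t * k)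

const : ℤ → Op
const c = (c , 0) ∷ []

shift : ℕ → Op
shift k = (1ℤ , k) ∷ []

⟦⟧-cong : ∀ x {f g} → (∀ y → f y ≡ g y) → ∀ y → ⟦ x ⟧ f y ≡ ⟦ x ⟧ g y
⟦⟧-cong []            e y = refl
⟦⟧-cong ((c , k) ∷ x) e y = cong₂ (λ u v → c ℤ.* u ℤ.+ v) (e (k + y)) (⟦⟧-cong x e y)

⟦⟧-++ : ∀ x z f y → ⟦ x ++ z ⟧ f y ≡ ⟦ x ⟧ f y ℤ.+ ⟦ z ⟧ f y
⟦⟧-++ []            z f y = sym (ℤₚ.+-identityˡ _)
⟦⟧-++ ((c , k) ∷ x) z f y = trans (cong (ℤ._+_ (c ℤ.* f (k + y))) (⟦⟧-++ x z f y)) (sym (ℤₚ.+-assoc (c ℤ.* f (k + y)) _ _))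

⟦⟧-shift : ∀ x k f y → ⟦ x ⟧ (λ i → f (k + i)) y ≡ ⟦ x ⟧ f (k + y)
⟦⟧-shift []            k f y = refl
⟦⟧-shift ((c , l) ∷ x) k f y =
  cong₂ (λ u v → c ℤ.* f u ℤ.+ v) (rearrange k l y) (⟦⟧-shift x k f y)
  where
  rearrange : ∀ k l y → k + (l + y) ≡ l + (k + y)
  rearrange = ℕ-Solver.solve-∀

⟦⟧-+ : ∀ x f g y → ⟦ x ⟧ (λ i → f i ℤ.+ g i) y ≡ ⟦ x ⟧ f y ℤ.+ ⟦ x ⟧ g y
⟦⟧-+ []            f g y = refl
⟦⟧-+ ((c , k) ∷ x) f g y = trans (cong (ℤ._+_ (c ℤ.* (f (k + y) ℤ.+ g (k + y)))) (⟦⟧-+ x f g y)) (rearrange c _ _ _ _)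
  where
  rearrange : ∀ c a b u v → c ℤ.* (a ℤ.+ b) ℤ.+ (u ℤ.+ v) ≡ (c ℤ.* a ℤ.+ u) ℤ.+ (c ℤ.* b ℤ.+ v)
  rearrange = ℤ-Solver.solve-∀

⟦⟧-* : ∀ x c f y → ⟦ x ⟧ (λ i → c ℤ.* f i) y ≡ c ℤ.* ⟦ x ⟧ f y
⟦⟧-* []            c f y = sym (ℤₚ.*-zeroʳ c)
⟦⟧-* ((d , k) ∷ x) c f y = trans (cong (ℤ._+_ (d ℤ.* (c ℤ.* f (k + y)))) (⟦⟧-* x c f y)) (rearrange c d _ _)
  where
  rearrange : ∀ c d a u → d ℤ.* (c ℤ.* a) ℤ.+ c ℤ.* u ≡ c ℤ.* (d ℤ.* a ℤ.+ u)
  rearrange = ℤ-Solver.solve-∀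

⟦⟧-0 : ∀ x y → ⟦ x ⟧ (λ _ → 0ℤ) y ≡ 0ℤ
⟦⟧-0 []            y = refl
⟦⟧-0 ((c , k) ∷ x) y = cong₂ ℤ._+_ (ℤₚ.*-zeroʳ c) (⟦⟧-0 x y)

⟦⟧-comm : ∀ x z f y → ⟦ x ⟧ (⟦ z ⟧ f) y ≡ ⟦ z ⟧ (⟦ x ⟧ f) y
⟦⟧-comm []            z f y = sym (⟦⟧-0 z y)
⟦⟧-comm ((c , k) ∷ x) z f y = sym (begin
  ⟦ z ⟧ (λ i → c ℤ.* f (k + i) ℤ.+ ⟦ x ⟧ f i) y
    ≡⟨ ⟦⟧-+ z (λ i → c ℤ.* f (k + i)) (⟦ x ⟧ f) y ⟩
  ⟦ z ⟧ (λ i → c ℤ.* f (k + i)) y ℤ.+ ⟦ z ⟧ (⟦ x ⟧ f) y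
    ≡⟨ cong₂ ℤ._+_ (trans (⟦⟧-* z c (λ i → f (k + i)) y) (cong (c ℤ.*_) (⟦⟧-shift z k f y))) (sym (⟦⟧-comm x z f y)) ⟩
  c ℤ.* ⟦ z ⟧ f (k + y) ℤ.+ ⟦ x ⟧ (⟦ z ⟧ f) y ∎)
  where open ≡.≡-Reasoning

⟦⟧-⋆ : ∀ x z f y → ⟦ x ⋆ z ⟧ f y ≡ ⟦ x ⟧ (⟦ z ⟧ f) y
⟦⟧-⋆ []            z f y = refl
⟦⟧-⋆ ((c , k) ∷ x) z f y = trans (⟦⟧-++ (map _ z) (x ⋆ z) f y) (cong₂ ℤ._+_ (scaled z) (⟦⟧-⋆ x z f y))
  where
  rearrange : ∀ c d a u → (c ℤ.* d) ℤ.* a ℤ.+ c ℤ.* u ≡ c ℤ.* (d ℤ.* a ℤ.+ u)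
  rearrange = ℤ-Solver.solve-∀
  scaled : ∀ z → ⟦ map (λ (d , l) → c ℤ.* d , l + k) z ⟧ f y ≡ c ℤ.* ⟦ z ⟧ f (k + y)
  scaled []            = sym (ℤₚ.*-zeroʳ c)
  scaled ((d , l) ∷ z) = trans
    (cong₂ (λ u v → (c ℤ.* d) ℤ.* f u ℤ.+ v) (ℕₚ.+-assoc l k y) (scaled z)) (rearrange c d _ _)

⟦⟧-neg : ∀ x f y → ⟦ neg x ⟧ f y ≡ ℤ.- ⟦ x ⟧ f y
⟦⟧-neg []            f y = refl
⟦⟧-neg ((c , k) ∷ x) f y = trans (cong (ℤ._+_ (ℤ.- c ℤ.* f (k + y))) (⟦⟧-neg x f y)) (rearrange c _ _)
  where
  rearrange : ∀ c a u → ℤ.- c ℤ.* a ℤ.+ ℤ.- u ≡ ℤ.- (c ℤ.* a ℤ.+ u)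
  rearrange = ℤ-Solver.solve-∀

⟦⟧-const : ∀ c f y → ⟦ const c ⟧ f y ≡ c ℤ.* f y
⟦⟧-const c f y = ℤₚ.+-identityʳ _

⟦⟧-Sh : ∀ k f y → ⟦ shift k ⟧ f y ≡ f (k + y)
⟦⟧-Sh k f y = trans (ℤₚ.+-identityʳ _) (ℤₚ.*-identityˡ _)

⟦⟧-dilate : ∀ t x f y → ⟦ dilate t x ⟧ f y ≡ ⟦ x ⟧ (λ k → f (t * k + y)) 0
⟦⟧-dilate t []            f y = refl
⟦⟧-dilate t ((c , k) ∷ x) f y =
  cong₂ (λ u v → c ℤ.* f (t * u + y) ℤ.+ v) (sym (ℕₚ.+-identityʳ k)) (⟦⟧-dilate t x f y)

dilate-⋆ : ∀ t x z → dilate t (x ⋆ z) ≡ dilate t x ⋆ dilate t z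
dilate-⋆ t []            z = refl
dilate-⋆ t ((c , k) ∷ x) z = trans (Listₚ.map-++ _ (map _ z) (x ⋆ z)) (cong₂ _++_ (scaled z) (dilate-⋆ t x z))
  where
  scaled : ∀ z → dilate t (map (λ (d , l) → c ℤ.* d , l + k) z)
               ≡ map (λ (d , l) → c ℤ.* d , l + t * k) (dilate t z)
  scaled []            = refl
  scaled ((d , l) ∷ z) = cong₂ _∷_ (cong (c ℤ.* d ,_) (ℕₚ.*-distribˡ-+ t l k)) (scaled z)

dilate-dilate : ∀ s t x → dilate s (dilate t x) ≡ dilate (s * t) x
dilate-dilate s t []            = refl
dilate-dilate s t ((c , k) ∷ x) = cong₂ _∷_ (cong (c ,_) (sym (ℕₚ.*-assoc s t k))) (dilate-dilate s t x)

Kills : List Op → Seq → Set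
Kills Z f = All (λ z → ∀ y → ⟦ z ⟧ f y ≡ 0ℤ) Z

Kills-act : ∀ {Z f} x → Kills Z f → Kills Z (⟦ x ⟧ f)
Kills-act {f = f} x = All.map (λ {z} h y → trans (⟦⟧-comm z x f y) (trans (⟦⟧-cong x h y) (⟦⟧-0 x y)))

-- ℤ[S] modulo the annihilator of the module of sequences killed by Z.  Being torsion free, it
-- allows cancelling integers.
module OperatorRing (Z : List Op) where

  infix 4 _≈_
  record _≈_ (x z : Op) : Set where
    constructor mk
    field on : ∀ f → Kills Z f → ∀ y → ⟦ x ⟧ f y ≡ ⟦ z ⟧ f y
  open _≈_ public

  everywhere : ∀ {x z} → (∀ f y → ⟦ x ⟧ f y ≡ ⟦ z ⟧ f y) → x ≈ z
  everywhere h = mk λ f _ → h f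

  operatorRing : CommutativeRing 0ℓ 0ℓ
  operatorRing = record
    { Carrier = Op ; _≈_ = _≈_ ; _+_ = _++_ ; _*_ = _⋆_ ; -_ = neg ; 0# = [] ; 1# = const 1ℤ
    ; isCommutativeRing = record
      { isRing = record
        { +-isAbelianGroup = record
          { isGroup = record
            { isMonoid = record
              { isSemigroup = record
                { isMagma = record
                  { isEquivalence = record
                    { refl  = mk λ f _ y → refl
                    ; sym   = λ e → mk λ f m y → sym (on e f m y)
                    ; trans = λ e e′ → mk λ f m y → trans (on e f m y) (on e′ f m y)
                    }
                  ; ∙-cong = λ {x} {y} {u} {v} e e′ → mk λ f m i → trans (⟦⟧-++ x u f i)
                      (trans (cong₂ ℤ._+_ (on e f m i) (on e′ f m i)) (sym (⟦⟧-++ y v f i)))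
                  }
                ; assoc = λ x y z → everywhere λ f i → cong (λ u → ⟦ u ⟧ f i) (Listₚ.++-assoc x y z)
                }
              ; identity = (λ x → everywhere λ f i → refl)
                         , (λ x → everywhere λ f i → cong (λ u → ⟦ u ⟧ f i) (Listₚ.++-identityʳ x))
              }
            ; inverse = (λ x → everywhere λ f i → trans (⟦⟧-++ (neg x) x f i)
                            (trans (cong (λ u → u ℤ.+ ⟦ x ⟧ f i) (⟦⟧-neg x f i)) (ℤₚ.+-inverseˡ (⟦ x ⟧ f i))))
                      , (λ x → everywhere λ f i → trans (⟦⟧-++ x (neg x) f i)
                            (trans (cong (ℤ._+_ (⟦ x ⟧ f i)) (⟦⟧-neg x f i)) (ℤₚ.+-inverseʳ (⟦ x ⟧ f i))))
            ; ⁻¹-cong = λ {x} {y} e → mk λ f m i →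
                trans (⟦⟧-neg x f i) (trans (cong ℤ.-_ (on e f m i)) (sym (⟦⟧-neg y f i)))
            }
          ; comm = λ x y → everywhere λ f i → trans (⟦⟧-++ x y f i)
              (trans (ℤₚ.+-comm (⟦ x ⟧ f i) _) (sym (⟦⟧-++ y x f i)))
          }
        ; *-cong = λ {x} {y} {u} {v} e e′ → mk λ f m i → trans (⟦⟧-⋆ x u f i)
            (trans (⟦⟧-cong x (on e′ f m) i) (trans (on e (⟦ v ⟧ f) (Kills-act v m) i) (sym (⟦⟧-⋆ y v f i))))
        ; *-assoc = λ x y z → everywhere λ f i → trans (⟦⟧-⋆ (x ⋆ y) z f i) (trans (⟦⟧-⋆ x y (⟦ z ⟧ f) i)
            (trans (⟦⟧-cong x (λ j → sym (⟦⟧-⋆ y z f j)) i) (sym (⟦⟧-⋆ x (y ⋆ z) f i))))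
        ; *-identity = (λ x → everywhere λ f i → trans (⟦⟧-⋆ (const 1ℤ) x f i) (⟦⟧-Sh 0 (⟦ x ⟧ f) i))
                     , (λ x → everywhere λ f i → trans (⟦⟧-⋆ x (const 1ℤ) f i) (⟦⟧-cong x (⟦⟧-Sh 0 f) i))
        ; distrib = (λ x y z → everywhere λ f i → trans (⟦⟧-⋆ x (y ++ z) f i)
                        (trans (⟦⟧-cong x (⟦⟧-++ y z f) i) (trans (⟦⟧-+ x (⟦ y ⟧ f) (⟦ z ⟧ f) i)
                          (trans (cong₂ ℤ._+_ (sym (⟦⟧-⋆ x y f i)) (sym (⟦⟧-⋆ x z f i)))
                                 (sym (⟦⟧-++ (x ⋆ y) (x ⋆ z) f i))))))
                  , (λ x y z → everywhere λ f i → trans (⟦⟧-⋆ (y ++ z) x f i)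
                        (trans (⟦⟧-++ y z (⟦ x ⟧ f) i)
                          (trans (cong₂ ℤ._+_ (sym (⟦⟧-⋆ y x f i)) (sym (⟦⟧-⋆ z x f i)))
                                 (sym (⟦⟧-++ (y ⋆ x) (z ⋆ x) f i)))))
        }
      ; *-comm = λ x y → everywhere λ f i →
          trans (⟦⟧-⋆ x y f i) (trans (⟦⟧-comm x y f i) (sym (⟦⟧-⋆ y x f i)))
      }
    }

infix 4 _≡_mod_
_≡_mod_ : ℕ → ℕ → ℕ → Set
a ≡ b mod m = ∃₂ λ i j → a + i * m ≡ b + j * m

dilate-1≡ : ∀ x → dilate 1 x ≡ x
dilate-1≡ []            = refl
dilate-1≡ ((c , k) ∷ x) = cong₂ _∷_ (cong (c ,_) (ℕₚ.*-identityˡ k)) (dilate-1≡ x)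

module OperatorCongruence (Z : List Op) where
  open OperatorRing Z public
  open RingCongruence operatorRing public
  open CommutativeRing operatorRing using (semiring; commutativeSemiring; 1#; reflexive; *-congˡ; +-congˡ; *-identityʳ; *-comm)
    renaming (refl to ≈-refl; sym to ≈-sym; trans to ≈-trans)
  open Exp semiring using (^-congˡ; ^-congʳ; ^-assocʳ) renaming (_^_ to _↑_)
  open CExp commutativeSemiring using (^-distrib-*)
  open Mult semiring using () renaming (_×_ to _·_)

  ·1≈const : ∀ n → n · 1# ≈ const (+ n)
  ·1≈const zero    = everywhere λ f y → refl
  ·1≈const (suc n) = ≈-trans (+-congˡ {const 1ℤ} (·1≈const n)) (everywhere λ f y →
    trans (⟦⟧-++ (const 1ℤ) (const (+ n)) f y)
      (trans (cong₂ ℤ._+_ (⟦⟧-const 1ℤ f y) (⟦⟧-const (+ n) f y))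
        (trans (sym (ℤₚ.*-distribʳ-+ (f y) 1ℤ (+ n))) (sym (⟦⟧-const (+ suc n) f y)))))

  shift-+ : ∀ k l → shift (k + l) ≈ shift k ⋆ shift l
  shift-+ k l = reflexive (cong shift (ℕₚ.+-comm k l))

  shift-* : ∀ j k → shift (j * k) ≈ shift k ↑ j
  shift-* zero    k = ≈-refl
  shift-* (suc j) k = ≈-trans (shift-+ k (j * k)) (*-congˡ {shift k} (shift-* j k))

  monomial : ∀ c k → (c , k) ∷ [] ≈ const c ⋆ shift k
  monomial c k = reflexive (cong₂ (λ u v → (u , v) ∷ []) (sym (ℤₚ.*-identityʳ c)) (sym (ℕₚ.+-identityʳ k)))

  module _ {p} (pr : Prime p) where
    open Frobenius pr
    open CommutativeRing (quotientRing (p · 1#)) using ()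
      renaming (trans to trans[]; refl to refl[]; +-cong to +-cong[]; *-cong to *-cong[])

    fixed-const : ∀ c → Fixed (const c)
    fixed-const c = trans[] (≈⇒≡[] _ (^-congˡ p (proj₂ (rep c)))) (trans[] (proj₁ (rep c)) (≈⇒≡[] _ (≈-sym (proj₂ (rep c)))))
      where
      rep′ : ∀ c → ∃ λ x → Fixed x × const c ≈ x
      rep′ (+ n)    = n · 1# , fixed-· n , ≈-sym (·1≈const n)
      rep′ -[1+ n ] = neg (suc n · 1#) , fixed-⊖ (fixed-· (suc n)) , ≈-sym (CommutativeRing.-‿cong operatorRing (·1≈const (suc n)))
      rep : ∀ c → Fixed (proj₁ (rep′ c)) × const c ≈ proj₁ (rep′ c)
      rep c = proj₂ (rep′ c)

    ^p≡dilate : ∀ x → x ↑ p ≡ dilate p x [ p · 1# ]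
    ^p≡dilate []            = fixed-0
    ^p≡dilate ((c , k) ∷ x) = trans[] (frobenius-⊕ ((c , k) ∷ []) x) (+-cong[] single (^p≡dilate x))
      where
      single : ((c , k) ∷ []) ↑ p ≡ (c , p * k) ∷ [] [ p · 1# ]
      single = trans[] (≈⇒≡[] _ (≈-trans (^-congˡ p (monomial c k)) (^-distrib-* (const c) (shift k) p)))
        (trans[] (*-cong[] (fixed-const c) (≈⇒≡[] _ (≈-sym (shift-* p k)))) (≈⇒≡[] _ (≈-sym (monomial c (p * k)))))

    ^p^j≡dilate : ∀ j x → x ↑ (p ^ j) ≡ dilate (p ^ j) x [ p · 1# ]
    ^p^j≡dilate zero    x = ≈⇒≡[] _ (≈-trans (*-identityʳ x) (reflexive (sym (dilate-1≡ x))))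
    ^p^j≡dilate (suc j) x =
      trans[] (≈⇒≡[] _ (≈-sym (^-assocʳ x p (p ^ j))))
        (trans[] (^-cong[] (p ^ j) (^p≡dilate x))
          (trans[] (^p^j≡dilate j (dilate p x))
            (≈⇒≡[] _ (reflexive (trans (dilate-dilate (p ^ j) p x) (cong (λ u → dilate u x) (ℕₚ.*-comm (p ^ j) p)))))))
      where
      ^-cong[] : ∀ n {x y} → x ≡ y [ p · 1# ] → x ↑ n ≡ y ↑ n [ p · 1# ]
      ^-cong[] zero    h = refl[]
      ^-cong[] (suc n) h = *-cong[] h (^-cong[] n h)

  module _ {π : Op} {w : ℕ} (shift-w : shift w ≡ const 1ℤ [ π ]) where
    open CommutativeRing (quotientRing π) using ()
      renaming (trans to trans[]; refl to refl[]; sym to sym[]; +-cong to +-cong[]; *-cong to *-cong[])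

    shift-j*w : ∀ j → shift (j * w) ≡ const 1ℤ [ π ]
    shift-j*w zero    = refl[]
    shift-j*w (suc j) = trans[] (≈⇒≡[] _ (shift-+ w (j * w))) (*-cong[] shift-w (shift-j*w j))

    shift-cong : ∀ {a b} → a ≡ b mod w → shift a ≡ shift b [ π ]
    shift-cong {a} {b} (i , j , e) = trans[] (sym[] (absorb a i)) (trans[] (≈⇒≡[] _ (reflexive (cong shift e))) (absorb b j))
      where
      absorb : ∀ a i → shift (a + i * w) ≡ shift a [ π ]
      absorb a i = trans[] (≈⇒≡[] _ (shift-+ a (i * w)))
        (trans[] (*-cong[] (refl[] {shift a}) (shift-j*w i)) (≈⇒≡[] _ (*-identityʳ (shift a))))

    dilate-cong : ∀ {s t} → s ≡ t mod w → ∀ x → dilate s x ≡ dilate t x [ π ]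
    dilate-cong h [] = refl[]
    dilate-cong {s} {t} (i , j , e) ((c , k) ∷ x) = +-cong[]
      (trans[] (≈⇒≡[] _ (monomial c (s * k))) (trans[]
        (*-cong[] (refl[] {const c}) (shift-cong (k * i , k * j , scale)))
        (≈⇒≡[] _ (≈-sym (monomial c (t * k))))))
      (dilate-cong (i , j , e) x)
      where
      rearrange : ∀ s k i w → s * k + (k * i) * w ≡ k * (s + i * w)
      rearrange = ℕ-Solver.solve-∀
      scale : s * k + (k * i) * w ≡ t * k + (k * j) * w
      scale = trans (rearrange s k i w) (trans (cong (k ℕ.*_) e) (sym (rearrange t k j w)))

  module DilationMultiplier
    {p} (pr : Prime p) {t w : ℕ} (π : Op)
    (invariant : ∀ {f} y → Kills Z f → Kills Z (λ k → f (t * k + y)))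
    (shift-w : shift w ≡ const 1ℤ [ π ])
    (π∣p : π ∣ p · 1#)
    (M : ℕ) (p∣π^M : p · 1# ∣ π ↑ M)
    (π∣dilate : π ∣ dilate t π)
    (s : ℕ) (p^s≡1 : (p ^ suc s) ≡ 1 mod w)
    (r : ℕ) (p^r≡t : (p ^ r) ≡ t mod w)
    where
    open PowerLift pr π π∣p
    open CommutativeRing (quotientRing π) using () renaming (trans to trans[]; sym to sym[]; reflexive to reflexive[])

    dilate-≈ : ∀ {x y} → x ≈ y → dilate t x ≈ dilate t y
    dilate-≈ {x} {y} e = mk λ f m i → trans (⟦⟧-dilate t x f i)
      (trans (on e _ (invariant i m) 0) (sym (⟦⟧-dilate t y f i)))

    private
      exponent : ∃ λ Q → p ^ suc s ≡ suc (suc Q)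
      exponent with p ^ suc s | ℕₚ.<-≤-trans (ℕ.nonTrivial⇒n>1 p ⦃ prime⇒nonTrivial pr ⦄) (ℕₚ.m≤m*n p (p ^ s) ⦃ ℕₚ.m^n≢0 p s ⦃ prime⇒nonZero pr ⦄ ⦄)
      ... | suc zero    | ℕ.s≤s ()
      ... | suc (suc Q) | _ = Q , refl

      predecessor : ∀ j → ∃ λ N → p ^ j ≡ suc N
      predecessor j with p ^ j | ℕₚ.m^n>0 p ⦃ prime⇒nonZero pr ⦄ j
      ... | suc N | _ = N , refl

    dilation-multiplier : ∀ K {x y} → (p · 1#) ↑ K ∣ x ⋆ y → (p · 1#) ↑ K ∣ dilate t x ⋆ y
    dilation-multiplier K {x} {y} = multiplier (M * K) q∣π^MK {x} {y}
      where
      q∣π^MK : (p · 1#) ↑ K ∣ π ↑ (M * K)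
      q∣π^MK = ∣-resp (^-assocʳ π M K) (∣-↑ K p∣π^M)
      N = predecessor (M * K)
      open CommutativeRing (quotientRing ((p · 1#) ↑ K)) using () renaming (trans to trans[]q)
      open MultiplierLemma (dilate t) dilate-≈ (λ x y → reflexive (dilate-⋆ t x y))
        (reflexive (cong (λ k → (1ℤ , k) ∷ []) (ℕₚ.*-zeroʳ t)))
        π ((p · 1#) ↑ K) π∣dilate (proj₁ exponent) (proj₁ N) (p ^ r)
        (λ x → trans[] (≈⇒≡[] π (^-congʳ x (sym (proj₂ exponent))))
          (trans[] (≡[]-mono π∣p (^p^j≡dilate pr (suc s) x))
            (trans[] (dilate-cong shift-w p^s≡1 x) (reflexive[] (dilate-1≡ x)))))
        (λ x → sym[] (trans[] (≡[]-mono π∣p (^p^j≡dilate pr r x)) (dilate-cong shift-w p^r≡t x)))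
        (λ {a} {b} h → trans[]q (≈⇒≡[] _ (^-congʳ a (sym (proj₂ N))))
          (trans[]q (≡[]-mono (∣-trans q∣π^MK (∣-resp (*-comm (π ↑ (M * K)) π) (∣-⊗ʳ π (∣-refl (π ↑ (M * K))))))
                      (pow-lifts (M * K) h))
            (≈⇒≡[] _ (^-congʳ b (proj₂ N)))))

-- Sums and the inner product of periodic sequences

module ℤ+ = GroupProperties (AbelianGroup.group ℤₚ.+-0-abelianGroup)

∑ : ℕ → Seq → ℤ
∑ zero    f = 0ℤ
∑ (suc n) f = ∑ n f ℤ.+ f n

∑-cong : ∀ n {f g} → (∀ y → f y ≡ g y) → ∑ n f ≡ ∑ n g
∑-cong zero    e = refl
∑-cong (suc n) e = cong₂ ℤ._+_ (∑-cong n e) (e n)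

∑-+ : ∀ n f g → ∑ n (λ y → f y ℤ.+ g y) ≡ ∑ n f ℤ.+ ∑ n g
∑-+ zero    f g = refl
∑-+ (suc n) f g = trans (cong (ℤ._+ (f n ℤ.+ g n)) (∑-+ n f g)) (rearrange (∑ n f) (∑ n g) (f n) (g n))
  where
  rearrange : ∀ a b c d → (a ℤ.+ b) ℤ.+ (c ℤ.+ d) ≡ (a ℤ.+ c) ℤ.+ (b ℤ.+ d)
  rearrange = ℤ-Solver.solve-∀

∑-* : ∀ n c f → ∑ n (λ y → c ℤ.* f y) ≡ c ℤ.* ∑ n f
∑-* zero    c f = sym (ℤₚ.*-zeroʳ c)
∑-* (suc n) c f = trans (cong (ℤ._+ (c ℤ.* f n)) (∑-* n c f)) (sym (ℤₚ.*-distribˡ-+ c _ _))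

∑-0 : ∀ n → ∑ n (λ _ → 0ℤ) ≡ 0ℤ
∑-0 zero    = refl
∑-0 (suc n) = trans (ℤₚ.+-identityʳ _) (∑-0 n)

∑-mono : ∀ n {f g} → (∀ y → f y ℤ.≤ g y) → ∑ n f ℤ.≤ ∑ n g
∑-mono zero    h = ℤₚ.≤-refl
∑-mono (suc n) h = ℤₚ.+-mono-≤ (∑-mono n h) (h n)

∑-head : ∀ n f → ∑ (suc n) f ≡ f 0 ℤ.+ ∑ n (λ y → f (suc y))
∑-head zero    f = trans (ℤₚ.+-identityˡ (f 0)) (sym (ℤₚ.+-identityʳ (f 0)))
∑-head (suc n) f = trans (cong (ℤ._+ f (suc n)) (∑-head n f)) (ℤₚ.+-assoc (f 0) _ _)

∑-split : ∀ m n f → ∑ (n + m) f ≡ ∑ m f ℤ.+ ∑ n (λ y → f (m + y))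
∑-split m zero    f = sym (ℤₚ.+-identityʳ _)
∑-split m (suc n) f = trans (cong₂ ℤ._+_ (∑-split m n f) (cong f (ℕₚ.+-comm n m))) (ℤₚ.+-assoc (∑ m f) _ _)

∑-negative : ∀ n f → ∑ n f ℤ.< 0ℤ → ∃ λ y → f y ℤ.< 0ℤ
∑-negative zero    f h = contradiction h (ℤₚ.<-irrefl refl)
∑-negative (suc n) f h with f n ℤ.<? 0ℤ
... | yes fn<0 = n , fn<0
... | no  fn≮0 = ∑-negative n f (ℤₚ.≤-<-trans (ℤₚ.≤-trans (ℤₚ.≤-reflexive (sym (ℤₚ.+-identityʳ _)))
                   (ℤₚ.+-monoʳ-≤ (∑ n f) (ℤₚ.≮⇒≥ fn≮0))) h)

∑-nonneg : ∀ n f → (∀ y → 0ℤ ℤ.≤ f y) → 0ℤ ℤ.≤ ∑ n f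
∑-nonneg n f h = ℤₚ.≤-trans (ℤₚ.≤-reflexive (sym (∑-0 n))) (∑-mono n h)

∑≤0⇒≡0 : ∀ n f → (∀ y → 0ℤ ℤ.≤ f y) → ∑ n f ℤ.≤ 0ℤ → ∀ {y} → y < n → f y ≡ 0ℤ
∑≤0⇒≡0 (suc n) f h s {y} y<n with y ℕ.≟ n
... | yes refl = ℤₚ.≤-antisym (ℤₚ.≤-trans (ℤₚ.≤-trans (ℤₚ.≤-reflexive (sym (ℤₚ.+-identityˡ _)))
                   (ℤₚ.+-monoˡ-≤ (f n) (∑-nonneg n f h))) s) (h n)
... | no y≢n = ∑≤0⇒≡0 n f h (ℤₚ.≤-trans (ℤₚ.≤-trans (ℤₚ.≤-reflexive (sym (ℤₚ.+-identityʳ _)))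
                   (ℤₚ.+-monoʳ-≤ (∑ n f) (h n))) s) (ℕₚ.≤∧≢⇒< (ℕₚ.≤-pred y<n) y≢n)

Periodic : ℕ → Seq → Set
Periodic w f = ∀ y → f (w + y) ≡ f y

periodic-* : ∀ {w f} → Periodic w f → ∀ j y → f (j * w + y) ≡ f y
periodic-* p zero    y = refl
periodic-* {w} {f} p (suc j) y = trans (cong f (ℕₚ.+-assoc w (j * w) y)) (trans (p _) (periodic-* p j y))

periodic-act : ∀ {w f} x → Periodic w f → Periodic w (⟦ x ⟧ f)
periodic-act {w} {f} x p y = trans (sym (⟦⟧-shift x w f y)) (⟦⟧-cong x p y)

periodic-cong : ∀ {w f} → Periodic w f → ∀ i j {a b} → i * w + a ≡ j * w + b → f a ≡ f b
periodic-cong {f = f} p i j e = trans (sym (periodic-* p i _)) (trans (cong f e) (periodic-* p j _))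

∑-shift : ∀ {w f} → Periodic w f → ∀ k → ∑ w (λ y → f (k + y)) ≡ ∑ w f
∑-shift p zero    = refl
∑-shift {w} {f} p (suc k) = trans (ℤ+.∙-cancelˡ (f k) _ _ (trans (cong (λ i → f i ℤ.+ ∑ w (λ y → f (suc k + y))) (sym (ℕₚ.+-identityʳ k)))
   (trans (cong (ℤ._+_ (f (k + 0))) (∑-cong w (λ y → cong f (sym (ℕₚ.+-suc k y)))))
   (trans (sym (∑-head w (λ y → f (k + y)))) (trans (ℤₚ.+-comm _ (f (k + w)))
     (cong (ℤ._+ ∑ w (λ y → f (k + y))) (trans (cong f (ℕₚ.+-comm k w)) (p k)))))))) (∑-shift p k)

square≥0 : ∀ i → 0ℤ ℤ.≤ i ℤ.* i
square≥0 (+ n)    = ℤₚ.≤-trans (ℤ.+≤+ ℕ.z≤n) (ℤₚ.≤-reflexive (ℤₚ.pos-* n n))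
square≥0 -[1+ n ] = ℤ.+≤+ ℕ.z≤n

module InnerProduct (V : ℕ) ⦃ V≢0 : NonZero V ⦄ where

  ⟪_,_⟫ : Seq → Seq → ℤ
  ⟪ f , g ⟫ = ∑ V (λ y → f y ℤ.* g y)

  δ : Seq
  δ y = if ⌊ V ℕ∣.∣? y ⌋ then 1ℤ else 0ℤ

  bar : Op → Op
  bar = dilate (ℕ.pred V)

  private
    suc-pred = ℕₚ.suc-pred V

  ⟪⟫-cong : ∀ {f f′ g g′} → (∀ y → f y ≡ f′ y) → (∀ y → g y ≡ g′ y) → ⟪ f , g ⟫ ≡ ⟪ f′ , g′ ⟫
  ⟪⟫-cong e e′ = ∑-cong V (λ y → cong₂ ℤ._*_ (e y) (e′ y))

  ⟪⟫-congˡ : ∀ g {f f′} → (∀ y → f y ≡ f′ y) → ⟪ f , g ⟫ ≡ ⟪ f′ , g ⟫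
  ⟪⟫-congˡ g e = ⟪⟫-cong {g = g} e (λ _ → refl)

  ⟪⟫-congʳ : ∀ f {g g′} → (∀ y → g y ≡ g′ y) → ⟪ f , g ⟫ ≡ ⟪ f , g′ ⟫
  ⟪⟫-congʳ f e = ⟪⟫-cong {f = f} (λ _ → refl) e

  ⟪⟫-comm : ∀ f g → ⟪ f , g ⟫ ≡ ⟪ g , f ⟫
  ⟪⟫-comm f g = ∑-cong V (λ y → ℤₚ.*-comm (f y) (g y))

  ⟪⟫-+ʳ : ∀ f g h → ⟪ f , (λ y → g y ℤ.+ h y) ⟫ ≡ ⟪ f , g ⟫ ℤ.+ ⟪ f , h ⟫
  ⟪⟫-+ʳ f g h = trans (∑-cong V (λ y → ℤₚ.*-distribˡ-+ (f y) (g y) (h y))) (∑-+ V _ _)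

  ⟪⟫-*ʳ : ∀ c f g → ⟪ f , (λ y → c ℤ.* g y) ⟫ ≡ c ℤ.* ⟪ f , g ⟫
  ⟪⟫-*ʳ c f g = trans (∑-cong V (λ y → rearrange c (f y) (g y))) (∑-* V c _)
    where
    rearrange : ∀ c a b → a ℤ.* (c ℤ.* b) ≡ c ℤ.* (a ℤ.* b)
    rearrange = ℤ-Solver.solve-∀

  ⟪⟫-0ʳ : ∀ f → ⟪ f , (λ _ → 0ℤ) ⟫ ≡ 0ℤ
  ⟪⟫-0ʳ f = trans (∑-cong V (λ y → ℤₚ.*-zeroʳ (f y))) (∑-0 V)

  ⟪⟫-+ˡ : ∀ f g h → ⟪ (λ y → f y ℤ.+ g y) , h ⟫ ≡ ⟪ f , h ⟫ ℤ.+ ⟪ g , h ⟫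
  ⟪⟫-+ˡ f g h = trans (⟪⟫-comm _ h) (trans (⟪⟫-+ʳ h f g) (cong₂ ℤ._+_ (⟪⟫-comm h f) (⟪⟫-comm h g)))

  ⟪⟫-*ˡ : ∀ c f g → ⟪ (λ y → c ℤ.* f y) , g ⟫ ≡ c ℤ.* ⟪ f , g ⟫
  ⟪⟫-*ˡ c f g = trans (⟪⟫-comm _ g) (trans (⟪⟫-*ʳ c g f) (cong (c ℤ.*_) (⟪⟫-comm g f)))

  ⟪⟫-shift : ∀ {f g} → Periodic V f → Periodic V g → ∀ k →
             ⟪ (λ y → f (k + y)) , (λ y → g (k + y)) ⟫ ≡ ⟪ f , g ⟫
  ⟪⟫-shift p q k = ∑-shift (λ y → cong₂ ℤ._*_ (p y) (q y)) k

  -- pred V ≡ -1 modulo V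
  periodic-cancel : ∀ {f} → Periodic V f → ∀ k y → f (k + (ℕ.pred V * k + y)) ≡ f y
  periodic-cancel {f} p k y = trans (cong f (trans (sym (ℕₚ.+-assoc k _ y))
    (cong (ℕ._+ y) (trans (cong (ℕ._* k) suc-pred) (ℕₚ.*-comm V k))))) (periodic-* p k y)

  adjoint : ∀ {f g} → Periodic V f → Periodic V g → ∀ x → ⟪ ⟦ x ⟧ f , g ⟫ ≡ ⟪ f , ⟦ bar x ⟧ g ⟫
  adjoint {f} {g} p q []            = trans (⟪⟫-comm _ g) (trans (⟪⟫-0ʳ g) (sym (⟪⟫-0ʳ f)))
  adjoint {f} {g} p q ((c , k) ∷ x) =
    trans (⟪⟫-+ˡ (λ y → c ℤ.* f (k + y)) (⟦ x ⟧ f) g)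
      (trans (cong₂ ℤ._+_ (trans (⟪⟫-*ˡ c _ g) (trans (cong (c ℤ.*_) moved) (sym (⟪⟫-*ʳ c f _)))) (adjoint p q x))
        (sym (⟪⟫-+ʳ f (λ y → c ℤ.* g (ℕ.pred V * k + y)) (⟦ bar x ⟧ g))))
    where
    moved : ⟪ (λ y → f (k + y)) , g ⟫ ≡ ⟪ f , (λ y → g (ℕ.pred V * k + y)) ⟫
    moved = trans (sym (⟪⟫-shift (λ y → trans (cong f (rearrange k V y)) (p (k + y))) q (ℕ.pred V * k)))
      (⟪⟫-cong (periodic-cancel p k) (λ y → refl))
      where
      rearrange : ∀ k V y → k + (V + y) ≡ V + (k + y)
      rearrange = ℕ-Solver.solve-∀

  bar-bar : ∀ {f} → Periodic V f → ∀ x y → ⟦ bar (bar x) ⟧ f y ≡ ⟦ x ⟧ f y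
  bar-bar p []            y = refl
  bar-bar {f} p ((c , k) ∷ x) y = cong₂ (λ u v → c ℤ.* u ℤ.+ v)
    (sym (trans (sym (periodic-cancel p (ℕ.pred V * k) (k + y)))
      (trans (cong f (rearrange (ℕ.pred V * k) (ℕ.pred V * (ℕ.pred V * k)) k y))
             (periodic-cancel p k _)))) (bar-bar p x y)
    where
    rearrange : ∀ a b k y → a + (b + (k + y)) ≡ k + (a + (b + y))
    rearrange = ℕ-Solver.solve-∀

  δ-periodic : Periodic V δ
  δ-periodic y with V ℕ∣.∣? (V + y) | V ℕ∣.∣? y
  ... | yes _ | yes _ = refl
  ... | no  _ | no  _ = refl
  ... | yes h | no ¬h = contradiction (ℕ∣.∣m+n∣m⇒∣n h ℕ∣.∣-refl) ¬h
  ... | no ¬h | yes h = contradiction (ℕ∣.∣m∣n⇒∣m+n ℕ∣.∣-refl h) ¬h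

  ⟪f,δ⟫ : ∀ f → ⟪ f , δ ⟫ ≡ f 0
  ⟪f,δ⟫ f = trans (cong (λ n → ∑ n (λ y → f y ℤ.* δ y)) (sym suc-pred))
    (trans (∑-head (ℕ.pred V) _) (trans (cong₂ ℤ._+_ zero-term (vanish (ℕ.pred V) (ℕₚ.≤-reflexive suc-pred)))
      (ℤₚ.+-identityʳ (f 0))))
    where
    zero-term : f 0 ℤ.* δ 0 ≡ f 0
    zero-term with V ℕ∣.∣? 0
    ... | yes _ = ℤₚ.*-identityʳ (f 0)
    ... | no ¬h = contradiction (divides 0 refl) ¬h
    vanish : ∀ n → suc n ≤ V → ∑ n (λ y → f (suc y) ℤ.* δ (suc y)) ≡ 0ℤ
    vanish zero    _ = refl
    vanish (suc n) n<V = cong₂ ℤ._+_ (vanish n (ℕₚ.<⇒≤ n<V)) term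
      where
      term : f (suc n) ℤ.* δ (suc n) ≡ 0ℤ
      term with V ℕ∣.∣? suc n
      ... | no  _ = ℤₚ.*-zeroʳ (f (suc n))
      ... | yes h = contradiction (ℕ∣.∣⇒≤ h) (ℕₚ.<⇒≱ n<V)

  f≡0 : ∀ {f} → Periodic V f → (∀ {y} → y < V → f y ≡ 0ℤ) → ∀ y → f y ≡ 0ℤ
  f≡0 {f} p h y = trans (periodic-cong p 0 (y / V) (trans (m≡m%n+[m/n]*n y V) (ℕₚ.+-comm (y % V) _))) (h (m%n<n y V))

  private
    square≡0 : ∀ i → i ℤ.* i ≡ 0ℤ → i ≡ 0ℤ
    square≡0 i e = [ (λ h → h) , (λ h → h) ]′ (ℤₚ.i*j≡0⇒i≡0∨j≡0 i e)

  ⟪⟫-definite : ∀ {f} → Periodic V f → ⟪ f , f ⟫ ℤ.≤ 0ℤ → ∀ y → f y ≡ 0ℤ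
  ⟪⟫-definite {f} p h = f≡0 p λ {y} y<V → square≡0 (f y) (∑≤0⇒≡0 V _ (λ y → square≥0 (f y)) h y<V)

-- Geometric sums and discrete logarithms

unit-cancel : ∀ {V R} N → V ℕ∣.∣ R ^ N → ∀ ε {x} → V ℕ∣.∣ (1 + R * ε) * x → V ℕ∣.∣ x
unit-cancel {V} {R} N V∣R^N ε {x} V∣εx = subst (V ℕ∣.∣_) (ℕₚ.*-identityˡ x) (descend N (ℕ∣.∣m⇒∣m*n x V∣R^N))
  where
  rearrange : ∀ R ε x q → q * ((1 + R * ε) * x) ≡ (R * q) * (ε * x) + q * x
  rearrange = ℕ-Solver.solve-∀
  assoc : ∀ R ε x q → (R * q) * (ε * x) ≡ (R * q * x) * ε
  assoc = ℕ-Solver.solve-∀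
  descend : ∀ j → V ℕ∣.∣ R ^ j * x → V ℕ∣.∣ 1 * x
  descend zero    h = h
  descend (suc j) h = descend j (ℕ∣.∣m+n∣m⇒∣n
    (subst (V ℕ∣.∣_) (rearrange R ε x (R ^ j)) (ℕ∣.∣n⇒∣m*n (R ^ j) V∣εx))
    (subst (V ℕ∣.∣_) (sym (assoc R ε x (R ^ j))) (ℕ∣.∣m⇒∣m*n ε h)))

geom : ℕ → ℕ → ℕ
geom t zero    = 0
geom t (suc k) = 1 + t * geom t k

geom-+ : ∀ t a b → geom t (a + b) ≡ geom t a + t ^ a * geom t b
geom-+ t zero    b = sym (ℕₚ.*-identityˡ _)
geom-+ t (suc a) b = trans (cong (λ u → 1 + t * u) (geom-+ t a b)) (rearrange t (geom t a) (t ^ a) (geom t b))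
  where
  rearrange : ∀ t x q y → 1 + t * (x + q * y) ≡ 1 + t * x + t * q * y
  rearrange = ℕ-Solver.solve-∀

geom-* : ∀ t p k → geom t (p * k) ≡ geom t k * geom (t ^ k) p
geom-* t zero    k = sym (ℕₚ.*-zeroʳ (geom t k))
geom-* t (suc p) k = trans (geom-+ t k (p * k)) (trans (cong (λ u → geom t k + t ^ k * u) (geom-* t p k))
  (rearrange (geom t k) (t ^ k) (geom (t ^ k) p)))
  where
  rearrange : ∀ x q y → x + q * (x * y) ≡ x * (1 + q * y)
  rearrange = ℕ-Solver.solve-∀

pow-geom : ∀ D k → (1 + D) ^ k ≡ 1 + D * geom (1 + D) k
pow-geom D zero    = sym (cong suc (ℕₚ.*-zeroʳ D))
pow-geom D (suc k) = trans (cong ((1 + D) *_) (pow-geom D k)) (rearrange D (geom (1 + D) k))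
  where
  rearrange : ∀ D x → (1 + D) * (1 + D * x) ≡ 1 + D * (1 + (1 + D) * x)
  rearrange = ℕ-Solver.solve-∀

tri : ℕ → ℕ
tri zero    = 0
tri (suc n) = n + tri n

tri-odd : ∀ h → tri (1 + 2 * h) ≡ (1 + 2 * h) * h
tri-odd zero    = refl
tri-odd (suc h) = trans (cong (λ u → tri (suc u)) (rearrange h))
  (trans (cong (λ u → 1 + (1 + 2 * h) + ((1 + 2 * h) + u)) (tri-odd h)) (rearrange′ h))
  where
  rearrange : ∀ h → 2 * suc h ≡ 2 + 2 * h
  rearrange = ℕ-Solver.solve-∀
  rearrange′ : ∀ h → 1 + (1 + 2 * h) + ((1 + 2 * h) + (1 + 2 * h) * h) ≡ (1 + 2 * suc h) * suc h
  rearrange′ = ℕ-Solver.solve-∀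

geom-expand : ∀ X k → ∃ λ Y → geom (1 + X) k ≡ k + X * tri k + X * X * Y
geom-expand X zero    = 0 , sym (rearrange X)
  where
  rearrange : ∀ X → X * 0 + X * X * 0 ≡ 0
  rearrange = ℕ-Solver.solve-∀
geom-expand X (suc k) with geom-expand X k
... | Y , e = tri k + Y + X * Y , trans (cong (λ u → 1 + (1 + X) * u) e) (rearrange X k (tri k) Y)
  where
  rearrange : ∀ X k τ Y → 1 + (1 + X) * (k + X * τ + X * X * Y) ≡ suc k + X * (k + τ) + X * X * (τ + Y + X * Y)
  rearrange = ℕ-Solver.solve-∀

-- For every t ≡ 1 modulo D the sum 1 + t + ... + t^(p-1) is p times a unit, in the sense of unit-cancel.
-- This is a record because comparing unfolded instances of geom takes exponential time.
record Good (R D p : ℕ) : Set where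
  constructor good
  field unit-factor : ∀ u → ∃ λ ε → geom (1 + D * u) p ≡ p * (1 + R * ε)
open Good

good-odd : ∀ {R D} h → R ℕ∣.∣ D → 1 + 2 * h ℕ∣.∣ D → Good R D (1 + 2 * h)
good-odd {R} {D} h (divides d D≡dR) (divides d′ D≡d′p) = good factor
  where
  rearrange : ∀ p R d d′ u h Y → p + d * R * u * (p * h) + d * R * u * (d′ * p * u) * Y
                             ≡ p * (1 + R * (d * u * (h + d′ * u * Y)))
  rearrange = ℕ-Solver.solve-∀
  factor : ∀ u → ∃ λ ε → geom (1 + D * u) (1 + 2 * h) ≡ (1 + 2 * h) * (1 + R * ε)
  factor u with geom-expand (D * u) (1 + 2 * h)
  ... | Y , e = d * u * (h + d′ * u * Y) , trans e (trans
    (cong₂ (λ a b → 1 + 2 * h + D * u * a + D * u * (b * u) * Y) (tri-odd h) D≡d′p)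
    (trans (cong (λ a → 1 + 2 * h + a * u * ((1 + 2 * h) * h) + a * u * (d′ * (1 + 2 * h) * u) * Y) D≡dR)
      (rearrange (1 + 2 * h) R d d′ u h Y)))

good-2 : ∀ {R D} → 2 * R ℕ∣.∣ D → Good R D 2
good-2 {R} {D} (divides d D≡d2R) = good λ u → d * u , trans (cong (λ a → geom (1 + a * u) 2) D≡d2R) (rearrange R d u)
  where
  rearrange : ∀ R d u → 1 + (1 + d * (2 * R) * u) * (1 + (1 + d * (2 * R) * u) * 0) ≡ 2 * (1 + R * (d * u))
  rearrange = ℕ-Solver.solve-∀

next-multiple : ∀ {R D} p k z ε → geom (1 + D * geom (1 + D) k) p ≡ p * (1 + R * ε) →
  geom (1 + D) (p * k) * z ≡ (1 + R * ε) * (p * (geom (1 + D) k * z))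
next-multiple {R} {D} p k z ε e = trans (cong (_* z) (trans (geom-* (1 + D) p k)
    (cong (geom (1 + D) k *_) (trans (cong (λ u → geom u p) (pow-geom D k)) e))))
  (regroup (geom (1 + D) k) p (1 + R * ε) z)
  where
  regroup : ∀ g p ε z → g * (p * ε) * z ≡ ε * (p * (g * z))
  regroup = ℕ-Solver.solve-∀

-- Multiply z by the primes of V one after the other and stop at the last nonmultiple of V.
last-nonmultiple : ∀ {V R D N} → V ℕ∣.∣ R ^ N → (Q : ℕ → Set) → ∀ {z} ps → All (λ p → Good R D p × Q p) ps →
  ∀ k → V ℕ∣.∣ product ps * (geom (1 + D) k * z) → ¬ V ℕ∣.∣ geom (1 + D) k * z →
  ∃₂ λ k′ p → Q p × ¬ V ℕ∣.∣ geom (1 + D) k′ * z × V ℕ∣.∣ p * (geom (1 + D) k′ * z)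
last-nonmultiple {V} V∣R^N Q {z} [] _ k h ¬h = contradiction (subst (V ℕ∣.∣_) (ℕₚ.*-identityˡ _) h) ¬h
last-nonmultiple {V} {R} {D} {N} V∣R^N Q {z} (p ∷ ps) ((good-p , qp) ∷ goods) k h ¬h
  with V ℕ∣.∣? geom (1 + D) (p * k) * z | unit-factor good-p (geom (1 + D) k)
... | no ¬h′ | ε , e = last-nonmultiple {N = N} V∣R^N Q ps goods (p * k)
        (subst (V ℕ∣.∣_) (sym (trans (cong (product ps *_) (next-multiple {R} p k z ε e)) (rearrange p (product ps) (1 + R * ε) _)))
          (ℕ∣.∣n⇒∣m*n (1 + R * ε) h)) ¬h′
  where
  rearrange : ∀ p q ε w → q * (ε * (p * w)) ≡ ε * (p * q * w)
  rearrange = ℕ-Solver.solve-∀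
... | yes h′ | ε , e = k , p , qp , ¬h , unit-cancel N V∣R^N ε (subst (V ℕ∣.∣_) (next-multiple {R} p k z ε e) h′)

product∣geom : ∀ {D} ps → All (ℕ∣._∣ D) ps → product ps ℕ∣.∣ geom (1 + D) (product ps)
product∣geom {D} [] _ = divides 1 (cong suc (ℕₚ.*-zeroʳ D))
product∣geom {D} (p ∷ ps) (p∣D ∷ h) = subst (p * product ps ℕ∣.∣_) (sym (geom-* (1 + D) p (product ps)))
  (subst (ℕ∣._∣ (geom (1 + D) (product ps) * geom ((1 + D) ^ product ps) p)) (ℕₚ.*-comm (product ps) p) (ℕ∣.*-pres-∣ (product∣geom ps h) (p∣geom)))
  where
  p∣geom : p ℕ∣.∣ geom ((1 + D) ^ product ps) p
  p∣geom with geom-expand (D * geom (1 + D) (product ps)) p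
  ... | Y , e = subst (p ℕ∣.∣_) (sym (trans (cong (λ u → geom u p) (pow-geom D (product ps))) e))
    (ℕ∣.∣m∣n⇒∣m+n (ℕ∣.∣m∣n⇒∣m+n ℕ∣.∣-refl (ℕ∣.∣m⇒∣m*n (tri p) p∣X)) (ℕ∣.∣m⇒∣m*n Y (ℕ∣.∣m⇒∣m*n _ p∣X)))
    where
    p∣X : p ℕ∣.∣ D * geom (1 + D) (product ps)
    p∣X = ℕ∣.∣m⇒∣m*n _ p∣D

product∣^ : ∀ {R} ps → All (ℕ∣._∣ R) ps → ∃ λ N → product ps ℕ∣.∣ R ^ N
product∣^ []       []       = 0 , ℕ∣.∣-refl
product∣^ (p ∷ ps) (h ∷ hs) = suc (proj₁ (product∣^ ps hs)) , ℕ∣.*-pres-∣ h (proj₂ (product∣^ ps hs))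

pow-product≡1 : ∀ D ps → All (ℕ∣._∣ D) ps → (1 + D) ^ product ps ≡ 1 mod product ps
pow-product≡1 D ps h with product∣geom ps h
... | divides q e = 0 , D * q , trans (ℕₚ.+-identityʳ _) (trans (pow-geom D (product ps))
    (cong suc (trans (cong (D *_) e) (sym (ℕₚ.*-assoc D q _)))))

module PowersOfUnit (p′ D a b a′ α : ℕ) (p∣D : suc p′ ℕ∣.∣ D) (good-p : Good (suc p′) D (suc p′))
                    (aa′≡1 : a * a′ ≡ 1 + suc p′ * α) where
  p u : ℕ
  p = suc p′
  u = 1 + D * a

  geom-p^j : ∀ j → ∃ λ c → geom u (p ^ j) ≡ p ^ j * (1 + p * c)
  geom-p^j zero = 0 , trans (cong suc (ℕₚ.*-zeroʳ u)) (sym (trans (ℕₚ.*-identityˡ _) (cong suc (ℕₚ.*-zeroʳ p))))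
  geom-p^j (suc j) with geom-p^j j | unit-factor good-p (a * geom u (p ^ j))
  ... | c , e | ε , e′ = c + ε + p * c * ε , trans (geom-* u p (p ^ j))
    (trans (cong₂ _*_ e (trans (cong (λ x → geom x p) (trans (pow-geom (D * a) (p ^ j)) (cong suc (ℕₚ.*-assoc D a _)))) e′))
      (rearrange p (p ^ j) c ε))
    where
    rearrange : ∀ p q c ε → q * (1 + p * c) * (p * (1 + p * ε)) ≡ p * q * (1 + p * (c + ε + p * c * ε))
    rearrange = ℕ-Solver.solve-∀

  logarithm : ∀ j → ∃ λ r → u ^ r ≡ 1 + D * b mod (D * p ^ j)
  logarithm zero = 0 , b , 0 , cong suc (trans (cong (b *_) (ℕₚ.*-identityʳ D)) (trans (ℕₚ.*-comm b D) (sym (ℕₚ.+-identityʳ _))))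
  logarithm (suc j) with logarithm j | geom-p^j j
  ... | r , i , i′ , e | c , gⱼ = r + p ^ j * k , 0 , i′ + W , (begin
      u ^ (r + p ^ j * k) + 0         ≡⟨ ℕₚ.+-identityʳ _ ⟩
      u ^ (r + p ^ j * k)             ≡⟨ ℕₚ.^-distribˡ-+-* u r (p ^ j * k) ⟩
      u ^ r * u ^ (p ^ j * k)         ≡⟨ cong (u ^ r *_) (trans (sym (ℕₚ.^-*-assoc u (p ^ j) k)) uᵖʲᵏ) ⟩
      u ^ r * (1 + M * f * (k + M * f * Z)) ≡⟨ expand₁ (u ^ r) (M * f) k Z ⟩
      u ^ r + u ^ r * (M * f * k) + u ^ r * (M * f) * (M * f * Z)
        ≡⟨ cong₂ (λ x y → u ^ r + x * (M * f * k) + u ^ r * (M * f) * (y * f * Z)) u^r≡ M≡ ⟩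
      u ^ r + (1 + p * B) * (M * (a * (1 + p * c)) * k) + u ^ r * (M * f) * (p * M′ * f * Z)
        ≡⟨ expand₂ (u ^ r) p B M a c a′ (i + p′ * i′) f M′ Z ⟩
      u ^ r + M * (a * a′ * (i + p′ * i′)) + p * M * W₁
        ≡⟨ cong (λ x → u ^ r + M * (x * (i + p′ * i′)) + p * M * W₁) aa′≡1 ⟩
      u ^ r + M * ((1 + p * α) * (i + p′ * i′)) + p * M * W₁
        ≡⟨ expand₃ (u ^ r) M p p′ α i i′ W₁ ⟩
      (u ^ r + i * M) + p′ * i′ * M + p * M * W
        ≡⟨ cong (λ x → x + p′ * i′ * M + p * M * W) e ⟩
      (1 + D * b + i′ * M) + p′ * i′ * M + p * M * W
        ≡⟨ expand₄ (D * b) i′ p′ W D (p ^ j) ⟩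
      1 + D * b + (i′ + W) * (D * p ^ suc j) ∎)
    where
    open ≡.≡-Reasoning
    D′ = ℕ∣.quotient p∣D
    D≡ = ℕ∣._∣_.equality p∣D
    M = D * p ^ j
    k = a′ * (i + p′ * i′)
    f = a * (1 + p * c)
    M′ = D′ * p ^ j
    M≡ : M ≡ p * M′
    M≡ = trans (cong (_* p ^ j) D≡) (swap D′ p (p ^ j))
      where
      swap : ∀ D p q → D * p * q ≡ p * (D * q)
      swap = ℕ-Solver.solve-∀
    Y = proj₁ (geom-expand (M * f) k)
    Z = tri k + M * f * Y
    B = D′ * (a * geom u r)
    W₁ = (B * (1 + p * c) + c) * a * k + u ^ r * f * (M′ * f * Z)
    W = α * (i + p′ * i′) + W₁

    uᵖʲ : u ^ (p ^ j) ≡ 1 + M * f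
    uᵖʲ = trans (pow-geom (D * a) (p ^ j)) (cong suc (trans (cong (D * a *_) gⱼ) (swap D a (p ^ j) (1 + p * c))))
      where
      swap : ∀ D a q c → D * a * (q * c) ≡ D * q * (a * c)
      swap = ℕ-Solver.solve-∀
    uᵖʲᵏ : (u ^ (p ^ j)) ^ k ≡ 1 + M * f * (k + M * f * Z)
    uᵖʲᵏ = trans (cong (_^ k) uᵖʲ) (trans (pow-geom (M * f) k)
      (cong (λ x → 1 + M * f * x) (trans (proj₂ (geom-expand (M * f) k)) (collect k (M * f) (tri k) Y))))
      where
      collect : ∀ k X τ Y → k + X * τ + X * X * Y ≡ k + X * (τ + X * Y)
      collect = ℕ-Solver.solve-∀
    u^r≡ : u ^ r ≡ 1 + p * B
    u^r≡ = trans (pow-geom (D * a) r) (cong suc (trans (cong (λ x → x * a * geom u r) D≡) (swap D′ p a (geom u r))))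
      where
      swap : ∀ D p a g → D * p * a * g ≡ p * (D * (a * g))
      swap = ℕ-Solver.solve-∀

    expand₁ : ∀ v X k Z → v * (1 + X * (k + X * Z)) ≡ v + v * (X * k) + v * X * (X * Z)
    expand₁ = ℕ-Solver.solve-∀
    expand₂ : ∀ v p B M a c a′ s f M′ Z →
      v + (1 + p * B) * (M * (a * (1 + p * c)) * (a′ * s)) + v * (M * f) * (p * M′ * f * Z)
      ≡ v + M * (a * a′ * s) + p * M * ((B * (1 + p * c) + c) * a * (a′ * s) + v * f * (M′ * f * Z))
    expand₂ = ℕ-Solver.solve-∀
    expand₃ : ∀ v M p p′ α i i′ W → v + M * ((1 + p * α) * (i + p′ * i′)) + p * M * W
      ≡ (v + i * M) + p′ * i′ * M + p * M * (α * (i + p′ * i′) + W)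
    expand₃ = ℕ-Solver.solve-∀
    expand₄ : ∀ x i′ p′ W D q → (1 + x + i′ * (D * q)) + p′ * i′ * (D * q) + suc p′ * (D * q) * W
      ≡ 1 + x + (i′ + W) * (D * (suc p′ * q))
    expand₄ = ℕ-Solver.solve-∀

-- The powers of a generator u of the p-adic integers congruent to 1 modulo D exhaust them modulo D p^j.
discrete-log : ∀ {p D u t} p′ a b a′ α → p ≡ suc p′ → u ≡ 1 + D * a → t ≡ 1 + D * b → p ℕ∣.∣ D → Good p D p →
               a * a′ ≡ 1 + p * α → ∀ j → ∃ λ r → u ^ r ≡ t mod (D * p ^ j)
discrete-log p′ a b a′ α refl refl refl p∣D good-p aa′≡1 = PowersOfUnit.logarithm p′ _ a b a′ α p∣D good-p aa′≡1

-- Multipliers at ramified and unramified primes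

period : ℕ → Op
period V = (1ℤ , V) ∷ (-1ℤ , 0) ∷ []

psum : ℕ → ℕ → Op
psum zero    w = []
psum (suc n) w = (1ℤ , n * w) ∷ psum n w

⟦period⟧ : ∀ V f y → ⟦ period V ⟧ f y ≡ f (V + y) ℤ.- f y
⟦period⟧ V f y = rearrange (f (V + y)) (f y)
  where
  rearrange : ∀ a b → 1ℤ ℤ.* a ℤ.+ (-1ℤ ℤ.* b ℤ.+ 0ℤ) ≡ a ℤ.- b
  rearrange = ℤ-Solver.solve-∀

psum-telescope : ∀ n w f y → ⟦ psum n w ⟧ f (w + y) ℤ.+ f y ≡ ⟦ psum n w ⟧ f y ℤ.+ f (n * w + y)
psum-telescope zero    w f y = refl
psum-telescope (suc n) w f y = trans (ℤₚ.+-assoc (1ℤ ℤ.* f (n * w + (w + y))) _ _)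
  (trans (cong₂ (λ i u → 1ℤ ℤ.* f i ℤ.+ u) (rearrange n w y) (psum-telescope n w f y)) (swap (f (suc n * w + y)) (⟦ psum n w ⟧ f y) (f (n * w + y))))
  where
  rearrange : ∀ n w y → n * w + (w + y) ≡ suc n * w + y
  rearrange = ℕ-Solver.solve-∀
  swap : ∀ a b c → 1ℤ ℤ.* a ℤ.+ (b ℤ.+ c) ≡ 1ℤ ℤ.* c ℤ.+ b ℤ.+ a
  swap = ℤ-Solver.solve-∀

psum-dilate : ∀ {V p w f} t u → p * w ≡ V → t ≡ 1 + u * p → Periodic V f →
              ∀ n y h → ⟦ psum n w ⟧ (λ k → f (t * k + y)) h ≡ ⟦ psum n w ⟧ f (t * h + y)
psum-dilate t u pw≡V t≡ per zero    y h = refl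
psum-dilate {V} {p} {w} {f} t u pw≡V t≡ per (suc n) y h =
  cong₂ (λ a b → 1ℤ ℤ.* a ℤ.+ b)
    (periodic-cong per 0 (u * n) (trans (cong (λ s → s * (n * w + h) + y) t≡)
      (trans (rearrange n u p w h y) (cong₂ (λ v s → (u * n) * v + (n * w + (s * h + y))) pw≡V (sym t≡)))))
    (psum-dilate t u pw≡V t≡ per n y h)
  where
  rearrange : ∀ n u p w h y → (1 + u * p) * (n * w + h) + y
    ≡ (u * n) * (p * w) + (n * w + ((1 + u * p) * h + y))
  rearrange = ℕ-Solver.solve-∀

-- For V-periodic sequences and p w = V, the constraint psum p w says that the sums over the
-- cosets of the subgroup of order p vanish; it amounts to passing to ℤ[ζ] at the prime p.
constraints : ℕ → List (ℕ × ℕ) → List Op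
constraints V ps = period V ∷ map (uncurry psum) ps

module _ {V : ℕ} {ps : List (ℕ × ℕ)} {f : Seq} where
  kills : Periodic V f → All (λ (p , w) → ∀ y → ⟦ psum p w ⟧ f y ≡ 0ℤ) ps → Kills (constraints V ps) f
  kills per h = (λ y → trans (⟦period⟧ V f y) (trans (cong (ℤ._- f y) (per y)) (ℤₚ.+-inverseʳ (f y)))) ∷ Allₚ.map⁺ h

  kills⇒periodic : Kills (constraints V ps) f → Periodic V f
  kills⇒periodic (h ∷ _) y = ℤₚ.i-j≡0⇒i≡j _ _ (trans (sym (⟦period⟧ V f y)) (h y))

  kills⇒psum : Kills (constraints V ps) f → All (λ (p , w) → ∀ y → ⟦ psum p w ⟧ f y ≡ 0ℤ) ps
  kills⇒psum (_ ∷ h) = Allₚ.map⁻ h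

DilationFixes : ℕ → ℕ → ℕ × ℕ → Set
DilationFixes V t (p , w) = p * w ≡ V × ∃ λ u → t ≡ 1 + u * p

kills-dilate : ∀ {V ps t} → All (DilationFixes V t) ps → ∀ {f} y → Kills (constraints V ps) f →
               Kills (constraints V ps) (λ k → f (t * k + y))
kills-dilate {V} {ps} {t} fixes {f} y m =
  kills (λ h → periodic-cong per 0 t (rearrange t V h y))
    (All.zipWith (λ { {p , w} ((pw≡V , u , t≡) , h) → λ z → trans (psum-dilate t u pw≡V t≡ per p y z) (h _) }) (fixes , kills⇒psum m))
  where
  per = kills⇒periodic {V} {ps} m
  rearrange : ∀ t V h y → t * (V + h) + y ≡ t * V + (t * h + y)
  rearrange = ℕ-Solver.solve-∀

module ConstrainedRing (V : ℕ) (ps : List (ℕ × ℕ)) where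
  open OperatorCongruence (constraints V ps) public
  open CommutativeRing operatorRing using (semiring; 1#; reflexive; *-cong; *-congʳ; +-congˡ; *-identityʳ; -‿inverseʳ)
    renaming (refl to ≈-refl; sym to ≈-sym; trans to ≈-trans)
  open Exp semiring using () renaming (_^_ to _↑_)
  open Mult semiring using () renaming (_×_ to _·_)

  ≈-periodic : ∀ {x y} → (∀ f → Periodic V f → ∀ i → ⟦ x ⟧ f i ≡ ⟦ y ⟧ f i) → x ≈ y
  ≈-periodic h = mk λ f m → h f (kills⇒periodic {V} {ps} m)

  const-^ : ∀ p K → (p · 1#) ↑ K ≈ const (+ (p ^ K))
  const-^ p zero    = ≈-refl
  const-^ p (suc K) = ≈-trans (*-cong (·1≈const p) (const-^ p K)) (reflexive (cong const (sym (ℤₚ.pos-* p _))))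

  -- The Galois automorphism ζ ↦ ζ^t fixes every prime ideal above p.
  Fixes : ℕ → ℕ → Set
  Fixes t p = ∀ K {x y} → const (+ (p ^ K)) ∣ x ⋆ y → const (+ (p ^ K)) ∣ dilate t x ⋆ y

  private
    ∣-respˡ : ∀ {m n x} → m ≈ n → m ∣ x → n ∣ x
    ∣-respˡ e (c , h) = c , ≈-trans h (+-congˡ (*-congʳ e))

    from-multiplier : ∀ {t p} → (∀ K {x y} → (p · 1#) ↑ K ∣ x ⋆ y → (p · 1#) ↑ K ∣ dilate t x ⋆ y) → Fixes t p
    from-multiplier {p = p} h K {x} {y} d = ∣-respˡ (const-^ p K) (h K {x} {y} (∣-respˡ (≈-sym (const-^ p K)) d))

    dilate-· : ∀ t n → dilate t (n · 1#) ≡ n · 1#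
    dilate-· t zero    = refl
    dilate-· t (suc n) = cong₂ _∷_ (cong (1ℤ ,_) (ℕₚ.*-zeroʳ t)) (dilate-· t n)

    shift-V : shift V ≈ const 1ℤ
    shift-V = ≈-periodic λ f per y → trans (⟦⟧-Sh V f y) (trans (per y) (sym (⟦⟧-Sh 0 f y)))

  module _ {t : ℕ} (fixes : All (DilationFixes V t) ps) {p : ℕ} (pr : Prime p) where

    unramified : ∀ s ⦃ _ : NonZero s ⦄ r → (p ^ s) ≡ 1 mod V → (p ^ r) ≡ t mod V → Fixes t p
    unramified s r p^s≡1 p^r≡t = from-multiplier {t} {p} (λ K {x} {y} → dilation-multiplier K {x} {y})
      where
      open DilationMultiplier pr {t} {V} (p · 1#) (kills-dilate fixes) (≈⇒≡[] _ shift-V)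
        (∣-refl _) 1 (∣-resp (≈-sym (*-identityʳ (p · 1#))) (∣-refl _))
        (∣-resp (reflexive (sym (dilate-· t p))) (∣-refl _)) (ℕ.pred s) (subst (λ i → p ^ i ≡ 1 mod V) (sym (ℕₚ.suc-pred s)) p^s≡1) r p^r≡t

    ramified : ∀ c w → p ^ suc c * w ≡ V → (p , p ^ c * w) ∈ ps →
               ∀ s ⦃ _ : NonZero s ⦄ r → (p ^ s) ≡ 1 mod w → (p ^ r) ≡ t mod w → Fixes t p
    ramified c w p^cw≡V p∈ps s r p^s≡1 p^r≡t = from-multiplier {t} {p} (λ K {x} {y} → dilation-multiplier K {x} {y})
      where
      π : Op
      π = (1ℤ , 0) ∷ (-1ℤ , w) ∷ []
      open CommutativeRing (quotientRing π) using ()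
        renaming (trans to trans[]; sym to sym[]; refl to refl[]; +-cong to +-cong[]; -‿cong to -‿cong[])

      shift-w : shift w ≡ const 1ℤ [ π ]
      shift-w = const -1ℤ , everywhere λ f y → rearrange (f (w + y)) (f y)
        where
        rearrange : ∀ a b → 1ℤ ℤ.* a ℤ.+ 0ℤ ≡ 1ℤ ℤ.* b ℤ.+ (-1ℤ ℤ.* b ℤ.+ (1ℤ ℤ.* a ℤ.+ 0ℤ))
        rearrange = ℤ-Solver.solve-∀

      psum≡ : ∀ j n → psum n (j * w) ≡ n · 1# [ π ]
      psum≡ j zero    = refl[]
      psum≡ j (suc n) = +-cong[] {shift (n * (j * w))} {1#}
        (trans[] (≈⇒≡[] π (reflexive (cong shift (sym (ℕₚ.*-assoc n j w))))) (shift-j*w {π} {w} shift-w (n * j))) (psum≡ j n)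

      psum≈0 : psum p (p ^ c * w) ≈ []
      psum≈0 = mk λ f m → All.lookup (kills⇒psum {V} {ps} m) p∈ps

      π∣p : π ∣ p · 1#
      π∣p = trans[] (sym[] (psum≡ (p ^ c) p)) (≈⇒≡[] π psum≈0)

      p∣π^p^c : p · 1# ∣ π ↑ (p ^ suc c)
      p∣π^p^c = CommutativeRing.trans (quotientRing (p · 1#)) (^p^j≡dilate pr (suc c) π) (≈⇒≡[] _ (≈-periodic vanishes))
        where
        vanishes : ∀ f → Periodic V f → ∀ y → ⟦ dilate (p ^ suc c) π ⟧ f y ≡ 0ℤ
        vanishes f per y = trans (cong₂ (λ a b → 1ℤ ℤ.* a ℤ.+ (-1ℤ ℤ.* b ℤ.+ 0ℤ))
            (cong (λ i → f (i + y)) (ℕₚ.*-zeroʳ (p ^ suc c)))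
            (trans (cong (λ i → f (i + y)) p^cw≡V) (per y))) (rearrange (f y))
          where
          rearrange : ∀ a → 1ℤ ℤ.* a ℤ.+ (-1ℤ ℤ.* a ℤ.+ 0ℤ) ≡ 0ℤ
          rearrange = ℤ-Solver.solve-∀

      π∣dilate : π ∣ dilate t π
      π∣dilate = trans[] (+-cong[] {(1ℤ , t * 0) ∷ []} {1#} {neg (shift (t * w))} {neg 1#}
          (≈⇒≡[] π (reflexive (cong (λ i → (1ℤ , i) ∷ []) (ℕₚ.*-zeroʳ t))))
          (-‿cong[] (shift-j*w {π} {w} shift-w t)))
        (≈⇒≡[] π (-‿inverseʳ 1#))

      open DilationMultiplier pr {t} {w} π (kills-dilate fixes) shift-w π∣p (p ^ suc c) p∣π^p^c π∣dilate
        (ℕ.pred s) (subst (λ i → p ^ i ≡ 1 mod w) (sym (ℕₚ.suc-pred s)) p^s≡1) r p^r≡t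

  ∣-coprime : ∀ {a b x} → Coprime a b → const (+ a) ∣ x → const (+ b) ∣ x → const (+ (a * b)) ∣ x
  ∣-coprime {a} {b} {x} cop (c , e) (d , h) = const β ⋆ c ++ const α ⋆ d , mk λ f m y →
    trans (merge (⟦ x ⟧ f y) (⟦ c ⟧ f y) (⟦ d ⟧ f y) (value a c f y (on e f m y)) (value b d f y (on h f m y)))
      (sym (trans (⟦⟧-⋆ (const (+ (a * b))) (const β ⋆ c ++ const α ⋆ d) f y) (trans (⟦⟧-const (+ (a * b)) (⟦ const β ⋆ c ++ const α ⋆ d ⟧ f) y)
        (cong (+ (a * b) ℤ.*_) (trans (⟦⟧-++ (const β ⋆ c) (const α ⋆ d) f y)
          (cong₂ ℤ._+_ (trans (⟦⟧-⋆ (const β) c f y) (⟦⟧-const β (⟦ c ⟧ f) y)) (trans (⟦⟧-⋆ (const α) d f y) (⟦⟧-const α (⟦ d ⟧ f) y))))))))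
    where
    bezout : ∃₂ λ α β → + a ℤ.* α ℤ.+ + b ℤ.* β ≡ 1ℤ
    bezout with coprime-Bézout cop
    ... | Bézout.+- u v eq = + u , ℤ.- (+ v) , (begin
        + a ℤ.* + u ℤ.+ + b ℤ.* ℤ.- (+ v) ≡⟨ rearrange (+ a) (+ u) (+ b) (+ v) ⟩
        + u ℤ.* + a ℤ.- + v ℤ.* + b       ≡⟨ cong₂ ℤ._-_ (trans (sym (ℤₚ.pos-* u a)) (cong +_ (sym eq))) (sym (ℤₚ.pos-* v b)) ⟩
        + (1 + v * b) ℤ.- + (v * b) ≡⟨ cancel (+ (v * b)) ⟩
        1ℤ ∎)
      where
      open ≡.≡-Reasoning
      rearrange : ∀ a u b v → a ℤ.* u ℤ.+ b ℤ.* ℤ.- v ≡ u ℤ.* a ℤ.- v ℤ.* b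
      rearrange = ℤ-Solver.solve-∀
      cancel : ∀ x → (1ℤ ℤ.+ x) ℤ.- x ≡ 1ℤ
      cancel = ℤ-Solver.solve-∀
    ... | Bézout.-+ u v eq = ℤ.- (+ u) , + v , (begin
        + a ℤ.* ℤ.- (+ u) ℤ.+ + b ℤ.* + v ≡⟨ rearrange (+ a) (+ u) (+ b) (+ v) ⟩
        + v ℤ.* + b ℤ.- + u ℤ.* + a       ≡⟨ cong₂ ℤ._-_ (trans (sym (ℤₚ.pos-* v b)) (cong +_ (sym eq))) (sym (ℤₚ.pos-* u a)) ⟩
        + (1 + u * a) ℤ.- + (u * a) ≡⟨ cancel (+ (u * a)) ⟩
        1ℤ ∎)
      where
      open ≡.≡-Reasoning
      rearrange : ∀ a u b v → a ℤ.* ℤ.- u ℤ.+ b ℤ.* v ≡ v ℤ.* b ℤ.- u ℤ.* a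
      rearrange = ℤ-Solver.solve-∀
      cancel : ∀ x → (1ℤ ℤ.+ x) ℤ.- x ≡ 1ℤ
      cancel = ℤ-Solver.solve-∀
    α = proj₁ bezout
    β = proj₁ (proj₂ bezout)
    value : ∀ a c f y → ⟦ x ⟧ f y ≡ ⟦ [] ++ const (+ a) ⋆ c ⟧ f y → ⟦ x ⟧ f y ≡ + a ℤ.* ⟦ c ⟧ f y
    value a c f y e = trans e (trans (⟦⟧-⋆ (const (+ a)) c f y) (⟦⟧-const (+ a) (⟦ c ⟧ f) y))
    merge : ∀ X C D → X ≡ + a ℤ.* C → X ≡ + b ℤ.* D → X ≡ + (a * b) ℤ.* (β ℤ.* C ℤ.+ α ℤ.* D)
    merge X C D eC eD = begin
      X ≡⟨ sym (ℤₚ.*-identityˡ X) ⟩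
      1ℤ ℤ.* X ≡⟨ cong (ℤ._* X) (sym (proj₂ (proj₂ bezout))) ⟩
      (+ a ℤ.* α ℤ.+ + b ℤ.* β) ℤ.* X ≡⟨ ℤₚ.*-distribʳ-+ X (+ a ℤ.* α) (+ b ℤ.* β) ⟩
      + a ℤ.* α ℤ.* X ℤ.+ + b ℤ.* β ℤ.* X ≡⟨ cong₂ (λ u v → + a ℤ.* α ℤ.* u ℤ.+ + b ℤ.* β ℤ.* v) eD eC ⟩
      + a ℤ.* α ℤ.* (+ b ℤ.* D) ℤ.+ + b ℤ.* β ℤ.* (+ a ℤ.* C) ≡⟨ rearrange (+ a) (+ b) α β C D ⟩
      (+ a ℤ.* + b) ℤ.* (β ℤ.* C ℤ.+ α ℤ.* D) ≡⟨ cong (ℤ._* (β ℤ.* C ℤ.+ α ℤ.* D)) (sym (ℤₚ.pos-* a b)) ⟩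
      + (a * b) ℤ.* (β ℤ.* C ℤ.+ α ℤ.* D) ∎
      where
      open ≡.≡-Reasoning
      rearrange : ∀ a b α β C D → a ℤ.* α ℤ.* (b ℤ.* D) ℤ.+ b ℤ.* β ℤ.* (a ℤ.* C) ≡ (a ℤ.* b) ℤ.* (β ℤ.* C ℤ.+ α ℤ.* D)
      rearrange = ℤ-Solver.solve-∀

  module _ {t : ℕ} {x y : Op} where
    divides-prime-power : ∀ {p K n} → Fixes t p → n ≡ p ^ K → x ⋆ y ≈ const (+ n) → const (+ n) ∣ dilate t x ⋆ y
    divides-prime-power {p} {K} fixes refl e = fixes K {x} {y} (∣-resp (≈-sym e) (∣-refl _))

    divides-two-prime-powers : ∀ {p q K L} → Fixes t p → Fixes t q → Coprime (p ^ K) (q ^ L) →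
      x ⋆ y ≈ const (+ (p ^ K * q ^ L)) → const (+ (p ^ K * q ^ L)) ∣ dilate t x ⋆ y
    divides-two-prime-powers {p} {q} {K} {L} fixesₚ fixesₒ cop e = ∣-coprime cop
      (fixesₚ K {x} {y} (∣-resp (≈-sym e) (const (+ (q ^ L)) , reflexive (cong const (ℤₚ.pos-* (p ^ K) _)))))
      (fixesₒ L {x} {y} (∣-resp (≈-sym e) (const (+ (p ^ K)) , reflexive (cong const (trans (ℤₚ.pos-* (p ^ K) _) (ℤₚ.*-comm (+ (p ^ K)) (+ (q ^ L))))))))

-- Sequences invariant under an affine map

Sign : ℤ → Set
Sign ε = ε ≡ 1ℤ ⊎ ε ≡ -1ℤ

sign-^ : ∀ {ε} k → Sign ε → Sign (ε ℤ.^ k)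
sign-^ zero    h = inj₁ refl
sign-^ (suc k) h with sign-^ k h | h
... | inj₁ e | inj₁ refl = inj₁ (trans (cong (1ℤ ℤ.*_) e) refl)
... | inj₁ e | inj₂ refl = inj₂ (trans (cong (-1ℤ ℤ.*_) e) refl)
... | inj₂ e | inj₁ refl = inj₂ (trans (cong (1ℤ ℤ.*_) e) refl)
... | inj₂ e | inj₂ refl = inj₁ (trans (cong (-1ℤ ℤ.*_) e) refl)

sign-square : ∀ {ε} → Sign ε → ε ℤ.* ε ≡ 1ℤ
sign-square (inj₁ refl) = refl
sign-square (inj₂ refl) = refl

1^k≡1 : ∀ {ε} k → ε ≡ 1ℤ → ε ℤ.^ k ≡ 1ℤ
1^k≡1 zero    e    = refl
1^k≡1 (suc k) refl = cong (1ℤ ℤ.*_) (1^k≡1 k refl)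

ndivides⇒coprime : ∀ {p q} → Prime p → ¬ p ℕ∣.∣ q → Coprime q p
ndivides⇒coprime pr ¬p∣q (d∣q , d∣p) with prime⇒irreducible pr d∣p
... | inj₁ d≡1  = d≡1
... | inj₂ refl = contradiction d∣q ¬p∣q

Odd : ℕ → Set
Odd p = ∃ λ h → p ≡ 1 + 2 * h

x≡-x⇒x≡0 : ∀ x → x ≡ -1ℤ ℤ.* x → x ≡ 0ℤ
x≡-x⇒x≡0 x e = [ (λ ()) , (λ h → h) ]′ (ℤₚ.i*j≡0⇒i≡0∨j≡0 (+ 2) (trans (double x) (trans (cong (λ y → x ℤ.+ y) e) (cancel x))))
  where
  double : ∀ x → + 2 ℤ.* x ≡ x ℤ.+ x
  double = ℤ-Solver.solve-∀
  cancel : ∀ x → x ℤ.+ -1ℤ ℤ.* x ≡ 0ℤ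
  cancel = ℤ-Solver.solve-∀

-- By Bézout, F is translated by w up to a sign, so its values on a coset are equal up to sign.
module _ {p q w : ℕ} {F : Seq} {η : ℤ} {y : ℕ} (pr : Prime p) (¬p∣q : ¬ p ℕ∣.∣ q) (sign : Sign η) where

  coset-vanish : (∀ i → F ((p + i) * w + y) ≡ F (i * w + y)) →
    (∀ i → F (i * w + y) ≡ η ℤ.* F ((q + i) * w + y)) → ⟦ psum p w ⟧ F y ≡ 0ℤ →
    η ≡ 1ℤ ⊎ Odd p → F y ≡ 0ℤ
  coset-vanish per step sum≡0 odd = conclude odd (sign-^ a sign)
    where
    φ : ℕ → ℤ
    φ i = F (i * w + y)

    per* : ∀ a i → φ (a * p + i) ≡ φ i
    per* zero    i = refl
    per* (suc a) i = trans (cong φ (ℕₚ.+-assoc p (a * p) i)) (trans (per _) (per* a i))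

    step* : ∀ a i → φ i ≡ (η ℤ.^ a) ℤ.* φ (a * q + i)
    step* zero    i = sym (ℤₚ.*-identityˡ _)
    step* (suc a) i = trans (step* a i) (trans (cong ((η ℤ.^ a) ℤ.*_) (step _))
      (trans (rearrange (η ℤ.^ a) η _) (cong (λ u → η ℤ.* (η ℤ.^ a) ℤ.* φ u) (sym (ℕₚ.+-assoc q (a * q) i)))))
      where
      rearrange : ∀ a b x → a ℤ.* (b ℤ.* x) ≡ b ℤ.* a ℤ.* x
      rearrange = ℤ-Solver.solve-∀

    unit-step : ∃ λ a → ∀ i → φ i ≡ (η ℤ.^ a) ℤ.* φ (suc i)
    unit-step with coprime-Bézout (ndivides⇒coprime pr ¬p∣q)
    ... | Bézout.+- a b eq = a , λ i → trans (step* a i) (cong ((η ℤ.^ a) ℤ.*_)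
            (trans (cong φ (trans (cong (ℕ._+ i) (sym eq)) (rearrange (b * p) i))) (per* b (suc i))))
      where
      rearrange : ∀ x i → 1 + x + i ≡ x + suc i
      rearrange = ℕ-Solver.solve-∀
    ... | Bézout.-+ a b eq = a , λ i → trans (sym (ℤₚ.*-identityˡ (φ i)))
            (trans (cong (ℤ._* φ i) (sym (sign-square (sign-^ a sign)))) (trans (ℤₚ.*-assoc (η ℤ.^ a) _ _)
              (cong ((η ℤ.^ a) ℤ.*_) (sym (trans (step* a (suc i)) (cong ((η ℤ.^ a) ℤ.*_)
                (trans (cong φ (trans (rearrange (a * q) i) (cong (ℕ._+ i) eq))) (per* b i))))))))
      where
      rearrange : ∀ x i → x + suc i ≡ 1 + x + i
      rearrange = ℕ-Solver.solve-∀

    a = proj₁ unit-step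
    θ = η ℤ.^ a

    conclude-1 : θ ≡ 1ℤ → F y ≡ 0ℤ
    conclude-1 θ≡1 = [ (λ e → contradiction e (p≢0 pr)) , (λ h → h) ]′
      (ℤₚ.i*j≡0⇒i≡0∨j≡0 (+ p) (trans (sym (sum p)) sum≡0))
      where
      p≢0 : ∀ {p} → Prime p → ¬ + p ≡ 0ℤ
      p≢0 {suc _} _ ()
      φ≡ : ∀ i → φ i ≡ φ 0
      φ≡ zero    = refl
      φ≡ (suc i) = trans (sym (trans (proj₂ unit-step i) (trans (cong (ℤ._* φ (suc i)) θ≡1) (ℤₚ.*-identityˡ _)))) (φ≡ i)
      sum : ∀ n → ⟦ psum n w ⟧ F y ≡ + n ℤ.* F y
      sum zero    = refl
      sum (suc n) = trans (cong₂ (λ u v → 1ℤ ℤ.* u ℤ.+ v) (φ≡ n) (sum n)) (sym (ℤₚ.*-distribʳ-+ (F y) 1ℤ (+ n)))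

    conclude-odd : θ ≡ -1ℤ → Odd p → F y ≡ 0ℤ
    conclude-odd θ≡-1 (h , refl) = x≡-x⇒x≡0 (φ 0) (trans (next 0)
      (cong (-1ℤ ℤ.*_) (trans (sym (evens h)) (trans (cong φ (ℕₚ.+-comm (2 * h) 1)) (trans (cong φ (sym (ℕₚ.+-identityʳ p))) (per 0))))))
      where
      next : ∀ i → φ i ≡ -1ℤ ℤ.* φ (suc i)
      next i = trans (proj₂ unit-step i) (cong (ℤ._* φ (suc i)) θ≡-1)
      double : ∀ i → φ i ≡ φ (suc (suc i))
      double i = trans (next i) (trans (cong (-1ℤ ℤ.*_) (next (suc i))) (cancel (φ (suc (suc i)))))
        where
        cancel : ∀ x → -1ℤ ℤ.* (-1ℤ ℤ.* x) ≡ x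
        cancel = ℤ-Solver.solve-∀
      evens : ∀ h → φ (2 * h + 1) ≡ φ 1
      evens zero    = refl
      evens (suc h) = trans (cong φ (rearrange h)) (trans (sym (double (2 * h + 1))) (evens h))
        where
        rearrange : ∀ h → 2 * suc h + 1 ≡ suc (suc (2 * h + 1))
        rearrange = ℕ-Solver.solve-∀
    conclude : η ≡ 1ℤ ⊎ Odd p → Sign θ → F y ≡ 0ℤ
    conclude (inj₁ η≡1) _           = conclude-1 (1^k≡1 a η≡1)
    conclude (inj₂ _)   (inj₁ θ≡1)  = conclude-1 θ≡1
    conclude (inj₂ o)   (inj₂ θ≡-1) = conclude-odd θ≡-1 o

-- The orbit of a point y not fixed by y ↦ (1 + D) y + s meets y + q w with q prime to p.
affine-vanish : ∀ {V R d F ε s N} ⦃ _ : NonZero V ⦄ → let D = R * d in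
  Periodic V F → Sign ε → (∀ y → F y ≡ ε ℤ.* F ((1 + D) * y + s)) →
  V ℕ∣.∣ R ^ N →
  ∀ ps → product ps ≡ V →
  All (λ p → Good R D p × (∃₂ λ r w → p * r ≡ R × p * w ≡ V × Prime p × (∀ y → ⟦ psum p w ⟧ F y ≡ 0ℤ) × (ε ≡ 1ℤ ⊎ Odd p))) ps →
  ∀ y → ¬ V ℕ∣.∣ D * y + s → F y ≡ 0ℤ
affine-vanish {V} {R} {d} {F} {ε} {s} {N} per sign rel V∣R^N ps product≡V goods y ¬V∣z
  with last-nonmultiple {N = N} V∣R^N (λ p → ∃₂ λ r w → p * r ≡ R × p * w ≡ V × Prime p × (∀ y → ⟦ psum p w ⟧ F y ≡ 0ℤ) × (ε ≡ 1ℤ ⊎ Odd p))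
         {z = R * d * y + s} ps goods 1
         (ℕ∣.∣m⇒∣m*n _ (subst (V ℕ∣.∣_) (sym product≡V) ℕ∣.∣-refl))
         (λ h → ¬V∣z (subst (V ℕ∣.∣_) (one (1 + R * d) _) h))
  where
  one : ∀ t z → (1 + t * 0) * z ≡ z
  one = ℕ-Solver.solve-∀
... | k , p , (r , w , pr≡R , pw≡V , pr , psum≡0 , odd) , ¬V∣W , divides q pW≡qV =
  coset-vanish {p} {q} {w} {F} {ε ℤ.^ k} {y} pr ¬p∣q (sign-^ k sign)
    (λ i → trans (cong F (period-shift p i w y)) (trans (cong (λ v → F (v + (i * w + y))) pw≡V) (per _)))
    (λ i → trans (iterate k _) (cong ((ε ℤ.^ k) ℤ.*_) (periodic-cong per 0 (G * d * r * i) (target i))))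
    (psum≡0 y) (odd′ odd)
  where
  D = R * d
  t = 1 + D
  G = geom t k
  W = G * (D * y + s)
  period-shift : ∀ p i w y → (p + i) * w + y ≡ p * w + (i * w + y)
  period-shift = ℕ-Solver.solve-∀
  odd′ : ε ≡ 1ℤ ⊎ Odd p → ε ℤ.^ k ≡ 1ℤ ⊎ Odd p
  odd′ (inj₁ e) = inj₁ (1^k≡1 k e)
  odd′ (inj₂ o) = inj₂ o
  W≡qw : W ≡ q * w
  W≡qw = ℕₚ.*-cancelˡ-≡ _ _ p ⦃ prime⇒nonZero pr ⦄ (trans pW≡qV (trans (cong (q ℕ.*_) (sym pw≡V)) (swap q p w)))
    where
    swap : ∀ q p w → q * (p * w) ≡ p * (q * w)
    swap = ℕ-Solver.solve-∀
  ¬p∣q : ¬ p ℕ∣.∣ q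
  ¬p∣q (divides c q≡cp) = ¬V∣W (divides c (trans W≡qw (trans (cong (ℕ._* w) q≡cp) (trans (ℕₚ.*-assoc c p w) (cong (c ℕ.*_) pw≡V)))))
  iterate : ∀ k y → F y ≡ (ε ℤ.^ k) ℤ.* F (y + geom t k * (D * y + s))
  iterate zero    y = trans (cong F (sym (ℕₚ.+-identityʳ y))) (sym (ℤₚ.*-identityˡ _))
  iterate (suc k) y = trans (rel y) (trans (cong (ε ℤ.*_) (iterate k (t * y + s)))
    (trans (sym (ℤₚ.*-assoc ε (ε ℤ.^ k) _)) (cong (λ u → ε ℤ.* (ε ℤ.^ k) ℤ.* F u) (rearrange D y s (geom t k)))))
    where
    rearrange : ∀ D y s g → (1 + D) * y + s + g * (D * ((1 + D) * y + s) + s)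
      ≡ y + (1 + (1 + D) * g) * (D * y + s)
    rearrange = ℕ-Solver.solve-∀
  target : ∀ i → (i * w + y) + G * (D * (i * w + y) + s)
             ≡ (G * d * r * i) * V + ((q + i) * w + y)
  target i = begin
    (i * w + y) + G * (D * (i * w + y) + s) ≡⟨ expand i w y G R d s ⟩
    (i * w + y) + W + G * R * d * i * w
      ≡⟨ cong₂ (λ a b → (i * w + y) + a + G * b * d * i * w) W≡qw (sym pr≡R) ⟩
    (i * w + y) + q * w + G * (p * r) * d * i * w ≡⟨ collect i w y q G p r d ⟩
    (G * d * r * i) * (p * w) + ((q + i) * w + y)
      ≡⟨ cong (λ v → (G * d * r * i) * v + ((q + i) * w + y)) pw≡V ⟩
    (G * d * r * i) * V + ((q + i) * w + y) ∎
    where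
    open ≡.≡-Reasoning
    expand : ∀ i w y G R d s → (i * w + y) + G * (R * d * (i * w + y) + s)
      ≡ (i * w + y) + G * (R * d * y + s) + G * R * d * i * w
    expand = ℕ-Solver.solve-∀
    collect : ∀ i w y q G p r d → (i * w + y) + q * w + G * (p * r) * d * i * w
      ≡ (G * d * r * i) * (p * w) + ((q + i) * w + y)
    collect = ℕ-Solver.solve-∀

-- Coset projections and isometries

opposite-signs : ∀ i j → i ℤ.* j ℤ.< 0ℤ → + 2 ℤ.≤ i ℤ.- j ⊎ + 2 ℤ.≤ j ℤ.- i
opposite-signs (+ m) (+ n) h = contradiction (ℤₚ.≤-trans (ℤ.+≤+ ℕ.z≤n) (ℤₚ.≤-reflexive (ℤₚ.pos-* m n))) (ℤₚ.<⇒≱ h)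
opposite-signs (+ zero) -[1+ n ] h = contradiction h (ℤₚ.<-irrefl refl)
opposite-signs (+ suc m) -[1+ n ] h = inj₁ (ℤ.+≤+ (ℕ.s≤s (ℕₚ.≤-trans (ℕ.s≤s ℕ.z≤n) (ℕₚ.m≤n+m (suc n) m))))
opposite-signs -[1+ n ] (+ zero) h = contradiction (subst (ℤ._< 0ℤ) (ℤₚ.*-zeroʳ -[1+ n ]) h) (ℤₚ.<-irrefl refl)
opposite-signs -[1+ n ] (+ suc m) h = inj₂ (ℤ.+≤+ (ℕ.s≤s (ℕₚ.≤-trans (ℕ.s≤s ℕ.z≤n) (ℕₚ.m≤n+m (suc n) m))))
opposite-signs -[1+ m ] -[1+ n ] h = contradiction (ℤ.+≤+ ℕ.z≤n) (ℤₚ.<⇒≱ h)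

scale : ℕ → ℕ × ℕ → ℕ × ℕ
scale m (p , r) = p , m * r

scaled-coset : ∀ p m r {R} → p * r ≡ R → p * (m * r) ≡ m * R
scaled-coset p m r e = trans (swap p m r) (cong (m ℕ.*_) e)
  where
  swap : ∀ p m r → p * (m * r) ≡ m * (p * r)
  swap = ℕ-Solver.solve-∀

-- p times the projection onto the sequences with vanishing sums over the cosets of order p
project : ℕ → ℕ → Op
project p w = (+ p , 0) ∷ neg (psum p w)

projects : List (ℕ × ℕ) → Op
projects []             = const 1ℤ
projects ((p , w) ∷ qs) = project p w ⋆ projects qs

degree : List (ℕ × ℕ) → ℤ
degree []             = 1ℤ
degree ((p , w) ∷ qs) = + p ℤ.* degree qs

dilate-psum : ∀ m p w → dilate m (psum p w) ≡ psum p (m * w)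
dilate-psum m zero    w = refl
dilate-psum m (suc n) w = cong₂ _∷_ (cong (1ℤ ,_) (rearrange m n w)) (dilate-psum m n w)
  where
  rearrange : ∀ m n w → m * (n * w) ≡ n * (m * w)
  rearrange = ℕ-Solver.solve-∀

dilate-neg : ∀ m x → dilate m (neg x) ≡ neg (dilate m x)
dilate-neg m []            = refl
dilate-neg m ((c , k) ∷ x) = cong (_ ∷_) (dilate-neg m x)

dilate-projects : ∀ m qs → dilate m (projects qs) ≡ projects (map (scale m) qs)
dilate-projects m []             = cong (λ k → (1ℤ , k) ∷ []) (ℕₚ.*-zeroʳ m)
dilate-projects m ((p , r) ∷ qs) = trans (dilate-⋆ m (project p r) (projects qs)) (cong₂ _⋆_
  (cong₂ _∷_ (cong (+ p ,_) (ℕₚ.*-zeroʳ m)) (trans (dilate-neg m (psum p r)) (cong neg (dilate-psum m p r)))) (dilate-projects m qs))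

degree-scale : ∀ m qs → degree (map (scale m) qs) ≡ degree qs
degree-scale m []             = refl
degree-scale m ((p , r) ∷ qs) = cong (+ p ℤ.*_) (degree-scale m qs)

⟦project⟧ : ∀ p w f y → ⟦ project p w ⟧ f y ≡ + p ℤ.* f y ℤ.- ⟦ psum p w ⟧ f y
⟦project⟧ p w f y = cong (ℤ._+_ (+ p ℤ.* f y)) (⟦⟧-neg (psum p w) f y)

module Projection (V : ℕ) ⦃ _ : NonZero V ⦄ where
  open InnerProduct V

  module _ {p w : ℕ} (pw≡V : p * w ≡ V) {f : Seq} (per : Periodic V f) where
    psum-periodic : Periodic w (⟦ psum p w ⟧ f)
    psum-periodic y = ℤ+.∙-cancelʳ (f y) _ _ (trans (psum-telescope p w f y)
      (cong (λ u → ⟦ psum p w ⟧ f y ℤ.+ u) (trans (cong (λ v → f (v + y)) pw≡V) (per y))))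

    psum-psum : ∀ n y → ⟦ psum n w ⟧ (⟦ psum p w ⟧ f) y ≡ + n ℤ.* ⟦ psum p w ⟧ f y
    psum-psum zero    y = refl
    psum-psum (suc n) y = trans (cong₂ (λ a b → 1ℤ ℤ.* a ℤ.+ b) (periodic-* psum-periodic n y) (psum-psum n y))
      (sym (ℤₚ.*-distribʳ-+ (⟦ psum p w ⟧ f y) 1ℤ (+ n)))

    psum-project : ∀ y → ⟦ psum p w ⟧ (⟦ project p w ⟧ f) y ≡ 0ℤ
    psum-project y = begin
      ⟦ psum p w ⟧ (⟦ project p w ⟧ f) y ≡⟨ ⟦⟧-comm (psum p w) (project p w) f y ⟩
      ⟦ project p w ⟧ (⟦ psum p w ⟧ f) y ≡⟨ ⟦project⟧ p w (⟦ psum p w ⟧ f) y ⟩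
      + p ℤ.* ⟦ psum p w ⟧ f y ℤ.- ⟦ psum p w ⟧ (⟦ psum p w ⟧ f) y ≡⟨ cong (λ u → + p ℤ.* ⟦ psum p w ⟧ f y ℤ.- u) (psum-psum p y) ⟩
      + p ℤ.* ⟦ psum p w ⟧ f y ℤ.- + p ℤ.* ⟦ psum p w ⟧ f y ≡⟨ ℤₚ.+-inverseʳ (+ p ℤ.* ⟦ psum p w ⟧ f y) ⟩
      0ℤ ∎
      where open ≡.≡-Reasoning

    psum-orthogonal : ∀ {g} → NonZero p → Periodic V g → (∀ y → ⟦ psum p w ⟧ g y ≡ 0ℤ) → ⟪ ⟦ psum p w ⟧ f , g ⟫ ≡ 0ℤ
    psum-orthogonal {g} p≢0 perg h = [ (λ e → contradiction (ℤₚ.+-injective e) (ℕ.≢-nonZero⁻¹ p ⦃ p≢0 ⦄)) , (λ e → e) ]′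
      (ℤₚ.i*j≡0⇒i≡0∨j≡0 (+ p) (trans (sym (average p)) (trans (⟪⟫-congʳ (⟦ psum p w ⟧ f) h) (⟪⟫-0ʳ (⟦ psum p w ⟧ f)))))
      where
      pf = ⟦ psum p w ⟧ f
      average : ∀ n → ⟪ pf , ⟦ psum n w ⟧ g ⟫ ≡ + n ℤ.* ⟪ pf , g ⟫
      average zero    = ⟪⟫-0ʳ pf
      average (suc n) = trans (⟪⟫-+ʳ pf (λ y → 1ℤ ℤ.* g (n * w + y)) (⟦ psum n w ⟧ g))
        (trans (cong₂ ℤ._+_ (trans (⟪⟫-*ʳ 1ℤ pf (λ y → g (n * w + y))) (cong (1ℤ ℤ.*_) shifted)) (average n))
          (sym (ℤₚ.*-distribʳ-+ ⟪ pf , g ⟫ 1ℤ (+ n))))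
        where
        shifted : ⟪ pf , (λ y → g (n * w + y)) ⟫ ≡ ⟪ pf , g ⟫
        shifted = trans (⟪⟫-congˡ (λ y → g (n * w + y)) (λ y → sym (periodic-* psum-periodic n y)))
          (⟪⟫-shift (periodic-act (psum p w) per) perg (n * w))

  Cosets : ℕ × ℕ → Set
  Cosets (p , w) = p * w ≡ V × NonZero p

  projects-killed : ∀ qs → All Cosets qs → ∀ {f} → Periodic V f →
                    All (λ (p , w) → ∀ y → ⟦ psum p w ⟧ (⟦ projects qs ⟧ f) y ≡ 0ℤ) qs
  projects-killed [] [] per = []
  projects-killed ((p , w) ∷ qs) ((pw≡V , _) ∷ hs) {f} per =
    (λ y → trans (⟦⟧-cong (psum p w) (⟦⟧-⋆ (project p w) (projects qs) f) y)
             (psum-project {p} {w} pw≡V (periodic-act (projects qs) per) y))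
    ∷ All.map (λ {q} h y → trans (⟦⟧-cong (uncurry′ q) (⟦⟧-⋆ (project p w) (projects qs) f) y)
        (trans (⟦⟧-comm (uncurry′ q) (project p w) (⟦ projects qs ⟧ f) y)
          (trans (⟦⟧-cong (project p w) h y) (⟦⟧-0 (project p w) y)))) (projects-killed qs hs per)
    where
    uncurry′ : ℕ × ℕ → Op
    uncurry′ (p , w) = psum p w

  ⟪projects⟫ : ∀ qs → All Cosets qs → ∀ {f g} → Periodic V f → Periodic V g →
               All (λ (p , w) → ∀ y → ⟦ psum p w ⟧ g y ≡ 0ℤ) qs →
               ⟪ ⟦ projects qs ⟧ f , g ⟫ ≡ degree qs ℤ.* ⟪ f , g ⟫
  ⟪projects⟫ [] [] {f} {g} perf perg [] = trans (⟪⟫-congˡ g (⟦⟧-Sh 0 f)) (sym (ℤₚ.*-identityˡ _))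
  ⟪projects⟫ ((p , w) ∷ qs) ((pw≡V , p≢0) ∷ hs) {f} {g} perf perg (k ∷ ks) = begin
    ⟪ ⟦ project p w ⋆ projects qs ⟧ f , g ⟫
      ≡⟨ ⟪⟫-congˡ g (λ y → trans (⟦⟧-⋆ (project p w) (projects qs) f y) (trans (⟦project⟧ p w f′ y) (cong (λ u → + p ℤ.* f′ y ℤ.+ u) (sym (ℤₚ.-1*i≡-i (⟦ psum p w ⟧ f′ y)))))) ⟩
    ⟪ (λ y → + p ℤ.* f′ y ℤ.+ -1ℤ ℤ.* ⟦ psum p w ⟧ f′ y) , g ⟫
      ≡⟨ ⟪⟫-+ˡ (λ y → + p ℤ.* f′ y) _ g ⟩
    ⟪ (λ y → + p ℤ.* f′ y) , g ⟫ ℤ.+ ⟪ (λ y → -1ℤ ℤ.* ⟦ psum p w ⟧ f′ y) , g ⟫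
      ≡⟨ cong₂ ℤ._+_ (⟪⟫-*ˡ (+ p) f′ g) (trans (⟪⟫-*ˡ -1ℤ (⟦ psum p w ⟧ f′) g)
           (cong (-1ℤ ℤ.*_) (psum-orthogonal pw≡V (periodic-act (projects qs) perf) p≢0 perg k))) ⟩
    + p ℤ.* ⟪ f′ , g ⟫ ℤ.+ 0ℤ ≡⟨ ℤₚ.+-identityʳ _ ⟩
    + p ℤ.* ⟪ f′ , g ⟫ ≡⟨ cong (+ p ℤ.*_) (⟪projects⟫ qs hs perf perg ks) ⟩
    + p ℤ.* (degree qs ℤ.* ⟪ f , g ⟫) ≡⟨ sym (ℤₚ.*-assoc (+ p) _ _) ⟩
    + p ℤ.* degree qs ℤ.* ⟪ f , g ⟫ ∎
    where
    open ≡.≡-Reasoning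
    f′ = ⟦ projects qs ⟧ f

module Isometry (V : ℕ) ⦃ _ : NonZero V ⦄ (ps : List (ℕ × ℕ)) (t n : ℕ) ⦃ _ : NonZero n ⦄ (x E : Op)
  (fixes : All (DilationFixes V t) ps) where
  open ConstrainedRing V ps
  open CommutativeRing operatorRing using (*-comm; reflexive) renaming (trans to ≈-trans)
  open InnerProduct V

  module _ (xx̄≈n : x ⋆ bar x ≈ const (+ n)) (σxx̄≈nE : dilate t x ⋆ bar x ≈ const (+ n) ⋆ E) where

    private
      cancel : ∀ {i j} → + n ℤ.* i ≡ + n ℤ.* j → i ≡ j
      cancel {i} {j} e = ℤₚ.*-cancelˡ-≡ (+ n) i j e

      σx σx̄ : Op
      σx = dilate t x
      σx̄ = bar σx

      dilate-≈ : ∀ {x y} → x ≈ y → dilate t x ≈ dilate t y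
      dilate-≈ {x} {y} e = mk λ f m i → trans (⟦⟧-dilate t x f i)
        (trans (on e _ (kills-dilate fixes i m) 0) (sym (⟦⟧-dilate t y f i)))

      σx̄σx≈n : σx̄ ⋆ σx ≈ const (+ n)
      σx̄σx≈n = ≈-trans (*-comm σx̄ σx) (≈-trans (reflexive (trans (cong (dilate t x ⋆_) (trans (dilate-dilate (ℕ.pred V) t x)
          (trans (cong (λ k → dilate k x) (ℕₚ.*-comm (ℕ.pred V) t)) (sym (dilate-dilate t (ℕ.pred V) x))))) (sym (dilate-⋆ t x (bar x)))))
        (≈-trans (dilate-≈ xx̄≈n) (reflexive (cong (λ k → (+ n , k) ∷ []) (ℕₚ.*-zeroʳ t)))))

    x̄xf≡nf : ∀ {f} → Kills (constraints V ps) f → ∀ y → ⟦ bar x ⟧ (⟦ x ⟧ f) y ≡ + n ℤ.* f y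
    x̄xf≡nf {f} m y = trans (sym (⟦⟧-⋆ (bar x) x f y)) (trans (on (≈-trans (*-comm (bar x) x) xx̄≈n) f m y) (⟦⟧-const (+ n) f y))

    σx≈Ex : ∀ f → Kills (constraints V ps) f → ∀ y → ⟦ σx ⟧ f y ≡ ⟦ E ⟧ (⟦ x ⟧ f) y
    σx≈Ex f m y = cancel (begin
      + n ℤ.* ⟦ σx ⟧ f y                ≡⟨ sym (⟦⟧-* σx (+ n) f y) ⟩
      ⟦ σx ⟧ (λ i → + n ℤ.* f i) y      ≡⟨ ⟦⟧-cong σx (λ i → sym (x̄xf≡nf m i)) y ⟩
      ⟦ σx ⟧ (⟦ bar x ⟧ (⟦ x ⟧ f)) y    ≡⟨ sym (⟦⟧-⋆ σx (bar x) (⟦ x ⟧ f) y) ⟩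
      ⟦ σx ⋆ bar x ⟧ (⟦ x ⟧ f) y        ≡⟨ on σxx̄≈nE (⟦ x ⟧ f) (Kills-act x m) y ⟩
      ⟦ const (+ n) ⋆ E ⟧ (⟦ x ⟧ f) y   ≡⟨ trans (⟦⟧-⋆ (const (+ n)) E (⟦ x ⟧ f) y) (⟦⟧-const (+ n) (⟦ E ⟧ (⟦ x ⟧ f)) y) ⟩
      + n ℤ.* ⟦ E ⟧ (⟦ x ⟧ f) y ∎)
      where open ≡.≡-Reasoning

    E-isometry : ∀ {f g} → Kills (constraints V ps) f → Kills (constraints V ps) g → ⟪ ⟦ E ⟧ f , ⟦ E ⟧ g ⟫ ≡ ⟪ f , g ⟫
    E-isometry {f} {g} mf mg = cancel (cancel (begin
      + n ℤ.* (+ n ℤ.* ⟪ ⟦ E ⟧ f , ⟦ E ⟧ g ⟫)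
        ≡⟨ cong (+ n ℤ.*_) (sym (⟪⟫-*ʳ (+ n) (⟦ E ⟧ f) (⟦ E ⟧ g))) ⟩
      + n ℤ.* ⟪ ⟦ E ⟧ f , (λ y → + n ℤ.* ⟦ E ⟧ g y) ⟫
        ≡⟨ sym (⟪⟫-*ˡ (+ n) (⟦ E ⟧ f) _) ⟩
      ⟪ (λ y → + n ℤ.* ⟦ E ⟧ f y) , (λ y → + n ℤ.* ⟦ E ⟧ g y) ⟫
        ≡⟨ ⟪⟫-cong (nE mf) (nE mg) ⟩
      ⟪ ⟦ σx ⟧ (⟦ bar x ⟧ f) , ⟦ σx ⟧ (⟦ bar x ⟧ g) ⟫
        ≡⟨ adjoint (periodic-act (bar x) perf) (periodic-act σx (periodic-act (bar x) perg)) σx ⟩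
      ⟪ ⟦ bar x ⟧ f , ⟦ σx̄ ⟧ (⟦ σx ⟧ (⟦ bar x ⟧ g)) ⟫
        ≡⟨ ⟪⟫-congʳ (⟦ bar x ⟧ f) (λ y → trans (sym (⟦⟧-⋆ σx̄ σx (⟦ bar x ⟧ g) y))
             (trans (on σx̄σx≈n (⟦ bar x ⟧ g) (Kills-act (bar x) mg) y) (⟦⟧-const (+ n) (⟦ bar x ⟧ g) y))) ⟩
      ⟪ ⟦ bar x ⟧ f , (λ y → + n ℤ.* ⟦ bar x ⟧ g y) ⟫
        ≡⟨ ⟪⟫-*ʳ (+ n) (⟦ bar x ⟧ f) (⟦ bar x ⟧ g) ⟩
      + n ℤ.* ⟪ ⟦ bar x ⟧ f , ⟦ bar x ⟧ g ⟫
        ≡⟨ cong (+ n ℤ.*_) (adjoint perf (periodic-act (bar x) perg) (bar x)) ⟩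
      + n ℤ.* ⟪ f , ⟦ bar (bar x) ⟧ (⟦ bar x ⟧ g) ⟫
        ≡⟨ cong (+ n ℤ.*_) (⟪⟫-congʳ f (λ y → trans (bar-bar (periodic-act (bar x) perg) x y)
             (trans (sym (⟦⟧-⋆ x (bar x) g y)) (trans (on xx̄≈n g mg y) (⟦⟧-const (+ n) g y))))) ⟩
      + n ℤ.* ⟪ f , (λ y → + n ℤ.* g y) ⟫
        ≡⟨ cong (+ n ℤ.*_) (⟪⟫-*ʳ (+ n) f g) ⟩
      + n ℤ.* (+ n ℤ.* ⟪ f , g ⟫) ∎))
      where
      open ≡.≡-Reasoning
      perf = kills⇒periodic {V} {ps} mf
      perg = kills⇒periodic {V} {ps} mg
      nE : ∀ {f} → Kills (constraints V ps) f → ∀ y → + n ℤ.* ⟦ E ⟧ f y ≡ ⟦ σx ⟧ (⟦ bar x ⟧ f) y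
      nE {f} m y = trans (sym (⟦⟧-const (+ n) (⟦ E ⟧ f) y)) (trans (sym (⟦⟧-⋆ (const (+ n)) E f y))
        (trans (sym (on σxx̄≈nE f m y)) (⟦⟧-⋆ σx (bar x) f y)))

-- Weighing matrices as operators

module ℤ-Sum = Sum ℤₚ.+-0-commutativeMonoid

sumFin≡sum : ∀ {v} (f : Fin v → ℤ) → sumFin f ≡ ℤ-Sum.sum f
sumFin≡sum {zero}  f = refl
sumFin≡sum {suc v} f = cong (λ u → f Fin.zero ℤ.+ u) (sumFin≡sum (λ i → f (Fin.suc i)))

sumFin-cong : ∀ {v} {f g : Fin v → ℤ} → (∀ i → f i ≡ g i) → sumFin f ≡ sumFin g
sumFin-cong {zero}  e = refl
sumFin-cong {suc v} e = cong₂ ℤ._+_ (e Fin.zero) (sumFin-cong (λ i → e (Fin.suc i)))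

sumFin-swap : ∀ {m n} (f : Fin m → Fin n → ℤ) → sumFin (λ i → sumFin (f i)) ≡ sumFin (λ j → sumFin (λ i → f i j))
sumFin-swap f = trans (trans (sumFin-cong (λ i → sumFin≡sum (f i))) (sumFin≡sum (λ i → ℤ-Sum.sum (f i)))) (trans (ℤ-Sum.∑-comm f)
  (sym (trans (sumFin-cong (λ j → sumFin≡sum (λ i → f i j))) (sumFin≡sum (λ j → ℤ-Sum.sum (λ i → f i j))))))

sumFin-involution : ∀ {v} (ι : Fin v → Fin v) → (∀ i → ι (ι i) ≡ i) → ∀ f → sumFin f ≡ sumFin (λ i → f (ι i))
sumFin-involution ι inv f = trans (sumFin≡sum f) (trans (ℤ-Sum.sum-permute f (permutation ι ι inv inv)) (sym (sumFin≡sum (λ i → f (ι i)))))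

sumFin-*ˡ : ∀ {v} c (f : Fin v → ℤ) → c ℤ.* sumFin f ≡ sumFin (λ i → c ℤ.* f i)
sumFin-*ˡ {zero}  c f = ℤₚ.*-zeroʳ c
sumFin-*ˡ {suc v} c f = trans (ℤₚ.*-distribˡ-+ c (f Fin.zero) _) (cong (λ u → c ℤ.* f Fin.zero ℤ.+ u) (sumFin-*ˡ c (λ i → f (Fin.suc i))))

sumFin-*ʳ : ∀ {v} c (f : Fin v → ℤ) → sumFin f ℤ.* c ≡ sumFin (λ i → f i ℤ.* c)
sumFin-*ʳ c f = trans (ℤₚ.*-comm (sumFin f) c) (trans (sumFin-*ˡ c f) (sumFin-cong (λ i → ℤₚ.*-comm c (f i))))

sumFin-0 : ∀ v → sumFin {v} (λ _ → 0ℤ) ≡ 0ℤ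
sumFin-0 zero    = refl
sumFin-0 (suc v) = trans (ℤₚ.+-identityˡ _) (sumFin-0 v)

sumFin-mono : ∀ {v} {f g : Fin v → ℤ} → (∀ i → f i ℤ.≤ g i) → sumFin f ℤ.≤ sumFin g
sumFin-mono {zero}  h = ℤₚ.≤-refl
sumFin-mono {suc v} h = ℤₚ.+-mono-≤ (h Fin.zero) (sumFin-mono (λ i → h (Fin.suc i)))

sumFin-1 : ∀ v → sumFin {v} (λ _ → 1ℤ) ≡ + v
sumFin-1 zero    = refl
sumFin-1 (suc v) = cong (λ u → 1ℤ ℤ.+ u) (sumFin-1 v)

sumFin-single : ∀ {v} (e : Fin v) (f : Fin v → ℤ) → sumFin (λ i → if ⌊ i Fin.≟ e ⌋ then f i else 0ℤ) ≡ f e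
sumFin-single {suc v} Fin.zero f = trans (cong (λ u → f Fin.zero ℤ.+ u) (sumFin-0 v)) (ℤₚ.+-identityʳ _)
sumFin-single {suc v} (Fin.suc e) f = trans (ℤₚ.+-identityˡ _) (trans (sumFin-cong same) (sumFin-single e (λ i → f (Fin.suc i))))
  where
  same : ∀ i → (if ⌊ Fin.suc i Fin.≟ Fin.suc e ⌋ then f (Fin.suc i) else 0ℤ) ≡ (if ⌊ i Fin.≟ e ⌋ then f (Fin.suc i) else 0ℤ)
  same i with i Fin.≟ e
  ... | yes _ = refl
  ... | no  _ = refl

toOp : ∀ {v} → (Fin v → ℤ) → (Fin v → ℕ) → Op
toOp {zero}  a χ = []
toOp {suc v} a χ = (a Fin.zero , χ Fin.zero) ∷ toOp (λ i → a (Fin.suc i)) (λ i → χ (Fin.suc i))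

⟦toOp⟧ : ∀ {v} (a : Fin v → ℤ) χ f y → ⟦ toOp a χ ⟧ f y ≡ sumFin (λ g → a g ℤ.* f (χ g + y))
⟦toOp⟧ {zero}  a χ f y = refl
⟦toOp⟧ {suc v} a χ f y = cong (λ u → a Fin.zero ℤ.* f (χ Fin.zero + y) ℤ.+ u) (⟦toOp⟧ (λ i → a (Fin.suc i)) (λ i → χ (Fin.suc i)) f y)

dilate-toOp : ∀ {v} t (a : Fin v → ℤ) χ → dilate t (toOp a χ) ≡ toOp a (λ g → t * χ g)
dilate-toOp {zero}  t a χ = refl
dilate-toOp {suc v} t a χ = cong ((a Fin.zero , t * χ Fin.zero) ∷_) (dilate-toOp t (λ i → a (Fin.suc i)) (λ i → χ (Fin.suc i)))

indicator-* : ∀ {P : Set} (d : Dec P) a x → (if ⌊ d ⌋ then a else 0ℤ) ℤ.* x ≡ (if ⌊ d ⌋ then a ℤ.* x else 0ℤ)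
indicator-* (yes _) a x = refl
indicator-* (no _)  a x = refl

module WeighingOperator (V : ℕ) ⦃ V≢0 : NonZero V ⦄ {v n : ℕ}
  (ldiv : Fin v → Fin v → Fin v) (e : Fin v) (a : Fin v → ℤ)
  (involutive : ∀ h g → ldiv (ldiv h g) g ≡ h)
  (χ : Fin v → ℕ) (χ-ldiv : ∀ h g → χ (ldiv h g) + χ h ≡ χ g mod V) (χ-e : V ℕ∣.∣ χ e) where

  open InnerProduct V

  x : Op
  x = toOp a χ

  xx̄≡n : WeighingCond ldiv e n a → ∀ f → Periodic V f → ∀ y → ⟦ x ⋆ bar x ⟧ f y ≡ ⟦ const (+ n) ⟧ f y
  xx̄≡n (_ , weigh) f per y = begin
    ⟦ x ⋆ bar x ⟧ f y ≡⟨ ⟦⟧-⋆ x (bar x) f y ⟩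
    ⟦ x ⟧ (⟦ bar x ⟧ f) y ≡⟨ ⟦⟧-cong x (λ i → trans (cong (λ o → ⟦ o ⟧ f i) (dilate-toOp (ℕ.pred V) a χ)) (⟦toOp⟧ a (λ g → ℕ.pred V * χ g) f i)) y ⟩
    ⟦ x ⟧ (λ i → sumFin (λ h → a h ℤ.* f (ℕ.pred V * χ h + i))) y ≡⟨ ⟦toOp⟧ a χ _ y ⟩
    sumFin (λ g → a g ℤ.* sumFin (λ h → a h ℤ.* f (ℕ.pred V * χ h + (χ g + y))))
      ≡⟨ sumFin-cong (λ g → trans (cong (a g ℤ.*_) (trans (sumFin-involution (λ k → ldiv k g) (λ k → involutive k g) _)
           (sumFin-cong (λ k → cong (a (ldiv k g) ℤ.*_) (move k g))))) (sumFin-*ˡ (a g) (λ k → a (ldiv k g) ℤ.* f (χ k + y)))) ⟩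
    sumFin (λ g → sumFin (λ k → a g ℤ.* (a (ldiv k g) ℤ.* f (χ k + y)))) ≡⟨ sumFin-swap (λ g k → a g ℤ.* (a (ldiv k g) ℤ.* f (χ k + y))) ⟩
    sumFin (λ k → sumFin (λ g → a g ℤ.* (a (ldiv k g) ℤ.* f (χ k + y))))
      ≡⟨ sumFin-cong (λ k → trans (sumFin-cong (λ g → sym (ℤₚ.*-assoc (a g) (a (ldiv k g)) _)))
           (trans (sym (sumFin-*ʳ (f (χ k + y)) (λ g → a g ℤ.* a (ldiv k g))))
             (trans (cong (ℤ._* f (χ k + y)) (weigh k)) (indicator-* (k Fin.≟ e) (+ n) _)))) ⟩
    sumFin (λ k → if ⌊ k Fin.≟ e ⌋ then + n ℤ.* f (χ k + y) else 0ℤ) ≡⟨ sumFin-single e (λ k → + n ℤ.* f (χ k + y)) ⟩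
    + n ℤ.* f (χ e + y) ≡⟨ cong (+ n ℤ.*_) (trans (cong (λ i → f (i + y)) (ℕ∣._∣_.equality χ-e)) (periodic-* per (ℕ∣.quotient χ-e) y)) ⟩
    + n ℤ.* f y ≡⟨ sym (⟦⟧-const (+ n) f y) ⟩
    ⟦ const (+ n) ⟧ f y ∎
    where
    open ≡.≡-Reasoning
    move : ∀ k g → f (ℕ.pred V * χ (ldiv k g) + (χ g + y)) ≡ f (χ k + y)
    move k g with χ-ldiv k g
    ... | i , j , eq = trans (periodic-cong per j i (trans (rearrange (ℕ.pred V * χ (ldiv k g)) (χ g) y (j * V))
        (trans (cong (λ u → ℕ.pred V * χ (ldiv k g) + (u + y)) (sym eq)) (rearrange′ (ℕ.pred V * χ (ldiv k g)) (χ (ldiv k g)) (χ k) (i * V) y))))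
      (periodic-cancel per (χ (ldiv k g)) (χ k + y))
      where
      rearrange : ∀ p c y j → j + (p + (c + y)) ≡ p + (c + j + y)
      rearrange = ℕ-Solver.solve-∀
      rearrange′ : ∀ p l k i y → p + (l + k + i + y) ≡ i + (l + (p + (k + y)))
      rearrange′ = ℕ-Solver.solve-∀

  -- ψ distinguishes the elements of each fibre of χ.
  module _ {κ : ℕ} (ψ : Fin v → Fin κ)
    (injective : ∀ y {g g′} → V ℕ∣.∣ χ g + y → V ℕ∣.∣ χ g′ + y → ψ g ≡ ψ g′ → g ≡ g′) where

    private
      unique : ∀ {v} (φ : Fin v → ℤ) → (∀ g → φ g ≡ 0ℤ ⊎ φ g ≡ 1ℤ) → (∀ g g′ → φ g ≡ 1ℤ → φ g′ ≡ 1ℤ → g ≡ g′) → sumFin φ ℤ.≤ 1ℤ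
      unique {zero}  φ bit uniq = ℤ.+≤+ ℕ.z≤n
      unique {suc v} φ bit uniq with bit Fin.zero
      ... | inj₁ e = subst (λ u → u ℤ.+ sumFin (λ i → φ (Fin.suc i)) ℤ.≤ 1ℤ) (sym e) (ℤₚ.≤-trans (ℤₚ.≤-reflexive (ℤₚ.+-identityˡ _))
        (unique (λ i → φ (Fin.suc i)) (λ g → bit (Fin.suc g)) (λ g g′ p q → Finₚ.suc-injective (uniq _ _ p q))))
      ... | inj₂ e = ℤₚ.≤-reflexive (cong₂ ℤ._+_ e (trans (sumFin-cong tail≡0) (sumFin-0 v)))
        where
        tail≡0 : ∀ i → φ (Fin.suc i) ≡ 0ℤ
        tail≡0 i with bit (Fin.suc i)
        ... | inj₁ e′ = e′
        ... | inj₂ e′ = contradiction (uniq Fin.zero (Fin.suc i) e e′) λ ()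

      δ-bit : ∀ y → (δ y ≡ 0ℤ) ⊎ (δ y ≡ 1ℤ × V ℕ∣.∣ y)
      δ-bit y with V ℕ∣.∣? y
      ... | yes h = inj₂ (refl , h)
      ... | no  _ = inj₁ refl

    fibre : ∀ y → sumFin (λ g → δ (χ g + y)) ℤ.≤ + κ
    fibre y = ℤₚ.≤-trans (ℤₚ.≤-reflexive (trans (sumFin-cong (λ g → sym (sumFin-single (ψ g) (λ _ → δ (χ g + y)))))
        (sumFin-swap (λ g i → cell g i))))
      (ℤₚ.≤-trans (sumFin-mono (λ i → unique (λ g → cell g i) (bit i) (λ g g′ p q → at-most-one i g g′ p q))) (ℤₚ.≤-reflexive (sumFin-1 κ)))
      where
      cell : Fin v → Fin κ → ℤ
      cell g i = if ⌊ i Fin.≟ ψ g ⌋ then δ (χ g + y) else 0ℤ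
      bit : ∀ i g → cell g i ≡ 0ℤ ⊎ cell g i ≡ 1ℤ
      bit i g with i Fin.≟ ψ g | δ-bit (χ g + y)
      ... | no  _ | _ = inj₁ refl
      ... | yes _ | inj₁ e = inj₁ e
      ... | yes _ | inj₂ (e , _) = inj₂ e
      at : ∀ i g → cell g i ≡ 1ℤ → i ≡ ψ g × V ℕ∣.∣ χ g + y
      at i g c≡1 with i Fin.≟ ψ g | δ-bit (χ g + y)
      at i g ()  | no  _ | _
      at i g c≡1 | yes _ | inj₁ e = contradiction (trans (sym e) c≡1) λ ()
      at i g c≡1 | yes i≡ | inj₂ (_ , h) = i≡ , h
      at-most-one : ∀ i g g′ → cell g i ≡ 1ℤ → cell g′ i ≡ 1ℤ → g ≡ g′
      at-most-one i g g′ p q = injective y (proj₂ (at i g p)) (proj₂ (at i g′ q)) (trans (sym (proj₁ (at i g p))) (proj₁ (at i g′ q)))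

    private
      trit-bounds : ∀ {a d} → Trit a → 0ℤ ℤ.≤ d → a ℤ.* d ℤ.≤ d × -1ℤ ℤ.* (a ℤ.* d) ℤ.≤ d
      trit-bounds (inj₁ refl) 0≤d = 0≤d , 0≤d
      trit-bounds {d = d} (inj₂ (inj₁ refl)) 0≤d = ℤₚ.≤-reflexive (ℤₚ.*-identityˡ d) ,
        ℤₚ.≤-trans (ℤₚ.≤-reflexive (trans (cong (-1ℤ ℤ.*_) (ℤₚ.*-identityˡ d)) (ℤₚ.-1*i≡-i d))) (ℤₚ.≤-trans (ℤₚ.neg-mono-≤ 0≤d) 0≤d)
      trit-bounds {d = d} (inj₂ (inj₂ refl)) 0≤d =
        ℤₚ.≤-trans (ℤₚ.≤-reflexive (ℤₚ.-1*i≡-i d)) (ℤₚ.≤-trans (ℤₚ.neg-mono-≤ 0≤d) 0≤d) ,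
        ℤₚ.≤-reflexive (trans (sym (ℤₚ.*-assoc -1ℤ -1ℤ d)) (ℤₚ.*-identityˡ d))

      0≤δ : ∀ y → 0ℤ ℤ.≤ δ y
      0≤δ y with V ℕ∣.∣? y
      ... | yes _ = ℤ.+≤+ ℕ.z≤n
      ... | no  _ = ℤ.+≤+ ℕ.z≤n

    b²≤κ² : WeighingCond ldiv e n a → ∀ y → ⟦ x ⟧ δ y ℤ.* ⟦ x ⟧ δ y ℤ.≤ + (κ * κ)
    b²≤κ² (trit , _) y = ℤₚ.0≤i-j⇒j≤i (ℤₚ.≤-trans gap (ℤₚ.≤-reflexive (trans (expand (+ κ) b) (cong (ℤ._- b ℤ.* b) (sym (ℤₚ.pos-* κ κ))))))
      where
      b = ⟦ x ⟧ δ y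
      upper : b ℤ.≤ + κ
      upper = ℤₚ.≤-trans (ℤₚ.≤-reflexive (⟦toOp⟧ a χ δ y)) (ℤₚ.≤-trans (sumFin-mono (λ g → proj₁ (trit-bounds (trit g) (0≤δ _)))) (fibre y))
      lower : -1ℤ ℤ.* b ℤ.≤ + κ
      lower = ℤₚ.≤-trans (ℤₚ.≤-reflexive (trans (cong (-1ℤ ℤ.*_) (⟦toOp⟧ a χ δ y)) (sumFin-*ˡ -1ℤ (λ g → a g ℤ.* δ (χ g + y)))))
        (ℤₚ.≤-trans (sumFin-mono (λ g → proj₂ (trit-bounds (trit g) (0≤δ _)))) (fibre y))
      gap : 0ℤ ℤ.≤ (+ κ ℤ.- b) ℤ.* (+ κ ℤ.- -1ℤ ℤ.* b)
      gap = ℤₚ.≤-trans (ℤₚ.≤-reflexive (sym (ℤₚ.*-zeroʳ (+ κ ℤ.- b))))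
        (ℤₚ.*-monoˡ-≤-nonNeg (+ κ ℤ.- b) ⦃ ℤ.nonNegative (ℤₚ.i≤j⇒0≤j-i upper) ⦄ (ℤₚ.i≤j⇒0≤j-i lower))
      expand : ∀ k b → (k ℤ.- b) ℤ.* (k ℤ.- -1ℤ ℤ.* b) ≡ k ℤ.* k ℤ.- b ℤ.* b
      expand = ℤ-Solver.solve-∀

module _ {w : ℕ} {P : ℕ → Set} (P? : ∀ y → Dec (P y)) where
  private
    bit : ℕ → ℤ
    bit y = if ⌊ P? y ⌋ then 1ℤ else 0ℤ

  ∑-unique : ∀ w k → (∀ {i j} → i ≤ j → j < w → P (k + i) → P (k + j) → i ≡ j) → ∑ w (λ y → bit (k + y)) ℤ.≤ 1ℤ
  ∑-unique zero    k uniq = ℤ.+≤+ ℕ.z≤n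
  ∑-unique (suc w) k uniq with P? (k + w)
  ... | no  _ = ℤₚ.≤-trans (ℤₚ.≤-reflexive (ℤₚ.+-identityʳ _)) (∑-unique w k (λ i≤j j<w → uniq i≤j (ℕₚ.m<n⇒m<1+n j<w)))
  ... | yes h = ℤₚ.≤-reflexive (cong (ℤ._+ 1ℤ) (earlier w ℕₚ.≤-refl))
    where
    earlier : ∀ n → n ≤ w → ∑ n (λ y → bit (k + y)) ≡ 0ℤ
    earlier zero    _ = refl
    earlier (suc n) n<w with P? (k + n)
    ... | no  _  = trans (ℤₚ.+-identityʳ _) (earlier n (ℕₚ.<⇒≤ n<w))
    ... | yes h′ = contradiction (uniq (ℕₚ.<⇒≤ n<w) ℕₚ.≤-refl h′ h) (ℕₚ.<⇒≢ n<w)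

  ∑-windows : ∀ g → (∀ k → ∑ w (λ y → bit (k + y)) ℤ.≤ 1ℤ) → ∀ k → ∑ (g * w) (λ y → bit (k + y)) ℤ.≤ + g
  ∑-windows zero    h k = ℤ.+≤+ ℕ.z≤n
  ∑-windows (suc g) h k = ℤₚ.≤-trans (ℤₚ.≤-reflexive (trans (cong (λ n → ∑ n (λ y → bit (k + y))) (ℕₚ.+-comm w (g * w)))
      (trans (∑-split w (g * w) _) (cong (λ u → ∑ w (λ y → bit (k + y)) ℤ.+ u)
        (∑-cong (g * w) (λ y → cong bit (sym (ℕₚ.+-assoc k w y))))))))
    (ℤₚ.+-mono-≤ (h k) (∑-windows g h (k + w)))

fixed-point-count : ∀ g h w ⦃ _ : NonZero g ⦄ → (∀ {x} → w ℕ∣.∣ h * x → w ℕ∣.∣ x) → ∀ {D} → D ≡ g * h → ∀ {V} → V ≡ g * w → ∀ s →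
  ∑ V (λ y → if ⌊ V ℕ∣.∣? (D * y + s) ⌋ then 1ℤ else 0ℤ) ℤ.≤ + g
fixed-point-count g h w cancel refl {V} refl s = ∑-windows (λ y → V ℕ∣.∣? (g * h * y + s)) g
  (λ k → ∑-unique {w} (λ y → V ℕ∣.∣? (g * h * y + s)) w k (uniq k)) 0
  where
  uniq : ∀ k {i j} → i ≤ j → j < w → V ℕ∣.∣ g * h * (k + i) + s → V ℕ∣.∣ g * h * (k + j) + s → i ≡ j
  uniq k {i} {j} i≤j j<w Vi Vj with ℕₚ.m≤n⇒∃[o]m+o≡n i≤j
  ... | c , refl = small c (cancel (ℕ∣.*-cancelˡ-∣ g (subst (V ℕ∣.∣_) (ℕₚ.*-assoc g h c) (ℕ∣.∣m+n∣m⇒∣n (subst (V ℕ∣.∣_) (rearrange (g * h) k i c s) Vj) Vi)))) (ℕₚ.≤-<-trans (ℕₚ.m≤n+m c i) j<w)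
    where
    rearrange : ∀ D k i c s → D * (k + (i + c)) + s ≡ (D * (k + i) + s) + D * c
    rearrange = ℕ-Solver.solve-∀
    small : ∀ c → w ℕ∣.∣ c → c < w → i ≡ i + c
    small zero    _   _   = sym (ℕₚ.+-identityʳ i)
    small (suc c) w∣c c<w = contradiction (ℕ∣.∣⇒≤ w∣c) (ℕₚ.<⇒≱ c<w)

mod-unique : ∀ {a b V} ⦃ _ : NonZero V ⦄ → a < V → b < V → a ≡ b mod V → a ≡ b
mod-unique {a} {b} {V} a<V b<V (i , j , e) = begin
  a                     ≡⟨ sym (m<n⇒m%n≡m a<V) ⟩
  a % V                 ≡⟨ sym ([m+kn]%n≡m%n a i V) ⟩
  (a + i * V) % V   ≡⟨ cong (_% V) e ⟩
  (b + j * V) % V   ≡⟨ [m+kn]%n≡m%n b j V ⟩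
  b % V                 ≡⟨ m<n⇒m%n≡m b<V ⟩
  b                     ∎
  where open ≡.≡-Reasoning

-- A weighing element together with a homomorphism χ to ℤ/V₀ whose fibres have at most κ elements:
-- pushing the weights forward along χ gives coefficients of absolute value at most κ.
record BoundedWeighing (V₀ κ n : ℕ) : Set where
  field
    {v}        : ℕ
    ldiv       : Fin v → Fin v → Fin v
    e          : Fin v
    a          : Fin v → ℤ
    weighing   : WeighingCond ldiv e n a
    involutive : ∀ h g → ldiv (ldiv h g) g ≡ h
    χ          : Fin v → Fin V₀
    χ-ldiv     : ∀ h g → toℕ (χ (ldiv h g)) + toℕ (χ h) ≡ toℕ (χ g) mod V₀
    χ-e        : toℕ (χ e) ≡ 0
    ψ          : Fin v → Fin κ
    χψ-injective : ∀ {g g′} → χ g ≡ χ g′ → ψ g ≡ ψ g′ → g ≡ g′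

cycSub-mod : ∀ {k} (h g : Fin (suc k)) → toℕ (cycSub h g) + toℕ h ≡ toℕ g mod suc k
cycSub-mod {k} h g = q , 1 , (begin
  toℕ (cycSub h g) + toℕ h + q * suc k ≡⟨ cong (λ u → u + toℕ h + q * suc k) (Finₚ.toℕ-fromℕ< (m%n<n s (suc k))) ⟩
  s % suc k + toℕ h + q * suc k ≡⟨ swap (s % suc k) (toℕ h) (q * suc k) ⟩
  (s % suc k + q * suc k) + toℕ h ≡⟨ cong (ℕ._+ toℕ h) (sym (m≡m%n+[m/n]*n s (suc k))) ⟩
  toℕ g + (suc k ∸ toℕ h) + toℕ h ≡⟨ ℕₚ.+-assoc (toℕ g) _ _ ⟩
  toℕ g + (suc k ∸ toℕ h + toℕ h) ≡⟨ cong (toℕ g ℕ.+_) (trans (ℕₚ.m∸n+n≡m (ℕₚ.<⇒≤ (Finₚ.toℕ<n h))) (sym (ℕₚ.*-identityˡ _))) ⟩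
  toℕ g + 1 * suc k ∎)
  where
  open ≡.≡-Reasoning
  s = toℕ g + (suc k ∸ toℕ h)
  q = s ℕ./ suc k
  swap : ∀ a b c → a + b + c ≡ (a + c) + b
  swap = ℕ-Solver.solve-∀

cycSub-involutive : ∀ {k} (h g : Fin (suc k)) → cycSub (cycSub h g) g ≡ h
cycSub-involutive {k} h g with cycSub-mod h g | cycSub-mod (cycSub h g) g
... | i , j , e | i′ , j′ , e′ = Finₚ.toℕ-injective (mod-unique (Finₚ.toℕ<n _) (Finₚ.toℕ<n h)
  (i′ + j , j′ + i , ℕₚ.+-cancelˡ-≡ A _ _ (begin
    A + (B + (i′ + j) * suc k)        ≡⟨ left A B i′ j (suc k) ⟩
    (B + A + i′ * suc k) + j * suc k ≡⟨ cong (ℕ._+ j * suc k) e′ ⟩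
    (toℕ g + j′ * suc k) + j * suc k  ≡⟨ middle (toℕ g) j j′ (suc k) ⟩
    (toℕ g + j * suc k) + j′ * suc k  ≡⟨ cong (ℕ._+ j′ * suc k) (sym e) ⟩
    (A + toℕ h + i * suc k) + j′ * suc k ≡⟨ right A (toℕ h) i j′ (suc k) ⟩
    A + (toℕ h + (j′ + i) * suc k) ∎)))
  where
  open ≡.≡-Reasoning
  A = toℕ (cycSub h g)
  B = toℕ (cycSub (cycSub h g) g)
  left : ∀ A B i j k → A + (B + (i + j) * k) ≡ (B + A + i * k) + j * k
  left = ℕ-Solver.solve-∀
  middle : ∀ g j j′ k → (g + j′ * k) + j * k ≡ (g + j * k) + j′ * k
  middle = ℕ-Solver.solve-∀
  right : ∀ A h i j k → (A + h + i * k) + j * k ≡ A + (h + (j + i) * k)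
  right = ℕ-Solver.solve-∀

cyclic : ∀ {v n} → CW v n → BoundedWeighing v 1 n
cyclic {suc k} (a , weighing) = record
  { ldiv = cycSub ; e = Fin.zero ; a = a ; weighing = weighing ; involutive = cycSub-involutive
  ; χ = λ g → g ; χ-ldiv = cycSub-mod ; χ-e = refl ; ψ = λ _ → Fin.zero ; χψ-injective = λ e _ → e }

module PushForward {V₀ κ n} (B : BoundedWeighing V₀ κ n) (μ V : ℕ) ⦃ V≢0 : NonZero V ⦄ (V≡ : V ≡ μ * V₀) where
  open BoundedWeighing B
  open InnerProduct V

  private
    μ≢0 : NonZero μ
    μ≢0 = ℕₚ.m*n≢0⇒m≢0 μ ⦃ subst NonZero V≡ V≢0 ⦄
    V₀≢0 : NonZero V₀
    V₀≢0 = ℕₚ.m*n≢0⇒n≢0 μ ⦃ subst NonZero V≡ V≢0 ⦄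

    scaled : ∀ a b c i j → a + b + i * V₀ ≡ c + j * V₀ → μ * a + μ * b + i * V ≡ μ * c + j * V
    scaled a b c i j e = trans (cong (λ u → μ * a + μ * b + i * u) V≡) (trans (collect μ a b i V₀)
      (trans (cong (μ ℕ.*_) e) (trans (spread μ c j V₀) (cong (λ u → μ * c + j * u) (sym V≡)))))
      where
      collect : ∀ μ a b i V → μ * a + μ * b + i * (μ * V) ≡ μ * (a + b + i * V)
      collect = ℕ-Solver.solve-∀
      spread : ∀ μ c j V → μ * (c + j * V) ≡ μ * c + j * (μ * V)
      spread = ℕ-Solver.solve-∀

  χ′ : Fin v → ℕ
  χ′ g = μ * toℕ (χ g)

  private
    χ′-ldiv : ∀ h g → χ′ (ldiv h g) + χ′ h ≡ χ′ g mod V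
    χ′-ldiv h g with χ-ldiv h g
    ... | i , j , e = i , j , scaled (toℕ (χ (ldiv h g))) (toℕ (χ h)) (toℕ (χ g)) i j e

    module W = WeighingOperator V {v} {n} ldiv e a involutive χ′ χ′-ldiv
      (divides 0 (trans (cong (μ ℕ.*_) χ-e) (ℕₚ.*-zeroʳ μ)))

    injective : ∀ y {g g′} → V ℕ∣.∣ χ′ g + y → V ℕ∣.∣ χ′ g′ + y → ψ g ≡ ψ g′ → g ≡ g′
    injective y {g} {g′} (divides q e₁) (divides q′ e₂) ψ≡ = χψ-injective
      (Finₚ.toℕ-injective (mod-unique ⦃ V₀≢0 ⦄ (Finₚ.toℕ<n (χ g)) (Finₚ.toℕ<n (χ g′))
        (q′ , q , ℕₚ.*-cancelˡ-≡ _ _ μ ⦃ μ≢0 ⦄ (ℕₚ.+-cancelʳ-≡ y _ _ (trans (spread μ (toℕ (χ g)) q′ V₀ y)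
          (trans (cong₂ (λ u w → u + q′ * w) e₁ (sym V≡)) (trans (ℕₚ.+-comm (q * V) (q′ * V))
            (trans (cong₂ (λ u w → u + q * w) (sym e₂) V≡) (sym (spread μ (toℕ (χ g′)) q V₀ y))))))))))
      ψ≡
      where
      spread : ∀ μ a q V y → μ * (a + q * V) + y ≡ (μ * a + y) + q * (μ * V)
      spread = ℕ-Solver.solve-∀

  x : Op
  x = W.x

  xx̄≡n : ∀ f → Periodic V f → ∀ y → ⟦ x ⋆ bar x ⟧ f y ≡ ⟦ const (+ n) ⟧ f y
  xx̄≡n = W.xx̄≡n weighing

  b² : ∀ y → ⟦ x ⟧ δ y ℤ.* ⟦ x ⟧ δ y ℤ.≤ + (κ * κ)
  b² = W.b²≤κ² ψ injective weighing

-- The bound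

-- 0 ≤ (P b - F)²
module _ (P b F : ℤ) {κ² : ℕ} where
  inside : b ℤ.* b ℤ.≤ + κ² → + 2 ℤ.* P ℤ.* (b ℤ.* F) ℤ.+ -1ℤ ℤ.* (F ℤ.* F) ℤ.≤ (P ℤ.* P ℤ.* + κ²) ℤ.* 1ℤ
  inside b² = begin
    A                   ≡⟨ sym (ℤₚ.+-identityʳ A) ⟩
    A ℤ.+ 0ℤ            ≤⟨ ℤₚ.+-monoʳ-≤ A (square≥0 (P ℤ.* b ℤ.- F)) ⟩
    A ℤ.+ (P ℤ.* b ℤ.- F) ℤ.* (P ℤ.* b ℤ.- F) ≡⟨ expand P b F ⟩
    P ℤ.* P ℤ.* (b ℤ.* b) ≤⟨ ℤₚ.*-monoˡ-≤-nonNeg (P ℤ.* P) ⦃ ℤ.nonNegative (square≥0 P) ⦄ b² ⟩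
    P ℤ.* P ℤ.* + κ²    ≡⟨ sym (ℤₚ.*-identityʳ _) ⟩
    P ℤ.* P ℤ.* + κ² ℤ.* 1ℤ ∎
    where
    open ℤₚ.≤-Reasoning
    A = + 2 ℤ.* P ℤ.* (b ℤ.* F) ℤ.+ -1ℤ ℤ.* (F ℤ.* F)
    expand : ∀ P b F → (+ 2 ℤ.* P ℤ.* (b ℤ.* F) ℤ.+ -1ℤ ℤ.* (F ℤ.* F)) ℤ.+ (P ℤ.* b ℤ.- F) ℤ.* (P ℤ.* b ℤ.- F) ≡ P ℤ.* P ℤ.* (b ℤ.* b)
    expand = ℤ-Solver.solve-∀

  outside : F ≡ 0ℤ → + 2 ℤ.* P ℤ.* (b ℤ.* F) ℤ.+ -1ℤ ℤ.* (F ℤ.* F) ℤ.≤ (P ℤ.* P ℤ.* + κ²) ℤ.* 0ℤ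
  outside refl = ℤₚ.≤-reflexive (trans (vanish P b) (sym (ℤₚ.*-zeroʳ (P ℤ.* P ℤ.* + κ²))))
    where
    vanish : ∀ P b → + 2 ℤ.* P ℤ.* (b ℤ.* 0ℤ) ℤ.+ -1ℤ ℤ.* (0ℤ ℤ.* 0ℤ) ≡ 0ℤ
    vanish = ℤ-Solver.solve-∀

P²κ²≥0 : ∀ P κ² → 0ℤ ℤ.≤ P ℤ.* P ℤ.* + κ²
P²κ²≥0 P κ² = ℤₚ.≤-trans (ℤₚ.≤-reflexive (sym (ℤₚ.*-zeroʳ (P ℤ.* P))))
  (ℤₚ.*-monoˡ-≤-nonNeg (P ℤ.* P) ⦃ ℤ.nonNegative (square≥0 P) ⦄ (ℤ.+≤+ ℕ.z≤n))

module Scaled (R′ m : ℕ) ⦃ m≢0 : NonZero m ⦄ where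
  R V : ℕ
  R = suc R′
  V = m * R

  instance
    V≢0 : NonZero V
    V≢0 = ℕₚ.m*n≢0 m R

  open InnerProduct V public
  open InnerProduct R using () renaming (δ to δᴿ) public

  δ-scale : ∀ i → δ (m * i) ≡ δᴿ i
  δ-scale i with V ℕ∣.∣? m * i | R ℕ∣.∣? i
  ... | yes _ | yes _ = refl
  ... | no  _ | no  _ = refl
  ... | yes h | no ¬h = contradiction (ℕ∣.*-cancelˡ-∣ m h) ¬h
  ... | no ¬h | yes h = contradiction (ℕ∣.*-monoʳ-∣ m h) ¬h

  ⟦⟧δ-scale : ∀ x i → ⟦ dilate m x ⟧ δ (m * i) ≡ ⟦ x ⟧ δᴿ i
  ⟦⟧δ-scale []            i = refl
  ⟦⟧δ-scale ((c , k) ∷ x) i = cong₂ (λ a b → c ℤ.* a ℤ.+ b)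
    (trans (cong δ (sym (ℕₚ.*-distribˡ-+ m k i))) (δ-scale (k + i))) (⟦⟧δ-scale x i)

  pairing : ∀ {f} → Periodic V f → ∀ x → ⟪ f , ⟦ dilate m x ⟧ δ ⟫ ≡ ⟦ dilate R′ x ⟧ (λ i → f (m * i)) 0
  pairing {f} per x = begin
    ⟪ f , ⟦ dilate m x ⟧ δ ⟫ ≡⟨ ⟪⟫-comm f _ ⟩
    ⟪ ⟦ dilate m x ⟧ δ , f ⟫ ≡⟨ adjoint δ-periodic per (dilate m x) ⟩
    ⟪ δ , ⟦ bar (dilate m x) ⟧ f ⟫ ≡⟨ ⟪⟫-comm δ _ ⟩
    ⟪ ⟦ bar (dilate m x) ⟧ f , δ ⟫ ≡⟨ ⟪f,δ⟫ (⟦ bar (dilate m x) ⟧ f) ⟩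
    ⟦ bar (dilate m x) ⟧ f 0 ≡⟨ rescale x ⟩
    ⟦ dilate R′ x ⟧ (λ i → f (m * i)) 0 ∎
    where
    open ≡.≡-Reasoning
    v = ℕ.pred V
    indices : ∀ k → k * V + (v * (m * k) + 0) ≡ (m * k) * V + m * (R′ * k + 0)
    indices k = trans (expand k m R′ v) (cong (λ u → (m * k) * u + m * (R′ * k + 0)) (ℕₚ.suc-pred V))
      where
      expand : ∀ k m R′ v → k * (m * suc R′) + (v * (m * k) + 0) ≡ (m * k) * suc v + m * (R′ * k + 0)
      expand = ℕ-Solver.solve-∀
    rescale : ∀ x → ⟦ bar (dilate m x) ⟧ f 0 ≡ ⟦ dilate R′ x ⟧ (λ i → f (m * i)) 0
    rescale []            = refl
    rescale ((c , k) ∷ x) = cong₂ (λ a b → c ℤ.* a ℤ.+ b) (periodic-cong per k (m * k) (indices k)) (rescale x)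

  -- U is chosen so that U δ generates the constrained sequences and has minimal norm 2 c; then an
  -- isometry E sends it to a signed translate of itself.
  module MinimalVector
    (ps : List (ℕ × ℕ)) (U : Op) (k c : ℕ)
    (U-killed : ∀ {f} → Periodic V f → Kills (constraints V (map (scale m) ps)) (⟦ dilate m U ⟧ f))
    (U-pair : ∀ {h} → Kills (constraints V (map (scale m) ps)) h → ∀ y →
              ⟦ dilate R′ U ⟧ (λ i → h (m * i + y)) 0 ≡ + c ℤ.* (h y ℤ.- h (m * k + y)))
    (U-norm : ⟦ dilate R′ U ⟧ (⟦ U ⟧ δᴿ) 0 ≡ + (2 * c))
    (U-shift : ⟦ dilate R′ (shift k ⋆ U) ⟧ (⟦ U ⟧ δᴿ) 0 ℤ.< 0ℤ)
    where

    Z : List Op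
    Z = constraints V (map (scale m) ps)

    per : ∀ {f} → Kills Z f → Periodic V f
    per = kills⇒periodic {V} {map (scale m) ps}

    u : Seq
    u = ⟦ dilate m U ⟧ δ

    u-killed : Kills Z u
    u-killed = U-killed δ-periodic

    ⟪u,u⟫ : ⟪ u , u ⟫ ≡ + (2 * c)
    ⟪u,u⟫ = trans (pairing (per u-killed) U) (trans (⟦⟧-cong (dilate R′ U) (⟦⟧δ-scale U) 0) U-norm)

    ⟪u,shift⟫ : ⟪ u , ⟦ shift (m * k) ⟧ u ⟫ ℤ.< 0ℤ
    ⟪u,shift⟫ = subst (ℤ._< 0ℤ) (sym (trans
      (⟪⟫-congʳ u (λ y → trans (sym (⟦⟧-⋆ (shift (m * k)) (dilate m U) δ y))
        (cong (λ o → ⟦ o ⟧ δ y) (sym (dilate-⋆ m (shift k) U)))))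
      (trans (pairing (per u-killed) (shift k ⋆ U)) (⟦⟧-cong (dilate R′ (shift k ⋆ U)) (⟦⟧δ-scale U) 0)))) U-shift

    module _ (E : Op) (isometry : ∀ {f g} → Kills Z f → Kills Z g → ⟪ ⟦ E ⟧ f , ⟦ E ⟧ g ⟫ ≡ ⟪ f , g ⟫) where

      private
        h : Seq
        h = ⟦ E ⟧ u

        h-killed : Kills Z h
        h-killed = Kills-act E u-killed

        descent : ∃ λ y → h y ℤ.* h (m * k + y) ℤ.< 0ℤ
        descent = ∑-negative V _ (subst (ℤ._< 0ℤ) (sym (trans
          (⟪⟫-congʳ h (λ y → trans (sym (⟦⟧-Sh (m * k) h y)) (⟦⟧-comm (shift (m * k)) E u y)))
          (isometry u-killed (Kills-act (shift (m * k)) u-killed)))) ⟪u,shift⟫)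

        y₀ = proj₁ descent

        h₀ : Seq
        h₀ y = h (y₀ + y)

        per-h₀ : Periodic V h₀
        per-h₀ y = trans (cong h (rearrange y₀ V y)) (per h-killed _)
          where
          rearrange : ∀ a b y → a + (b + y) ≡ b + (a + y)
          rearrange = ℕ-Solver.solve-∀

        gap : ℤ
        gap = h y₀ ℤ.- h (m * k + y₀)

        ⟪h₀,u⟫ : ⟪ h₀ , u ⟫ ≡ + c ℤ.* gap
        ⟪h₀,u⟫ = trans (pairing per-h₀ U) (trans (⟦⟧-cong (dilate R′ U) (λ i → cong h (ℕₚ.+-comm y₀ (m * i))) 0) (U-pair h-killed y₀))

        ⟪h₀,h₀⟫ : ⟪ h₀ , h₀ ⟫ ≡ + (2 * c)
        ⟪h₀,h₀⟫ = trans (⟪⟫-shift (per h-killed) (per h-killed) y₀) (trans (isometry u-killed u-killed) ⟪u,u⟫)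

        close : ∀ ε → ε ℤ.* ε ≡ 1ℤ → + 2 ℤ.≤ ε ℤ.* gap → ∀ y → h₀ y ≡ ε ℤ.* u y
        close ε ε²≡1 2≤gap y = ℤₚ.i-j≡0⇒i≡j _ _ (trans (cong (λ v → h₀ y ℤ.+ v) (ℤₚ.neg-distribˡ-* ε (u y)))
          (⟪⟫-definite {λ y → h₀ y ℤ.+ ℤ.- ε ℤ.* u y} (λ y → cong₂ (λ a b → a ℤ.+ ℤ.- ε ℤ.* b) (per-h₀ y) (per u-killed y)) small y))
          where
          open ≡.≡-Reasoning
          d : Seq
          d y = h₀ y ℤ.+ ℤ.- ε ℤ.* u y
          ⟪d,⟫ : ∀ g → ⟪ d , g ⟫ ≡ ⟪ h₀ , g ⟫ ℤ.+ ℤ.- ε ℤ.* ⟪ u , g ⟫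
          ⟪d,⟫ g = trans (⟪⟫-+ˡ h₀ _ g) (cong (λ v → ⟪ h₀ , g ⟫ ℤ.+ v) (⟪⟫-*ˡ (ℤ.- ε) u g))
          norm : ⟪ d , d ⟫ ≡ + 2 ℤ.* + c ℤ.* (+ 2 ℤ.- ε ℤ.* gap)
          norm = begin
            ⟪ d , d ⟫ ≡⟨ ⟪d,⟫ d ⟩
            ⟪ h₀ , d ⟫ ℤ.+ ℤ.- ε ℤ.* ⟪ u , d ⟫
              ≡⟨ cong₂ (λ a b → a ℤ.+ ℤ.- ε ℤ.* b) (trans (⟪⟫-comm h₀ d) (⟪d,⟫ h₀)) (trans (⟪⟫-comm u d) (⟪d,⟫ u)) ⟩
            (⟪ h₀ , h₀ ⟫ ℤ.+ ℤ.- ε ℤ.* ⟪ u , h₀ ⟫) ℤ.+ ℤ.- ε ℤ.* (⟪ h₀ , u ⟫ ℤ.+ ℤ.- ε ℤ.* ⟪ u , u ⟫)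
              ≡⟨ cong₂ (λ a b → a ℤ.+ ℤ.- ε ℤ.* b) (cong₂ (λ a b → a ℤ.+ ℤ.- ε ℤ.* b) (trans ⟪h₀,h₀⟫ (ℤₚ.pos-* 2 c)) (trans (⟪⟫-comm u h₀) ⟪h₀,u⟫))
                   (cong₂ (λ a b → a ℤ.+ ℤ.- ε ℤ.* b) ⟪h₀,u⟫ (trans ⟪u,u⟫ (ℤₚ.pos-* 2 c))) ⟩
            (+ 2 ℤ.* + c ℤ.+ ℤ.- ε ℤ.* (+ c ℤ.* gap)) ℤ.+ ℤ.- ε ℤ.* (+ c ℤ.* gap ℤ.+ ℤ.- ε ℤ.* (+ 2 ℤ.* + c))
              ≡⟨ expand (+ c) ε gap ⟩
            + 2 ℤ.* + c ℤ.* (1ℤ ℤ.+ ε ℤ.* ε ℤ.- ε ℤ.* gap) ≡⟨ cong (λ v → + 2 ℤ.* + c ℤ.* (1ℤ ℤ.+ v ℤ.- ε ℤ.* gap)) ε²≡1 ⟩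
            + 2 ℤ.* + c ℤ.* (+ 2 ℤ.- ε ℤ.* gap) ∎
            where
            expand : ∀ c ε g → (+ 2 ℤ.* c ℤ.+ ℤ.- ε ℤ.* (c ℤ.* g)) ℤ.+ ℤ.- ε ℤ.* (c ℤ.* g ℤ.+ ℤ.- ε ℤ.* (+ 2 ℤ.* c))
              ≡ + 2 ℤ.* c ℤ.* (1ℤ ℤ.+ ε ℤ.* ε ℤ.- ε ℤ.* g)
            expand = ℤ-Solver.solve-∀
          small : ⟪ d , d ⟫ ℤ.≤ 0ℤ
          small = ℤₚ.≤-trans (ℤₚ.≤-reflexive (trans norm (cong (ℤ._* (+ 2 ℤ.- ε ℤ.* gap)) (sym (ℤₚ.pos-* 2 c)))))
            (ℤₚ.≤-trans (ℤₚ.*-monoˡ-≤-nonNeg (+ (2 * c)) (ℤₚ.i≤j⇒i-j≤0 2≤gap)) (ℤₚ.≤-reflexive (ℤₚ.*-zeroʳ (+ (2 * c)))))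

        translate : ∀ {ε} → (∀ y → h₀ y ≡ ε ℤ.* u y) → ∀ y → h y ≡ ε ℤ.* u (ℕ.pred V * y₀ + y)
        translate e y = trans (sym (periodic-cancel (per h-killed) y₀ y)) (e _)

      signed-translate : ∃₂ λ ε s → Sign ε × (∀ y → ⟦ E ⟧ u y ≡ ε ℤ.* u (s + y))
      signed-translate with opposite-signs (h y₀) (h (m * k + y₀)) (proj₂ descent)
      ... | inj₁ g = 1ℤ , _ , inj₁ refl , translate {1ℤ} (close 1ℤ refl (subst (+ 2 ℤ.≤_) (sym (ℤₚ.*-identityˡ gap)) g))
      ... | inj₂ g = -1ℤ , _ , inj₂ refl , translate { -1ℤ} (close -1ℤ refl (subst (+ 2 ℤ.≤_) (flip (h y₀) (h (m * k + y₀))) g))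
        where
        flip : ∀ a b → b ℤ.- a ≡ -1ℤ ℤ.* (a ℤ.- b)
        flip = ℤ-Solver.solve-∀

    module Bound
      (qs : List (ℕ × ℕ)) (C : Op)
      (qs-cosets : All (λ (p , r) → p * r ≡ R × Prime p) qs)
      (factor : ∀ {f} → Periodic V f → ∀ y → ⟦ projects (map (scale m) qs) ⟧ f y ≡ ⟦ C ⟧ (⟦ dilate m U ⟧ f) y)
      (negation : (∃ λ s → ∀ {f} → Kills Z f → ∀ y → f (s + y) ≡ -1ℤ ℤ.* f y) ⊎ All (λ (p , _) → Odd p) qs)
      (d : ℕ)
      (rs : List ℕ) (rs-product : product rs ≡ V)
      (rs-good : All (λ p → Good R (R * d) p × (∃ λ r → (p , r) ∈ qs)) rs)
      (g κ : ℕ)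
      (fixed-points : ∀ s → ∑ V (λ y → if ⌊ V ℕ∣.∣? (R * d * y + s) ⌋ then 1ℤ else 0ℤ) ℤ.≤ + g)
      where

      private
        radical = product∣^ {R} rs (All.map (λ { (_ , r , p∈qs) → divides r
          (trans (sym (proj₁ (All.lookup qs-cosets p∈qs))) (ℕₚ.*-comm _ r)) }) rs-good)
        N = proj₁ radical
        V∣R^N : V ℕ∣.∣ R ^ N
        V∣R^N = subst (ℕ∣._∣ (R ^ N)) rs-product (proj₂ radical)

      D t : ℕ
      D = R * d
      t = 1 + D

      open Projection V

      P : ℤ
      P = degree qs

      ops = projects (map (scale m) qs)

      module _ (x : Op) (n : ℕ) (E : Op)
        (isometry : ∀ {f g} → Kills Z f → Kills Z g → ⟪ ⟦ E ⟧ f , ⟦ E ⟧ g ⟫ ≡ ⟪ f , g ⟫)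
        (σx≡Ex : ∀ f → Kills Z f → ∀ y → ⟦ dilate t x ⟧ f y ≡ ⟦ E ⟧ (⟦ x ⟧ f) y)
        (x̄x≡n : ∀ f → Kills Z f → ∀ y → ⟦ bar x ⟧ (⟦ x ⟧ f) y ≡ + n ℤ.* f y)
        (b² : ∀ y → ⟦ x ⟧ δ y ℤ.* ⟦ x ⟧ δ y ℤ.≤ + (κ * κ))
        where

        private
          cosets : All Cosets (map (scale m) qs)
          cosets = Allₚ.map⁺ (All.map (λ { {p , r} (e , pr) → scaled-coset p m r e , prime⇒nonZero pr }) qs-cosets)

          f₀ b F : Seq
          f₀ = ⟦ ops ⟧ δ
          b  = ⟦ x ⟧ δ
          F  = ⟦ x ⟧ f₀

          f₀≡Cu : ∀ y → f₀ y ≡ ⟦ C ⟧ u y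
          f₀≡Cu = factor δ-periodic

          f₀-killed : Kills Z f₀
          f₀-killed = All.map (λ {z} h y → trans (⟦⟧-cong z f₀≡Cu y) (h y)) (Kills-act C u-killed)

          F-killed : Kills Z F
          F-killed = Kills-act x f₀-killed

          F≡ : ∀ y → F y ≡ ⟦ ops ⟧ b y
          F≡ = ⟦⟧-comm x ops δ

          per-b : Periodic V b
          per-b = periodic-act x δ-periodic

          F-cosets : All (λ (p , w) → ∀ y → ⟦ psum p w ⟧ F y ≡ 0ℤ) (map (scale m) qs)
          F-cosets = All.map (λ { {p , w} h y → trans (⟦⟧-cong (psum p w) F≡ y) (h y) })
                       (projects-killed (map (scale m) qs) cosets per-b)

          δ-t : ∀ z → δ (t * z) ≡ δ z
          δ-t z with V ℕ∣.∣? t * z | V ℕ∣.∣? z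
          ... | yes _ | yes _ = refl
          ... | no  _ | no  _ = refl
          ... | yes h | no ¬h = contradiction (unit-cancel N V∣R^N d h) ¬h
          ... | no ¬h | yes h = contradiction (ℕ∣.∣n⇒∣m*n t h) ¬h

          scaled-t : ∀ x z → ⟦ dilate m x ⟧ δ (t * z) ≡ ⟦ dilate m x ⟧ δ z
          scaled-t []            z = refl
          scaled-t ((c , k) ∷ x) z = cong₂ (λ a b → c ℤ.* a ℤ.+ b)
            (trans (periodic-cong δ-periodic (d * k) 0 (expand d k m R z)) (δ-t (m * k + z))) (scaled-t x z)
            where
            expand : ∀ d k m R z → (d * k) * (m * R) + (m * k + (1 + R * d) * z) ≡ (1 + R * d) * (m * k + z)
            expand = ℕ-Solver.solve-∀

          f₀-t : ∀ z → f₀ (t * z) ≡ f₀ z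
          f₀-t z = trans (cong (λ o → ⟦ o ⟧ δ (t * z)) (sym (dilate-projects m qs)))
            (trans (scaled-t (projects qs) z) (cong (λ o → ⟦ o ⟧ δ z) (dilate-projects m qs)))

          σx-t : ∀ y → ⟦ dilate t x ⟧ f₀ (t * y) ≡ F y
          σx-t y = trans (⟦⟧-dilate t x f₀ (t * y)) (trans
            (⟦⟧-cong x (λ k → trans (cong f₀ (trans (sym (ℕₚ.*-distribˡ-+ t k y)) (cong (t ℕ.*_) (ℕₚ.+-comm k y)))) (f₀-t (y + k))) 0)
            (trans (⟦⟧-shift x y f₀ 0) (cong F (ℕₚ.+-identityʳ y))))

          relation : ∀ {ε s} → (∀ y → ⟦ E ⟧ u y ≡ ε ℤ.* u (s + y)) → ∀ y → F y ≡ ε ℤ.* F (t * y + s)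
          relation {ε} {s} e y = begin
            F y ≡⟨ sym (σx-t y) ⟩
            ⟦ dilate t x ⟧ f₀ (t * y) ≡⟨ σx≡Ex f₀ f₀-killed (t * y) ⟩
            ⟦ E ⟧ (⟦ x ⟧ f₀) (t * y) ≡⟨ ⟦⟧-comm E x f₀ (t * y) ⟩
            ⟦ x ⟧ (⟦ E ⟧ f₀) (t * y) ≡⟨ ⟦⟧-cong x Ef₀ (t * y) ⟩
            ⟦ x ⟧ (λ i → ε ℤ.* f₀ (s + i)) (t * y) ≡⟨ ⟦⟧-* x ε (λ i → f₀ (s + i)) (t * y) ⟩
            ε ℤ.* ⟦ x ⟧ (λ i → f₀ (s + i)) (t * y) ≡⟨ cong (ε ℤ.*_) (trans (⟦⟧-shift x s f₀ (t * y)) (cong F (ℕₚ.+-comm s _))) ⟩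
            ε ℤ.* F (t * y + s) ∎
            where
            open ≡.≡-Reasoning
            Ef₀ : ∀ i → ⟦ E ⟧ f₀ i ≡ ε ℤ.* f₀ (s + i)
            Ef₀ i = trans (⟦⟧-cong E f₀≡Cu i) (trans (⟦⟧-comm E C u i) (trans (⟦⟧-cong C e i)
              (trans (⟦⟧-* C ε (λ j → u (s + j)) i) (cong (ε ℤ.*_) (trans (⟦⟧-shift C s u i) (sym (f₀≡Cu (s + i))))))))

          Affine : Set
          Affine = ∃₂ λ ε s → Sign ε × (ε ≡ 1ℤ ⊎ All (λ (p , _) → Odd p) qs) × (∀ y → F y ≡ ε ℤ.* F (t * y + s))

          affine-from : (∃₂ λ ε s → Sign ε × (∀ y → ⟦ E ⟧ u y ≡ ε ℤ.* u (s + y))) →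
            (∃ λ s → ∀ {f} → Kills Z f → ∀ y → f (s + y) ≡ -1ℤ ℤ.* f y) ⊎ All (λ (p , _) → Odd p) qs → Affine
          affine-from (ε , s , sg , e)        (inj₂ odd) = ε , s , sg , inj₂ odd , relation {ε} {s} e
          affine-from (ε , s , inj₁ ε≡1 , e)  (inj₁ _)   = ε , s , inj₁ ε≡1 , inj₁ ε≡1 , relation {ε} {s} e
          affine-from (ε , s , inj₂ refl , e) (inj₁ (s₁ , minus)) = 1ℤ , s + s₁ , inj₁ refl , inj₁ refl ,
            λ y → trans (relation {ε} {s} e y) (trans (sym (minus F-killed _))
              (trans (cong F (rearrange s₁ (t * y) s)) (sym (ℤₚ.*-identityˡ _))))
            where
            rearrange : ∀ a b c → a + (b + c) ≡ b + (c + a)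
            rearrange = ℕ-Solver.solve-∀

          affine : Affine
          affine = affine-from (signed-translate E isometry) negation

          ε₀ = proj₁ affine
          s₀ = proj₁ (proj₂ affine)

          support : ∀ y → ¬ V ℕ∣.∣ D * y + s₀ → F y ≡ 0ℤ
          support = affine-vanish {d = d} {N = N} (per F-killed) (proj₁ props) (proj₂ (proj₂ props)) V∣R^N rs rs-product
            (All.map (λ { {p} (good-p , r , p∈qs) → good-p , r , m * r , proj₁ (All.lookup qs-cosets p∈qs)
                 , scaled-coset p m r (proj₁ (All.lookup qs-cosets p∈qs)) , proj₂ (All.lookup qs-cosets p∈qs)
                 , All.lookup (Allₚ.map⁻ F-cosets) p∈qs , odd-at p∈qs (proj₁ (proj₂ props)) }) rs-good)
            where
            props = proj₂ (proj₂ affine)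
            odd-at : ∀ {p r ε} → (p , r) ∈ qs → ε ≡ 1ℤ ⊎ All (λ (p , _) → Odd p) qs → ε ≡ 1ℤ ⊎ Odd p
            odd-at _    (inj₁ e) = inj₁ e
            odd-at p∈qs (inj₂ o) = inj₂ (All.lookup o p∈qs)

          indicator : Seq
          indicator y = if ⌊ V ℕ∣.∣? (D * y + s₀) ⌋ then 1ℤ else 0ℤ

          ⟪F,F⟫≡P⟪b,F⟫ : ⟪ F , F ⟫ ≡ P ℤ.* ⟪ b , F ⟫
          ⟪F,F⟫≡P⟪b,F⟫ = trans (⟪⟫-congˡ F F≡) (trans (⟪projects⟫ (map (scale m) qs) cosets per-b (per F-killed) F-cosets)
            (cong (ℤ._* ⟪ b , F ⟫) (degree-scale m qs)))

          ⟪F,F⟫≡ : ⟪ F , F ⟫ ≡ + n ℤ.* (P ℤ.* ⟦ projects qs ⟧ δᴿ 0)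
          ⟪F,F⟫≡ = begin
            ⟪ ⟦ x ⟧ f₀ , ⟦ x ⟧ f₀ ⟫ ≡⟨ adjoint (per f₀-killed) (per F-killed) x ⟩
            ⟪ f₀ , ⟦ bar x ⟧ (⟦ x ⟧ f₀) ⟫ ≡⟨ ⟪⟫-congʳ f₀ (x̄x≡n f₀ f₀-killed) ⟩
            ⟪ f₀ , (λ y → + n ℤ.* f₀ y) ⟫ ≡⟨ ⟪⟫-*ʳ (+ n) f₀ f₀ ⟩
            + n ℤ.* ⟪ f₀ , f₀ ⟫ ≡⟨ cong (+ n ℤ.*_) (⟪projects⟫ (map (scale m) qs) cosets δ-periodic (per f₀-killed)
                 (projects-killed (map (scale m) qs) cosets δ-periodic)) ⟩
            + n ℤ.* (degree (map (scale m) qs) ℤ.* ⟪ δ , f₀ ⟫) ≡⟨ cong (+ n ℤ.*_) (cong₂ ℤ._*_ (degree-scale m qs)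
                 (trans (⟪⟫-comm δ f₀) (trans (⟪f,δ⟫ f₀) f₀0))) ⟩
            + n ℤ.* (P ℤ.* ⟦ projects qs ⟧ δᴿ 0) ∎
            where
            open ≡.≡-Reasoning
            f₀0 : f₀ 0 ≡ ⟦ projects qs ⟧ δᴿ 0
            f₀0 = trans (cong (λ o → ⟦ o ⟧ δ 0) (sym (dilate-projects m qs)))
              (trans (cong (⟦ dilate m (projects qs) ⟧ δ) (sym (ℕₚ.*-zeroʳ m))) (⟦⟧δ-scale (projects qs) 0))

          bF FF : Seq
          bF y = b y ℤ.* F y
          FF y = F y ℤ.* F y

          pointwise : ∀ y → + 2 ℤ.* P ℤ.* bF y ℤ.+ -1ℤ ℤ.* FF y ℤ.≤ (P ℤ.* P ℤ.* + (κ * κ)) ℤ.* indicator y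
          pointwise y with V ℕ∣.∣? (D * y + s₀)
          ... | no ¬h = outside P (b y) (F y) (support y ¬h)
          ... | yes _ = inside P (b y) (F y) (b² y)

        bound : + n ℤ.* (P ℤ.* ⟦ projects qs ⟧ δᴿ 0) ℤ.≤ P ℤ.* P ℤ.* + (κ * κ) ℤ.* + g
        bound = begin
          + n ℤ.* (P ℤ.* ⟦ projects qs ⟧ δᴿ 0) ≡⟨ sym ⟪F,F⟫≡ ⟩
          ⟪ F , F ⟫ ≡⟨ double ⟪ F , F ⟫ ⟩
          + 2 ℤ.* ⟪ F , F ⟫ ℤ.+ -1ℤ ℤ.* ⟪ F , F ⟫ ≡⟨ cong (λ v → + 2 ℤ.* v ℤ.+ -1ℤ ℤ.* ⟪ F , F ⟫) ⟪F,F⟫≡P⟪b,F⟫ ⟩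
          + 2 ℤ.* (P ℤ.* ⟪ b , F ⟫) ℤ.+ -1ℤ ℤ.* ⟪ F , F ⟫ ≡⟨ cong (ℤ._+ (-1ℤ ℤ.* ⟪ F , F ⟫)) (sym (ℤₚ.*-assoc (+ 2) P ⟪ b , F ⟫)) ⟩
          + 2 ℤ.* P ℤ.* ⟪ b , F ⟫ ℤ.+ -1ℤ ℤ.* ⟪ F , F ⟫ ≡⟨ cong₂ ℤ._+_ (sym (∑-* V (+ 2 ℤ.* P) bF)) (sym (∑-* V -1ℤ FF)) ⟩
          ∑ V (λ y → + 2 ℤ.* P ℤ.* bF y) ℤ.+ ∑ V (λ y → -1ℤ ℤ.* FF y) ≡⟨ sym (∑-+ V (λ y → + 2 ℤ.* P ℤ.* bF y) (λ y → -1ℤ ℤ.* FF y)) ⟩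
          ∑ V (λ y → + 2 ℤ.* P ℤ.* bF y ℤ.+ -1ℤ ℤ.* FF y) ≤⟨ ∑-mono V pointwise ⟩
          ∑ V (λ y → (P ℤ.* P ℤ.* + (κ * κ)) ℤ.* indicator y) ≡⟨ ∑-* V (P ℤ.* P ℤ.* + (κ * κ)) indicator ⟩
          P ℤ.* P ℤ.* + (κ * κ) ℤ.* ∑ V indicator ≤⟨ ℤₚ.*-monoˡ-≤-nonNeg (P ℤ.* P ℤ.* + (κ * κ)) ⦃ ℤ.nonNegative (P²κ²≥0 P (κ * κ)) ⦄ (fixed-points s₀) ⟩
          P ℤ.* P ℤ.* + (κ * κ) ℤ.* + g ∎
          where
          open ℤₚ.≤-Reasoning
          double : ∀ a → a ≡ + 2 ℤ.* a ℤ.+ -1ℤ ℤ.* a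
          double = ℤ-Solver.solve-∀

      module _ (ps-cosets : All (λ (p , r) → p * r ≡ R) ps) where
        open OperatorRing Z using (_≈_; operatorRing)
        open RingCongruence operatorRing using (_∣_; cofactor; equality)

        fixes : All (DilationFixes V t) (map (scale m) ps)
        fixes = Allₚ.map⁺ (All.map (λ { {p , r} e → scaled-coset p m r e , d * r , cong suc (trans (cong (ℕ._* d) (sym e)) (swap p r d)) }) ps-cosets)
          where
          swap : ∀ p r d → p * r * d ≡ d * r * p
          swap = ℕ-Solver.solve-∀


        no-weighing : ∀ {V₀ n} μ → V ≡ μ * V₀ → BoundedWeighing V₀ κ n → ⦃ _ : NonZero n ⦄ →
          (∀ x → x ⋆ bar x ≈ const (+ n) → const (+ n) ∣ dilate t x ⋆ bar x) →
          ∀ n₀ A B → n₀ ≤ n → P ℤ.* ⟦ projects qs ⟧ δᴿ 0 ≡ + A → P ℤ.* P ℤ.* + (κ * κ) ℤ.* + g ≡ + B → B < n₀ * A → ⊥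
        no-weighing {V₀} {n} μ V≡ W division n₀ A B n₀≤n A≡ B≡ B<n₀A =
          ℕₚ.<⇒≱ B<n₀A (ℕₚ.≤-trans (ℕₚ.*-monoˡ-≤ A n₀≤n) (ℤ.drop‿+≤+ (begin
            + (n * A) ≡⟨ ℤₚ.pos-* n A ⟩
            + n ℤ.* + A ≡⟨ cong (+ n ℤ.*_) (sym A≡) ⟩
            + n ℤ.* (P ℤ.* ⟦ projects qs ⟧ δᴿ 0)
              ≤⟨ bound x n (cofactor n∣σxx̄)
                   (Isometry.E-isometry V _ t n x (cofactor n∣σxx̄) fixes xx̄≈n (equality n∣σxx̄))
                   (Isometry.σx≈Ex V _ t n x (cofactor n∣σxx̄) fixes xx̄≈n (equality n∣σxx̄))
                   (λ f → Isometry.x̄xf≡nf V _ t n x (cofactor n∣σxx̄) fixes xx̄≈n (equality n∣σxx̄)) b² ⟩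
            P ℤ.* P ℤ.* + (κ * κ) ℤ.* + g ≡⟨ B≡ ⟩
            + B ∎)))
          where
          open ℤₚ.≤-Reasoning
          open PushForward W μ V V≡
          xx̄≈n : x ⋆ bar x ≈ const (+ n)
          xx̄≈n = OperatorRing.mk λ f kf → xx̄≡n f (per kf)
          n∣σxx̄ = division x xx̄≈n

-- Circulant weighing matrices

product-replicate : ∀ c p → product (replicate c p) ≡ p ^ c
product-replicate zero    p = refl
product-replicate (suc c) p = cong (p ℕ.*_) (product-replicate c p)

product-replicate₂ : ∀ c p d q → product (replicate c p ++ replicate d q) ≡ p ^ c * q ^ d
product-replicate₂ c p d q = trans (product-++ (replicate c p) (replicate d q)) (cong₂ ℕ._*_ (product-replicate c p) (product-replicate d q))

prime-2 : Prime 2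
prime-2 = toWitness {a? = prime? 2} _
prime-3 : Prime 3
prime-3 = toWitness {a? = prime? 3} _
prime-5 : Prime 5
prime-5 = toWitness {a? = prime? 5} _
prime-7 : Prime 7
prime-7 = toWitness {a? = prime? 7} _
prime-11 : Prime 11
prime-11 = toWitness {a? = prime? 11} _
prime-13 : Prime 13
prime-13 = toWitness {a? = prime? 13} _

difference : ℕ → Op
difference r = (1ℤ , 0) ∷ (-1ℤ , r) ∷ []

⟦difference⟧ : ∀ w f y → ⟦ difference w ⟧ f y ≡ f y ℤ.- f (w + y)
⟦difference⟧ w f y = rearrange (f y) (f (w + y))
  where
  rearrange : ∀ a b → 1ℤ ℤ.* a ℤ.+ (-1ℤ ℤ.* b ℤ.+ 0ℤ) ≡ a ℤ.- b
  rearrange = ℤ-Solver.solve-∀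

dilate-difference : ∀ m r → dilate m (difference r) ≡ difference (m * r)
dilate-difference m r = cong (λ i → (1ℤ , i) ∷ (-1ℤ , m * r) ∷ []) (ℕₚ.*-zeroʳ m)

difference-kills-psum : ∀ {V p w} ⦃ _ : NonZero V ⦄ → p * w ≡ V → ∀ {f} → Periodic V f → ∀ y → ⟦ psum p w ⟧ (⟦ difference w ⟧ f) y ≡ 0ℤ
difference-kills-psum {V} {p} {w} pw≡V {f} per y = trans (⟦⟧-comm (psum p w) (difference w) f y)
  (trans (⟦difference⟧ w (⟦ psum p w ⟧ f) y) (trans (cong (λ u → ⟦ psum p w ⟧ f y ℤ.- u) (Projection.psum-periodic V {p} {w} pw≡V {f} per y))
    (ℤₚ.+-inverseʳ (⟦ psum p w ⟧ f y))))

project-2 : ∀ w f y → ⟦ project 2 w ⟧ f y ≡ ⟦ const 1ℤ ⟧ (⟦ difference w ⟧ f) y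
project-2 w f y = trans (cong (λ i → + 2 ℤ.* f y ℤ.+ (-1ℤ ℤ.* f i ℤ.+ (-1ℤ ℤ.* f y ℤ.+ 0ℤ))) (cong (ℕ._+ y) (ℕₚ.*-identityˡ w)))
  (trans (rearrange (f y) (f (w + y))) (sym (⟦⟧-const 1ℤ (⟦ difference w ⟧ f) y)))
  where
  rearrange : ∀ a b → + 2 ℤ.* a ℤ.+ (-1ℤ ℤ.* b ℤ.+ (-1ℤ ℤ.* a ℤ.+ 0ℤ)) ≡ 1ℤ ℤ.* (1ℤ ℤ.* a ℤ.+ (-1ℤ ℤ.* b ℤ.+ 0ℤ))
  rearrange = ℤ-Solver.solve-∀

project-3 : ∀ w f y → ⟦ project 3 w ⟧ f y ≡ ⟦ (+ 2 , 0) ∷ (1ℤ , w) ∷ [] ⟧ (⟦ difference w ⟧ f) y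
project-3 w f y = trans (cong₂ (λ i j → + 3 ℤ.* f y ℤ.+ (-1ℤ ℤ.* f i ℤ.+ (-1ℤ ℤ.* f j ℤ.+ (-1ℤ ℤ.* f y ℤ.+ 0ℤ)))) (twice w y) (cong (ℕ._+ y) (ℕₚ.*-identityˡ w)))
  (rearrange (f y) (f (w + y)) (f (w + (w + y))))
  where
  twice : ∀ w y → 2 * w + y ≡ w + (w + y)
  twice = ℕ-Solver.solve-∀
  rearrange : ∀ a b c → + 3 ℤ.* a ℤ.+ (-1ℤ ℤ.* c ℤ.+ (-1ℤ ℤ.* b ℤ.+ (-1ℤ ℤ.* a ℤ.+ 0ℤ)))
    ≡ + 2 ℤ.* (1ℤ ℤ.* a ℤ.+ (-1ℤ ℤ.* b ℤ.+ 0ℤ)) ℤ.+ (1ℤ ℤ.* (1ℤ ℤ.* b ℤ.+ (-1ℤ ℤ.* c ℤ.+ 0ℤ)) ℤ.+ 0ℤ)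
  rearrange = ℤ-Solver.solve-∀

psum-2 : ∀ {w f} → (∀ y → ⟦ psum 2 w ⟧ f y ≡ 0ℤ) → ∀ y → f (w + y) ≡ -1ℤ ℤ.* f y
psum-2 {w} {f} h y = solve-for (f (w + y)) (f y) (trans (cong (λ i → 1ℤ ℤ.* f i ℤ.+ (1ℤ ℤ.* f y ℤ.+ 0ℤ)) (sym (cong (ℕ._+ y) (ℕₚ.*-identityˡ w)))) (h y))
  where
  rearrange : ∀ a b → a ≡ (1ℤ ℤ.* a ℤ.+ (1ℤ ℤ.* b ℤ.+ 0ℤ)) ℤ.+ -1ℤ ℤ.* b
  rearrange = ℤ-Solver.solve-∀
  solve-for : ∀ a b → 1ℤ ℤ.* a ℤ.+ (1ℤ ℤ.* b ℤ.+ 0ℤ) ≡ 0ℤ → a ≡ -1ℤ ℤ.* b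
  solve-for a b e = trans (rearrange a b) (trans (cong (λ u → u ℤ.+ -1ℤ ℤ.* b) e) (ℤₚ.+-identityˡ _))

δ[_] : ∀ R → ⦃ NonZero R ⦄ → Seq
δ[ R ] = InnerProduct.δ R

module SinglePrime (p r R′ m : ℕ) ⦃ m≢0 : NonZero m ⦄ (pr≡R : p * r ≡ suc R′)
  (norm : ⟦ dilate R′ (difference r) ⟧ (⟦ difference r ⟧ δ[ suc R′ ]) 0 ≡ + 2)
  (shifted : ⟦ dilate R′ (shift (R′ * r) ⋆ difference r) ⟧ (⟦ difference r ⟧ δ[ suc R′ ]) 0 ℤ.< 0ℤ)
  where
  open Scaled R′ m public

  private
    w = m * r

    pw≡V : p * w ≡ V
    pw≡V = scaled-coset p m r pr≡R

    killed : ∀ {f} → Periodic V f → Kills (constraints V ((p , w) ∷ [])) (⟦ dilate m (difference r) ⟧ f)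
    killed {f} per = kills {V} {(p , w) ∷ []} (periodic-act (dilate m (difference r)) per)
      ((λ y → trans (cong (λ o → ⟦ psum p w ⟧ (⟦ o ⟧ f) y) (dilate-difference m r)) (difference-kills-psum {V} {p} {w} pw≡V per y)) ∷ [])

    pair : ∀ {h} → Kills (constraints V ((p , w) ∷ [])) h → ∀ y →
      ⟦ dilate R′ (difference r) ⟧ (λ i → h (m * i + y)) 0 ≡ + 1 ℤ.* (h y ℤ.- h (m * (R′ * r) + y))
    pair {h} _ y = trans (cong (λ o → ⟦ o ⟧ (λ i → h (m * i + y)) 0) (dilate-difference R′ r))
      (trans (⟦difference⟧ (R′ * r) (λ i → h (m * i + y)) 0)
        (trans (cong₂ (λ i j → h (i + y) ℤ.- h (m * j + y)) (ℕₚ.*-zeroʳ m) (ℕₚ.+-identityʳ _)) (sym (ℤₚ.*-identityˡ _))))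

  open MinimalVector ((p , r) ∷ []) (difference r) (R′ * r) 1 killed pair norm shifted public

  factorisation : ∀ C₁ → (∀ f y → ⟦ project p w ⟧ f y ≡ ⟦ C₁ ⟧ (⟦ difference w ⟧ f) y) → ∀ rest {f} → Periodic V f → ∀ y →
    ⟦ projects (map (scale m) ((p , r) ∷ rest)) ⟧ f y ≡ ⟦ projects (map (scale m) rest) ⋆ C₁ ⟧ (⟦ dilate m (difference r) ⟧ f) y
  factorisation C₁ split rest {f} _ y = begin
    ⟦ project p w ⋆ others ⟧ f y ≡⟨ ⟦⟧-⋆ (project p w) others f y ⟩
    ⟦ project p w ⟧ (⟦ others ⟧ f) y ≡⟨ ⟦⟧-comm (project p w) others f y ⟩
    ⟦ others ⟧ (⟦ project p w ⟧ f) y ≡⟨ ⟦⟧-cong others (split f) y ⟩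
    ⟦ others ⟧ (⟦ C₁ ⟧ (⟦ difference w ⟧ f)) y ≡⟨ sym (⟦⟧-⋆ others C₁ (⟦ difference w ⟧ f) y) ⟩
    ⟦ others ⋆ C₁ ⟧ (⟦ difference w ⟧ f) y ≡⟨ cong (λ o → ⟦ others ⋆ C₁ ⟧ (⟦ o ⟧ f) y) (sym (dilate-difference m r)) ⟩
    ⟦ others ⋆ C₁ ⟧ (⟦ dilate m (difference r) ⟧ f) y ∎
    where
    open ≡.≡-Reasoning
    others = projects (map (scale m) rest)

  kills-head : ∀ {f} → Kills Z f → ∀ y → ⟦ psum p w ⟧ f y ≡ 0ℤ
  kills-head k = All.head (kills⇒psum {V} {(p , w) ∷ []} k)

pow≥ : ∀ b ⦃ _ : NonZero b ⦄ k j → b ^ j ≤ b ^ (k + j)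
pow≥ b k j = ℕₚ.^-monoʳ-≤ b (ℕₚ.m≤n+m j k)

coprime-^ : ∀ {a b} L → Coprime a b → Coprime a (b ^ L)
coprime-^ zero    cop (_ , d∣1) = ℕ∣.∣1⇒≡1 d∣1
coprime-^ (suc L) cop (d∣a , d∣b*b^L) = coprime-^ L cop
  (d∣a , coprime-divisor (λ (c∣d , c∣b) → cop (ℕ∣.∣-trans c∣d d∣a , c∣b)) d∣b*b^L)

coprime-^^ : ∀ {a b} K L → Coprime a b → Coprime (a ^ K) (b ^ L)
coprime-^^ K L cop = coprime-^ L (Coprimality.sym (coprime-^ K (Coprimality.sym cop)))

power-order : ∀ p a D → p ^ a ≡ 1 + D → ∀ {w} ps → product ps ≡ w → All (ℕ∣._∣ D) ps → p ^ (a * w) ≡ 1 mod w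
power-order p a D e ps refl h = subst (λ u → u ≡ 1 mod product ps)
  (trans (cong (ℕ._^ product ps) (sym e)) (ℕₚ.^-*-assoc p a (product ps))) (pow-product≡1 D ps h)

power-log : ∀ p a {u t w} → p ^ a ≡ u → ∃ (λ r → (u ^ r) ≡ t mod w) → ∃ λ r → (p ^ r) ≡ t mod w
power-log p a {t = t} {w} refl (r , h) = a * r , subst (λ u → u ≡ t mod w) (ℕₚ.^-*-assoc p a r) h

<-by-computation : ∀ {a b} → {h : True (a ℕ.<? b)} → a < b
<-by-computation {h = h} = toWitness h

-- t = 7² and n / 2 ≤ 16
no-CW-7 : ∀ c e → ¬ CW (2 ^ c) (7 ^ (2 * e + 2))
no-CW-7 c e cw = no-weighing (refl ∷ []) 16 (V≡ (2 ^ c)) (cyclic cw) ⦃ ℕₚ.m^n≢0 7 (2 * e + 2) ⦄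
  (λ x → divides-prime-power {t = t} {x} {bar x} {7} {2 * e + 2} fixes-7 refl)
  49 2 64 (pow≥ 7 (2 * e) 2) refl refl (ℕₚ.m≤m+n 65 33)
  where
  instance
    2^c≢0 : NonZero (2 ^ c)
    2^c≢0 = ℕₚ.m^n≢0 2 c
    m≢0 : NonZero (8 * 2 ^ c)
    m≢0 = ℕₚ.m*n≢0 8 (2 ^ c)
  open SinglePrime 2 1 1 (8 * 2 ^ c) refl refl ℤ.-<+
  V≡ : ∀ q → 8 * q * 2 ≡ 16 * q
  V≡ = ℕ-Solver.solve-∀
  rs = replicate (4 + c) 2
  rs-product : product rs ≡ V
  rs-product = trans (product-replicate (4 + c) 2) (collect (2 ^ c))
    where
    collect : ∀ q → 2 * (2 * (2 * (2 * q))) ≡ 8 * q * 2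
    collect = ℕ-Solver.solve-∀
  open Bound ((2 , 1) ∷ []) (const 1ℤ ⋆ const 1ℤ) ((refl , prime-2) ∷ []) (factorisation (const 1ℤ) (project-2 (8 * 2 ^ c * 1)) [])
    (inj₁ (_ , λ k → psum-2 (kills-head k)))
    24 rs rs-product (Allₚ.replicate⁺ (4 + c) (good-2 {2} {48} (divides 12 refl) , 1 , here refl))
    16 1 (fixed-point-count 16 3 (2 ^ c) (unit-cancel {R = 2} c ℕ∣.∣-refl 1) refl (V≡ (2 ^ c)))
  open ConstrainedRing V (map (scale (8 * 2 ^ c)) ((2 , 1) ∷ [])) using (Fixes; unramified; divides-prime-power)
  fixes-7 : Fixes t 7
  fixes-7 = unramified {t} ((scaled-coset 2 (8 * 2 ^ c) 1 refl , 24 , refl) ∷ []) prime-7 (2 * V) ⦃ ℕₚ.m*n≢0 2 V ⦄ 2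
    (power-order 7 2 48 refl rs rs-product (Allₚ.replicate⁺ (4 + c) (divides 24 refl))) (0 , 0 , refl)

-- t = 2⁶ and n (2/3) (6/7) ≤ 21
no-CW-3·7^d : ∀ d e → ¬ CW (3 * 7 ^ d) (2 ^ (2 * e + 6))
no-CW-3·7^d d e cw = no-weighing (refl ∷ []) 7 (V≡ (7 ^ d)) (cyclic cw) ⦃ ℕₚ.m^n≢0 2 (2 * e + 6) ⦄
  (λ x → divides-prime-power {t = t} {x} {bar x} {2} {2 * e + 6} fixes-2 refl)
  64 252 9261 (pow≥ 2 (2 * e) 6) refl refl <-by-computation
  where
  instance
    m≢0 : NonZero (7 ^ d)
    m≢0 = ℕₚ.m^n≢0 7 d
  open SinglePrime 3 7 20 (7 ^ d) refl refl ℤ.-<+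
  V≡ : ∀ q → q * 21 ≡ 7 * (3 * q)
  V≡ = ℕ-Solver.solve-∀
  rs = 3 ∷ replicate (suc d) 7
  rs-product : product rs ≡ V
  rs-product = trans (cong (3 ℕ.*_) (product-replicate (suc d) 7)) (collect (7 ^ d))
    where
    collect : ∀ q → 3 * (7 * q) ≡ q * 21
    collect = ℕ-Solver.solve-∀
  cancel-3 : ∀ {x} → 7 ^ d ℕ∣.∣ 3 * x → 7 ^ d ℕ∣.∣ x
  cancel-3 {x} h = unit-cancel {R = 7} d ℕ∣.∣-refl 2 (subst (7 ^ d ℕ∣.∣_) (sym (ℕₚ.*-assoc 5 3 x)) (ℕ∣.∣n⇒∣m*n 5 h))
  open Bound ((3 , 7) ∷ (7 , 3) ∷ []) (projects (map (scale (7 ^ d)) ((7 , 3) ∷ [])) ⋆ ((+ 2 , 0) ∷ (1ℤ , 7 ^ d * 7) ∷ [])) ((refl , prime-3) ∷ (refl , prime-7) ∷ [])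
    (factorisation ((+ 2 , 0) ∷ (1ℤ , 7 ^ d * 7) ∷ []) (project-3 (7 ^ d * 7)) ((7 , 3) ∷ []))
    (inj₂ ((1 , refl) ∷ (3 , refl) ∷ []))
    3 rs rs-product ((good-odd {21} {63} 1 (divides 3 refl) (divides 21 refl) , 7 , here refl)
      ∷ Allₚ.replicate⁺ (suc d) (good-odd {21} {63} 3 (divides 3 refl) (divides 9 refl) , 3 , there (here refl)))
    21 1 (fixed-point-count 21 3 (7 ^ d) cancel-3 refl (ℕₚ.*-comm (7 ^ d) 21))
  open ConstrainedRing V (map (scale (7 ^ d)) ((3 , 7) ∷ [])) using (Fixes; unramified; divides-prime-power)
  fixes-2 : Fixes t 2
  fixes-2 = unramified {t} ((scaled-coset 3 (7 ^ d) 7 refl , 21 , refl) ∷ []) prime-2 (6 * V) ⦃ ℕₚ.m*n≢0 6 V ⦄ 6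
    (power-order 2 6 63 refl rs rs-product (divides 21 refl ∷ Allₚ.replicate⁺ (suc d) (divides 9 refl))) (0 , 0 , refl)

coprime-2-5 : ∀ K L → Coprime (2 ^ K) (5 ^ L)
coprime-2-5 K L = coprime-^^ K L (toWitness {a? = coprime? 2 5} _)

100≤ : ∀ e f → 100 ≤ 2 ^ (2 * e + 2) * 5 ^ (2 * f + 2)
100≤ e f = ℕₚ.*-mono-≤ (pow≥ 2 (2 * e) 2) (pow≥ 5 (2 * f) 2)

2^K5^L≢0 : ∀ K L → NonZero (2 ^ K * 5 ^ L)
2^K5^L≢0 K L = ℕₚ.m*n≢0 _ _ ⦃ ℕₚ.m^n≢0 2 K ⦄ ⦃ ℕₚ.m^n≢0 5 L ⦄

p^cq^d≢0 : ∀ p c q d ⦃ _ : NonZero p ⦄ ⦃ _ : NonZero q ⦄ → NonZero (p ^ c * q ^ d)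
p^cq^d≢0 p c q d = ℕₚ.m*n≢0 _ _ ⦃ ℕₚ.m^n≢0 p c ⦄ ⦃ ℕₚ.m^n≢0 q d ⦄

cancel-1 : ∀ {w x} → w ℕ∣.∣ 1 * x → w ℕ∣.∣ x
cancel-1 {w} {x} = subst (w ℕ∣.∣_) (ℕₚ.*-identityˡ x)

replicate₂⁺ : ∀ {P : ℕ → Set} c p d q → P p → P q → All P (replicate c p ++ replicate d q)
replicate₂⁺ c p d q hp hq = Allₚ.++⁺ (Allₚ.replicate⁺ c hp) (Allₚ.replicate⁺ d hq)

-- t = 40 is a power of 27 modulo 13^d; n (2/3) (12/13) ≤ 39
no-CW-3^c13^d : ∀ c d f → ¬ CW (3 ^ c * 13 ^ d) (3 ^ (2 * f + 4))
no-CW-3^c13^d c d f cw = no-weighing (refl ∷ []) 39 (ℕₚ.*-comm v 39) (cyclic cw) ⦃ ℕₚ.m^n≢0 3 (2 * f + 4) ⦄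
  (λ x → divides-prime-power {t = t} {x} {bar x} {3} {2 * f + 4} fixes-3 refl)
  81 936 59319 (pow≥ 3 (2 * f) 4) refl refl <-by-computation
  where
  v = 3 ^ c * 13 ^ d
  instance
    v≢0 : NonZero v
    v≢0 = p^cq^d≢0 3 c 13 d
  open SinglePrime 3 13 38 v refl refl ℤ.-<+
  rs = 3 ∷ 13 ∷ replicate c 3 ++ replicate d 13
  rs-product : product rs ≡ V
  rs-product = trans (cong (λ u → 3 * (13 * u)) (product-replicate₂ c 3 d 13)) (collect v)
    where
    collect : ∀ q → 3 * (13 * q) ≡ q * 39
    collect = ℕ-Solver.solve-∀
  C₁ = (+ 2 , 0) ∷ (1ℤ , v * 13) ∷ []
  qs = (3 , 13) ∷ (13 , 3) ∷ []
  at-3 : Good 39 39 3 × ∃ λ r → (3 , r) ∈ qs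
  at-3 = good-odd {39} {39} 1 (divides 1 refl) (divides 13 refl) , 13 , here refl
  at-13 : Good 39 39 13 × ∃ λ r → (13 , r) ∈ qs
  at-13 = good-odd {39} {39} 6 (divides 1 refl) (divides 3 refl) , 3 , there (here refl)
  open Bound qs (projects (map (scale v) ((13 , 3) ∷ [])) ⋆ C₁) ((refl , prime-3) ∷ (refl , prime-13) ∷ [])
    (factorisation C₁ (project-3 (v * 13)) ((13 , 3) ∷ []))
    (inj₂ ((1 , refl) ∷ (6 , refl) ∷ []))
    1 rs rs-product (at-3 ∷ at-13 ∷ replicate₂⁺ c 3 d 13 at-3 at-13)
    39 1 (fixed-point-count 39 1 v cancel-1 refl (ℕₚ.*-comm v 39))
  open ConstrainedRing V (map (scale v) ((3 , 13) ∷ [])) using (Fixes; ramified; divides-prime-power)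
  w = 13 ^ suc d
  log : ∃ λ r → (3 ^ r) ≡ t mod w
  log = power-log 3 3 {27} {40} {w} refl
    (discrete-log {13} {13} {27} {40} 12 2 3 7 1 refl refl refl ℕ∣.∣-refl (good-odd {13} {13} 6 ℕ∣.∣-refl ℕ∣.∣-refl) refl d)
  fixes-3 : Fixes t 3
  fixes-3 = ramified {t} ((scaled-coset 3 v 13 refl , 13 , refl) ∷ []) prime-3 c w (V≡ (3 ^ c) (13 ^ d))
    (here (cong (3 ,_) (coset (3 ^ c) (13 ^ d)))) (3 * w) ⦃ ℕₚ.m*n≢0 3 w ⦃ _ ⦄ ⦃ ℕₚ.m^n≢0 13 (suc d) ⦄ ⦄ (proj₁ log)
    (power-order 3 3 26 refl (replicate (suc d) 13) (product-replicate (suc d) 13) (Allₚ.replicate⁺ (suc d) (divides 2 refl))) (proj₂ log)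
    where
    V≡ : ∀ a b → 3 * a * (13 * b) ≡ a * b * 39
    V≡ = ℕ-Solver.solve-∀
    coset : ∀ a b → a * (13 * b) ≡ a * b * 13
    coset = ℕ-Solver.solve-∀

-- t = 5⁵ is a power of 2¹⁰ modulo 11^d; n (1/2) (10/11) ≤ 44
no-CW-2^c11^d : ∀ c d e f → ¬ CW (2 ^ c * 11 ^ d) (2 ^ (2 * e + 2) * 5 ^ (2 * f + 2))
no-CW-2^c11^d c d e f cw = no-weighing (refl ∷ []) 44 (V≡ v) (cyclic cw) ⦃ 2^K5^L≢0 (2 * e + 2) (2 * f + 2) ⦄
  (λ x → divides-two-prime-powers {t = t} {x} {bar x} {2} {5} {2 * e + 2} {2 * f + 2} fixes-2 fixes-5
    (coprime-2-5 (2 * e + 2) (2 * f + 2)))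
  100 220 21296 (100≤ e f) refl refl <-by-computation
  where
  v = 2 ^ c * 11 ^ d
  m = 2 * v
  instance
    v≢0 : NonZero v
    v≢0 = p^cq^d≢0 2 c 11 d
    m≢0 : NonZero m
    m≢0 = ℕₚ.m*n≢0 2 v
  open SinglePrime 2 11 21 m refl refl ℤ.-<+
  V≡ : ∀ q → 2 * q * 22 ≡ 44 * q
  V≡ = ℕ-Solver.solve-∀
  rs = 2 ∷ 2 ∷ 11 ∷ replicate c 2 ++ replicate d 11
  rs-product : product rs ≡ V
  rs-product = trans (cong (λ u → 2 * (2 * (11 * u))) (product-replicate₂ c 2 d 11)) (collect v)
    where
    collect : ∀ q → 2 * (2 * (11 * q)) ≡ 2 * q * 22
    collect = ℕ-Solver.solve-∀
  qs = (2 , 11) ∷ (11 , 2) ∷ []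
  at-2 : Good 22 3124 2 × ∃ λ r → (2 , r) ∈ qs
  at-2 = good-2 {22} {3124} (divides 71 refl) , 11 , here refl
  at-11 : Good 22 3124 11 × ∃ λ r → (11 , r) ∈ qs
  at-11 = good-odd {22} {3124} 5 (divides 142 refl) (divides 284 refl) , 2 , there (here refl)
  cancel-71 : ∀ {x} → v ℕ∣.∣ 71 * x → v ℕ∣.∣ x
  cancel-71 {x} h = unit-cancel {R = 22} (proj₁ radical) (subst (ℕ∣._∣ (22 ^ proj₁ radical)) (product-replicate₂ c 2 d 11) (proj₂ radical)) 29
    (subst (v ℕ∣.∣_) (sym (ℕₚ.*-assoc 9 71 x)) (ℕ∣.∣n⇒∣m*n 9 h))
    where
    radical = product∣^ {22} (replicate c 2 ++ replicate d 11) (replicate₂⁺ c 2 d 11 (divides 11 refl) (divides 2 refl))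
  open Bound qs (projects (map (scale m) ((11 , 2) ∷ [])) ⋆ const 1ℤ) ((refl , prime-2) ∷ (refl , prime-11) ∷ [])
    (factorisation (const 1ℤ) (project-2 (m * 11)) ((11 , 2) ∷ []))
    (inj₁ (_ , λ k → psum-2 (kills-head k)))
    142 rs rs-product (at-2 ∷ at-2 ∷ at-11 ∷ replicate₂⁺ c 2 d 11 at-2 at-11)
    44 1 (fixed-point-count 44 71 v cancel-71 {22 * 142} refl {V} (V≡ v))
  open ConstrainedRing V (map (scale m) ((2 , 11) ∷ [])) using (Fixes; ramified; unramified; divides-two-prime-powers)
  fixed : All (DilationFixes V t) (map (scale m) ((2 , 11) ∷ []))
  fixed = (scaled-coset 2 m 11 refl , 1562 , refl) ∷ []
  w = 11 ^ suc d
  log : ∃ λ r → (2 ^ r) ≡ t mod w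
  log = power-log 2 10 {1024} {3125} {w} refl
    (discrete-log {11} {11} {1024} {3125} 10 93 284 9 76 refl refl refl ℕ∣.∣-refl (good-odd {11} {11} 5 ℕ∣.∣-refl ℕ∣.∣-refl) refl d)
  fixes-2 : Fixes t 2
  fixes-2 = ramified {t} fixed prime-2 (suc c) w (V≡′ (2 ^ c) (11 ^ d))
    (here (cong (2 ,_) (coset (2 ^ c) (11 ^ d)))) (10 * w) ⦃ ℕₚ.m*n≢0 10 w ⦃ _ ⦄ ⦃ ℕₚ.m^n≢0 11 (suc d) ⦄ ⦄ (proj₁ log)
    (power-order 2 10 1023 refl (replicate (suc d) 11) (product-replicate (suc d) 11) (Allₚ.replicate⁺ (suc d) (divides 93 refl))) (proj₂ log)
    where
    V≡′ : ∀ a b → 2 * (2 * a) * (11 * b) ≡ 2 * (a * b) * 22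
    V≡′ = ℕ-Solver.solve-∀
    coset : ∀ a b → 2 * a * (11 * b) ≡ 2 * (a * b) * 11
    coset = ℕ-Solver.solve-∀
  fixes-5 : Fixes t 5
  fixes-5 = unramified {t} fixed prime-5 (5 * V) ⦃ ℕₚ.m*n≢0 5 V ⦄ 5
    (power-order 5 5 3124 refl rs rs-product (2∣ ∷ 2∣ ∷ 11∣ ∷ replicate₂⁺ c 2 d 11 2∣ 11∣))
    (0 , 0 , refl)
    where
    2∣ : 2 ℕ∣.∣ 3124
    2∣ = divides 1562 refl
    11∣ : 11 ℕ∣.∣ 3124
    11∣ = divides 284 refl

-- t = 5² is a power of 4 modulo 3^d; n (1/2) (2/3) ≤ 24
no-CW-2^c3^d : ∀ c d e f → ¬ CW (2 ^ c * 3 ^ d) (2 ^ (2 * e + 2) * 5 ^ (2 * f + 2))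
no-CW-2^c3^d c d e f cw = no-weighing (refl ∷ []) 24 (V≡ v) (cyclic cw) ⦃ 2^K5^L≢0 (2 * e + 2) (2 * f + 2) ⦄
  (λ x → divides-two-prime-powers {t = t} {x} {bar x} {2} {5} {2 * e + 2} {2 * f + 2} fixes-2 fixes-5
    (coprime-2-5 (2 * e + 2) (2 * f + 2)))
  100 12 864 (100≤ e f) refl refl <-by-computation
  where
  v = 2 ^ c * 3 ^ d
  m = 4 * v
  instance
    v≢0 : NonZero v
    v≢0 = p^cq^d≢0 2 c 3 d
    m≢0 : NonZero m
    m≢0 = ℕₚ.m*n≢0 4 v
  open SinglePrime 2 3 5 m refl refl ℤ.-<+
  V≡ : ∀ q → 4 * q * 6 ≡ 24 * q
  V≡ = ℕ-Solver.solve-∀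
  rs = 2 ∷ 2 ∷ 2 ∷ 3 ∷ replicate c 2 ++ replicate d 3
  rs-product : product rs ≡ V
  rs-product = trans (cong (λ u → 2 * (2 * (2 * (3 * u)))) (product-replicate₂ c 2 d 3)) (collect v)
    where
    collect : ∀ q → 2 * (2 * (2 * (3 * q))) ≡ 4 * q * 6
    collect = ℕ-Solver.solve-∀
  qs = (2 , 3) ∷ (3 , 2) ∷ []
  at-2 : Good 6 24 2 × ∃ λ r → (2 , r) ∈ qs
  at-2 = good-2 {6} {24} (divides 2 refl) , 3 , here refl
  at-3 : Good 6 24 3 × ∃ λ r → (3 , r) ∈ qs
  at-3 = good-odd {6} {24} 1 (divides 4 refl) (divides 8 refl) , 2 , there (here refl)
  open Bound qs (projects (map (scale m) ((3 , 2) ∷ [])) ⋆ const 1ℤ) ((refl , prime-2) ∷ (refl , prime-3) ∷ [])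
    (factorisation (const 1ℤ) (project-2 (m * 3)) ((3 , 2) ∷ []))
    (inj₁ (_ , λ k → psum-2 (kills-head k)))
    4 rs rs-product (at-2 ∷ at-2 ∷ at-2 ∷ at-3 ∷ replicate₂⁺ c 2 d 3 at-2 at-3)
    24 1 (fixed-point-count 24 1 v cancel-1 refl (V≡ v))
  open ConstrainedRing V (map (scale m) ((2 , 3) ∷ [])) using (Fixes; ramified; unramified; divides-two-prime-powers)
  fixed : All (DilationFixes V t) (map (scale m) ((2 , 3) ∷ []))
  fixed = (scaled-coset 2 m 3 refl , 12 , refl) ∷ []
  w = 3 ^ suc d
  log : ∃ λ r → (2 ^ r) ≡ t mod w
  log = power-log 2 2 {4} {25} {w} refl
    (discrete-log {3} {3} {4} {25} 2 1 8 1 0 refl refl refl ℕ∣.∣-refl (good-odd {3} {3} 1 ℕ∣.∣-refl ℕ∣.∣-refl) refl d)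
  fixes-2 : Fixes t 2
  fixes-2 = ramified {t} fixed prime-2 (2 + c) w (V≡′ (2 ^ c) (3 ^ d))
    (here (cong (2 ,_) (coset (2 ^ c) (3 ^ d)))) (2 * w) ⦃ ℕₚ.m*n≢0 2 w ⦃ _ ⦄ ⦃ ℕₚ.m^n≢0 3 (suc d) ⦄ ⦄ (proj₁ log)
    (power-order 2 2 3 refl (replicate (suc d) 3) (product-replicate (suc d) 3) (Allₚ.replicate⁺ (suc d) (divides 1 refl))) (proj₂ log)
    where
    V≡′ : ∀ a b → 2 * (2 * (2 * a)) * (3 * b) ≡ 4 * (a * b) * 6
    V≡′ = ℕ-Solver.solve-∀
    coset : ∀ a b → 2 * (2 * a) * (3 * b) ≡ 4 * (a * b) * 3
    coset = ℕ-Solver.solve-∀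
  fixes-5 : Fixes t 5
  fixes-5 = unramified {t} fixed prime-5 (2 * V) ⦃ ℕₚ.m*n≢0 2 V ⦄ 2
    (power-order 5 2 24 refl rs rs-product (divides 12 refl ∷ divides 12 refl ∷ divides 12 refl ∷ divides 8 refl
      ∷ replicate₂⁺ c 2 d 3 (divides 12 refl) (divides 8 refl))) (0 , 0 , refl)

-- t = 5 and n / 2 ≤ 4 · 2²
no-weighing-2^j : ∀ j e → ¬ BoundedWeighing (2 ^ j) 2 (2 ^ (2 * e + 6))
no-weighing-2^j j e W = no-weighing (refl ∷ []) 4 (V≡ (2 ^ j)) W ⦃ ℕₚ.m^n≢0 2 (2 * e + 6) ⦄
  (λ x → divides-prime-power {t = t} {x} {bar x} {2} {2 * e + 6} fixes-2 refl)
  64 2 64 (pow≥ 2 (2 * e) 6) refl refl <-by-computation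
  where
  m = 2 * 2 ^ j
  instance
    2^j≢0 : NonZero (2 ^ j)
    2^j≢0 = ℕₚ.m^n≢0 2 j
    m≢0 : NonZero m
    m≢0 = ℕₚ.m*n≢0 2 (2 ^ j)
  open SinglePrime 2 1 1 m refl refl ℤ.-<+
  V≡ : ∀ q → 2 * q * 2 ≡ 4 * q
  V≡ = ℕ-Solver.solve-∀
  rs = replicate (2 + j) 2
  rs-product : product rs ≡ V
  rs-product = trans (product-replicate (2 + j) 2) (collect (2 ^ j))
    where
    collect : ∀ q → 2 * (2 * q) ≡ 2 * q * 2
    collect = ℕ-Solver.solve-∀
  open Bound ((2 , 1) ∷ []) (const 1ℤ ⋆ const 1ℤ) ((refl , prime-2) ∷ []) (factorisation (const 1ℤ) (project-2 (m * 1)) [])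
    (inj₁ (_ , λ k → psum-2 (kills-head k)))
    2 rs rs-product (Allₚ.replicate⁺ (2 + j) (good-2 {2} {4} (divides 1 refl) , 1 , here refl))
    4 2 (fixed-point-count 4 1 (2 ^ j) cancel-1 refl (V≡ (2 ^ j)))
  open ConstrainedRing V (map (scale m) ((2 , 1) ∷ [])) using (Fixes; ramified; divides-prime-power)
  fixes-2 : Fixes t 2
  fixes-2 = ramified {t} ((scaled-coset 2 m 1 refl , 2 , refl) ∷ []) prime-2 (suc j) 1 (V≡′ (2 ^ j))
    (here (cong (2 ,_) refl)) 1 0 (0 , 1 , refl) (4 , 0 , refl)
    where
    V≡′ : ∀ q → 2 * (2 * q) * 1 ≡ 2 * q * 2
    V≡′ = ℕ-Solver.solve-∀

-- t = 7 and n (2/3) ≤ 3 · 3²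
no-weighing-3^j : ∀ j e → ¬ BoundedWeighing (3 ^ j) 3 (7 ^ (2 * e + 2))
no-weighing-3^j j e W = no-weighing (refl ∷ []) 3 (ℕₚ.*-comm m 3) W ⦃ ℕₚ.m^n≢0 7 (2 * e + 2) ⦄
  (λ x → divides-prime-power {t = t} {x} {bar x} {7} {2 * e + 2} fixes-7 refl)
  49 6 243 (pow≥ 7 (2 * e) 2) refl refl <-by-computation
  where
  m = 3 ^ j
  instance
    m≢0 : NonZero m
    m≢0 = ℕₚ.m^n≢0 3 j
  open SinglePrime 3 1 2 m refl refl ℤ.-<+
  rs = replicate (suc j) 3
  rs-product : product rs ≡ V
  rs-product = trans (product-replicate (suc j) 3) (ℕₚ.*-comm 3 m)
  C₁ = (+ 2 , 0) ∷ (1ℤ , m * 1) ∷ []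
  cancel-2 : ∀ {x} → m ℕ∣.∣ 2 * x → m ℕ∣.∣ x
  cancel-2 {x} h = unit-cancel {R = 3} j ℕ∣.∣-refl 1 (subst (m ℕ∣.∣_) (sym (ℕₚ.*-assoc 2 2 x)) (ℕ∣.∣n⇒∣m*n 2 h))
  open Bound ((3 , 1) ∷ []) (const 1ℤ ⋆ C₁) ((refl , prime-3) ∷ []) (factorisation C₁ (project-3 (m * 1)) [])
    (inj₂ ((1 , refl) ∷ []))
    2 rs rs-product (Allₚ.replicate⁺ (suc j) (good-odd {3} {6} 1 (divides 2 refl) (divides 2 refl) , 1 , here refl))
    3 3 (fixed-point-count 3 2 m cancel-2 refl (ℕₚ.*-comm m 3))
  open ConstrainedRing V (map (scale m) ((3 , 1) ∷ [])) using (Fixes; unramified; divides-prime-power)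
  fixes-7 : Fixes t 7
  fixes-7 = unramified {t} ((scaled-coset 3 m 1 refl , 2 , refl) ∷ []) prime-7 (1 * V) ⦃ ℕₚ.m*n≢0 1 V ⦄ 1
    (power-order 7 1 6 refl rs rs-product (Allₚ.replicate⁺ (suc j) (divides 2 refl))) (0 , 0 , refl)

project-5 : ∀ w f y → ⟦ project 5 w ⟧ f y
  ≡ ⟦ (+ 4 , 0) ∷ (+ 3 , 1 * w) ∷ (+ 2 , 2 * w) ∷ (1ℤ , 3 * w) ∷ [] ⟧ (⟦ difference w ⟧ f) y
project-5 w f y = trans (rearrange (g 0) (g 1) (g 2) (g 3) (g 4))
  (trans (cong₂ (λ a b → Φ a b (g 3) (g 4)) (next 0) (next 1)) (cong₂ (Φ (f (w + (0 * w + y))) (f (w + (1 * w + y)))) (next 2) (next 3)))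
  where
  g : ℕ → ℤ
  g i = f (i * w + y)
  next : ∀ i → g (suc i) ≡ f (w + (i * w + y))
  next i = cong f (ℕₚ.+-assoc w (i * w) y)
  Δ : ℤ → ℤ → ℤ
  Δ a b = 1ℤ ℤ.* a ℤ.+ (-1ℤ ℤ.* b ℤ.+ 0ℤ)
  Φ : ℤ → ℤ → ℤ → ℤ → ℤ
  Φ a b c d = + 4 ℤ.* Δ (g 0) a ℤ.+ (+ 3 ℤ.* Δ (g 1) b ℤ.+ (+ 2 ℤ.* Δ (g 2) c ℤ.+ (1ℤ ℤ.* Δ (g 3) d ℤ.+ 0ℤ)))
  rearrange : ∀ a b c d e → + 5 ℤ.* a ℤ.+ (-1ℤ ℤ.* e ℤ.+ (-1ℤ ℤ.* d ℤ.+ (-1ℤ ℤ.* c ℤ.+ (-1ℤ ℤ.* b ℤ.+ (-1ℤ ℤ.* a ℤ.+ 0ℤ)))))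
    ≡ + 4 ℤ.* (1ℤ ℤ.* a ℤ.+ (-1ℤ ℤ.* b ℤ.+ 0ℤ)) ℤ.+ (+ 3 ℤ.* (1ℤ ℤ.* b ℤ.+ (-1ℤ ℤ.* c ℤ.+ 0ℤ))
      ℤ.+ (+ 2 ℤ.* (1ℤ ℤ.* c ℤ.+ (-1ℤ ℤ.* d ℤ.+ 0ℤ)) ℤ.+ (1ℤ ℤ.* (1ℤ ℤ.* d ℤ.+ (-1ℤ ℤ.* e ℤ.+ 0ℤ)) ℤ.+ 0ℤ)))
  rearrange = ℤ-Solver.solve-∀

module TwoAndFive (m : ℕ) ⦃ m≢0 : NonZero m ⦄ where
  open Scaled 9 m public

  private
    w₂ = m * 5
    w₅ = m * 2
    ps : List (ℕ × ℕ)
    ps = (2 , 5) ∷ (5 , 2) ∷ []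
    U : Op
    U = difference 5 ⋆ difference 2

    ⟦U⟧ : ∀ f y → ⟦ dilate m U ⟧ f y ≡ ⟦ difference w₂ ⟧ (⟦ difference w₅ ⟧ f) y
    ⟦U⟧ f y = trans (cong (λ o → ⟦ o ⟧ f y) (trans (dilate-⋆ m (difference 5) (difference 2))
      (cong₂ _⋆_ (dilate-difference m 5) (dilate-difference m 2)))) (⟦⟧-⋆ (difference w₂) (difference w₅) f y)

    killed : ∀ {f} → Periodic V f → Kills (constraints V (map (scale m) ps)) (⟦ dilate m U ⟧ f)
    killed {f} per = kills {V} {map (scale m) ps} (periodic-act (dilate m U) per)
      ( (λ y → trans (⟦⟧-cong (psum 2 w₂) (⟦U⟧ f) y)
          (difference-kills-psum {V} {2} {w₂} (scaled-coset 2 m 5 refl) (periodic-act (difference w₅) per) y))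
      ∷ (λ y → trans (⟦⟧-cong (psum 5 w₅) (λ i → trans (⟦U⟧ f i) (⟦⟧-comm (difference w₂) (difference w₅) f i)) y)
          (difference-kills-psum {V} {5} {w₅} (scaled-coset 5 m 2 refl) (periodic-act (difference w₂) per) y))
      ∷ [])

    negated : ∀ {h} → Kills (constraints V (map (scale m) ps)) h → ∀ y → h (w₂ + y) ≡ -1ℤ ℤ.* h y
    negated k = psum-2 (All.head (kills⇒psum {V} {map (scale m) ps} k))

    pair : ∀ {h} → Kills (constraints V (map (scale m) ps)) h → ∀ y →
      ⟦ dilate 9 U ⟧ (λ i → h (m * i + y)) 0 ≡ + 2 ℤ.* (h y ℤ.- h (m * 18 + y))
    pair {h} k y = begin
      1ℤ ℤ.* h (m * 0 + y) ℤ.+ (-1ℤ ℤ.* h (m * 18 + y) ℤ.+ (-1ℤ ℤ.* h (m * 45 + y) ℤ.+ (1ℤ ℤ.* h (m * 63 + y) ℤ.+ 0ℤ)))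
        ≡⟨ cong (λ i → 1ℤ ℤ.* h (i + y) ℤ.+ (-1ℤ ℤ.* h (m * 18 + y) ℤ.+ (-1ℤ ℤ.* h (m * 45 + y) ℤ.+ (1ℤ ℤ.* h (m * 63 + y) ℤ.+ 0ℤ)))) (ℕₚ.*-zeroʳ m) ⟩
      1ℤ ℤ.* h y ℤ.+ (-1ℤ ℤ.* h (m * 18 + y) ℤ.+ (-1ℤ ℤ.* h (m * 45 + y) ℤ.+ (1ℤ ℤ.* h (m * 63 + y) ℤ.+ 0ℤ)))
        ≡⟨ cong₂ (λ a b → 1ℤ ℤ.* h y ℤ.+ (-1ℤ ℤ.* h (m * 18 + y) ℤ.+ (-1ℤ ℤ.* a ℤ.+ (1ℤ ℤ.* b ℤ.+ 0ℤ)))) at-45 at-63 ⟩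
      1ℤ ℤ.* h y ℤ.+ (-1ℤ ℤ.* h (m * 18 + y) ℤ.+ (-1ℤ ℤ.* (-1ℤ ℤ.* h y) ℤ.+ (1ℤ ℤ.* (-1ℤ ℤ.* h (m * 18 + y)) ℤ.+ 0ℤ)))
        ≡⟨ collect (h y) (h (m * 18 + y)) ⟩
      + 2 ℤ.* (h y ℤ.- h (m * 18 + y)) ∎
      where
      open ≡.≡-Reasoning
      per-h = kills⇒periodic {V} {map (scale m) ps} k
      collect : ∀ a b → 1ℤ ℤ.* a ℤ.+ (-1ℤ ℤ.* b ℤ.+ (-1ℤ ℤ.* (-1ℤ ℤ.* a) ℤ.+ (1ℤ ℤ.* (-1ℤ ℤ.* b) ℤ.+ 0ℤ))) ≡ + 2 ℤ.* (a ℤ.- b)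
      collect = ℤ-Solver.solve-∀
      at-45 : h (m * 45 + y) ≡ -1ℤ ℤ.* h y
      at-45 = trans (periodic-cong per-h 0 4 (expand m y)) (negated k y)
        where
        expand : ∀ m y → 0 * (m * 10) + (m * 45 + y) ≡ 4 * (m * 10) + (m * 5 + y)
        expand = ℕ-Solver.solve-∀
      at-63 : h (m * 63 + y) ≡ -1ℤ ℤ.* h (m * 18 + y)
      at-63 = trans (periodic-cong per-h 0 4 (expand m y)) (negated k (m * 18 + y))
        where
        expand : ∀ m y → 0 * (m * 10) + (m * 63 + y) ≡ 4 * (m * 10) + (m * 5 + (m * 18 + y))
        expand = ℕ-Solver.solve-∀

  open MinimalVector ps U 18 2 killed pair refl ℤ.-<+ public

  C₅ : Op
  C₅ = (+ 4 , 0) ∷ (+ 3 , 1 * w₅) ∷ (+ 2 , 2 * w₅) ∷ (1ℤ , 3 * w₅) ∷ []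

  factorisation : ∀ {f} → Periodic V f → ∀ y → ⟦ projects (map (scale m) ps) ⟧ f y ≡ ⟦ C₅ ⟧ (⟦ dilate m U ⟧ f) y
  factorisation {f} _ y = begin
    ⟦ project 2 w₂ ⋆ (project 5 w₅ ⋆ const 1ℤ) ⟧ f y ≡⟨ ⟦⟧-⋆ (project 2 w₂) (project 5 w₅ ⋆ const 1ℤ) f y ⟩
    ⟦ project 2 w₂ ⟧ (⟦ project 5 w₅ ⋆ const 1ℤ ⟧ f) y ≡⟨ ⟦⟧-cong (project 2 w₂) (λ i → trans (⟦⟧-⋆ (project 5 w₅) (const 1ℤ) f i)
       (trans (⟦⟧-cong (project 5 w₅) (⟦⟧-Sh 0 f) i) (project-5 w₅ f i))) y ⟩
    ⟦ project 2 w₂ ⟧ (⟦ C₅ ⟧ (⟦ difference w₅ ⟧ f)) y ≡⟨ ⟦⟧-comm (project 2 w₂) C₅ (⟦ difference w₅ ⟧ f) y ⟩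
    ⟦ C₅ ⟧ (⟦ project 2 w₂ ⟧ (⟦ difference w₅ ⟧ f)) y ≡⟨ ⟦⟧-cong C₅ (λ i → trans (project-2 w₂ (⟦ difference w₅ ⟧ f) i)
       (trans (⟦⟧-Sh 0 (⟦ difference w₂ ⟧ (⟦ difference w₅ ⟧ f)) i) (sym (⟦U⟧ f i)))) y ⟩
    ⟦ C₅ ⟧ (⟦ dilate m U ⟧ f) y ∎
    where open ≡.≡-Reasoning

  kills-head : ∀ {f} → Kills Z f → ∀ y → f (w₂ + y) ≡ -1ℤ ℤ.* f y
  kills-head = negated

-- t = 21 is a power of 16 modulo 5^d and of 5 modulo 2^c; n (1/2) (4/5) ≤ 20
no-CW-2^c5^d : ∀ c d e f → ¬ CW (2 ^ c * 5 ^ d) (2 ^ (2 * e + 2) * 5 ^ (2 * f + 2))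
no-CW-2^c5^d c d e f cw = no-weighing (refl ∷ refl ∷ []) 20 (V≡ v) (cyclic cw) ⦃ 2^K5^L≢0 (2 * e + 2) (2 * f + 2) ⦄
  (λ x → divides-two-prime-powers {t = t} {x} {bar x} {2} {5} {2 * e + 2} {2 * f + 2} fixes-2 fixes-5
    (coprime-2-5 (2 * e + 2) (2 * f + 2)))
  100 40 2000 (100≤ e f) refl refl <-by-computation
  where
  v = 2 ^ c * 5 ^ d
  m = 2 * v
  instance
    v≢0 : NonZero v
    v≢0 = p^cq^d≢0 2 c 5 d
    m≢0 : NonZero m
    m≢0 = ℕₚ.m*n≢0 2 v
  open TwoAndFive m
  V≡ : ∀ q → 2 * q * 10 ≡ 20 * q
  V≡ = ℕ-Solver.solve-∀
  rs = 2 ∷ 2 ∷ 5 ∷ replicate c 2 ++ replicate d 5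
  rs-product : product rs ≡ V
  rs-product = trans (cong (λ u → 2 * (2 * (5 * u))) (product-replicate₂ c 2 d 5)) (collect v)
    where
    collect : ∀ q → 2 * (2 * (5 * q)) ≡ 2 * q * 10
    collect = ℕ-Solver.solve-∀
  qs = (2 , 5) ∷ (5 , 2) ∷ []
  at-2 : Good 10 20 2 × ∃ λ r → (2 , r) ∈ qs
  at-2 = good-2 {10} {20} (divides 1 refl) , 5 , here refl
  at-5 : Good 10 20 5 × ∃ λ r → (5 , r) ∈ qs
  at-5 = good-odd {10} {20} 2 (divides 2 refl) (divides 4 refl) , 2 , there (here refl)
  open Bound qs C₅ ((refl , prime-2) ∷ (refl , prime-5) ∷ []) factorisation
    (inj₁ (_ , λ k → kills-head k))
    2 rs rs-product (at-2 ∷ at-2 ∷ at-5 ∷ replicate₂⁺ c 2 d 5 at-2 at-5)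
    20 1 (fixed-point-count 20 1 v cancel-1 refl (V≡ v))
  open ConstrainedRing V (map (scale m) qs) using (Fixes; ramified; divides-two-prime-powers)
  fixed : All (DilationFixes V t) (map (scale m) qs)
  fixed = (scaled-coset 2 m 5 refl , 10 , refl) ∷ (scaled-coset 5 m 2 refl , 4 , refl) ∷ []
  w = 5 ^ suc d
  log : ∃ λ r → (2 ^ r) ≡ t mod w
  log = power-log 2 4 {16} {21} {w} refl
    (discrete-log {5} {5} {16} {21} 4 3 4 2 1 refl refl refl ℕ∣.∣-refl (good-odd {5} {5} 2 ℕ∣.∣-refl ℕ∣.∣-refl) refl d)
  fixes-2 : Fixes t 2
  fixes-2 = ramified {t} fixed prime-2 (suc c) w (V≡′ (2 ^ c) (5 ^ d))
    (here (cong (2 ,_) (coset (2 ^ c) (5 ^ d)))) (4 * w) ⦃ ℕₚ.m*n≢0 4 w ⦃ _ ⦄ ⦃ ℕₚ.m^n≢0 5 (suc d) ⦄ ⦄ (proj₁ log)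
    (power-order 2 4 15 refl (replicate (suc d) 5) (product-replicate (suc d) 5) (Allₚ.replicate⁺ (suc d) (divides 3 refl))) (proj₂ log)
    where
    V≡′ : ∀ a b → 2 * (2 * a) * (5 * b) ≡ 2 * (a * b) * 10
    V≡′ = ℕ-Solver.solve-∀
    coset : ∀ a b → 2 * a * (5 * b) ≡ 2 * (a * b) * 5
    coset = ℕ-Solver.solve-∀
  w′ = 4 * 2 ^ c
  log′ : ∃ λ r → (5 ^ r) ≡ t mod w′
  log′ = discrete-log {2} {4} {5} {21} 1 1 5 1 0 refl refl refl (divides 2 refl) (good-2 {2} {4} (divides 1 refl)) refl c
  fixes-5 : Fixes t 5
  fixes-5 = ramified {t} fixed prime-5 d w′ (V≡′ (2 ^ c) (5 ^ d))
    (there (here (cong (5 ,_) (coset (2 ^ c) (5 ^ d))))) (1 * w′) ⦃ ℕₚ.m*n≢0 1 w′ ⦃ _ ⦄ ⦃ ℕₚ.m*n≢0 4 _ ⦃ _ ⦄ ⦃ ℕₚ.m^n≢0 2 c ⦄ ⦄ ⦄ (proj₁ log′)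
    (power-order 5 1 4 refl (replicate (2 + c) 2) (trans (product-replicate (2 + c) 2) (sym (ℕₚ.*-assoc 2 2 (2 ^ c)))) (Allₚ.replicate⁺ (2 + c) (divides 2 refl))) (proj₂ log′)
    where
    V≡′ : ∀ a b → 5 * b * (4 * a) ≡ 2 * (a * b) * 10
    V≡′ = ℕ-Solver.solve-∀
    coset : ∀ a b → b * (4 * a) ≡ 2 * (a * b) * 2
    coset = ℕ-Solver.solve-∀

-- Abelian groups of large exponent

injective⇒surjective : ∀ {n} {f : Fin n → Fin n} → Injective _≡_ _≡_ f → ∀ y → ∃ λ i → f i ≡ y
injective⇒surjective {suc n} {f} inj y with Finₚ.any? (λ i → f i Fin.≟ y)
... | yes h = h
... | no ¬h = contradiction (Finₚ.injective⇒≤ {f = λ i → Fin.punchOut (y≢ i)}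
    (λ {i} {j} e → inj (Finₚ.punchOut-injective (y≢ i) (y≢ j) e))) (ℕₚ.<⇒≱ (ℕₚ.n<1+n n))
  where
  y≢ : ∀ i → y ≢ f i
  y≢ i e = ¬h (i , sym e)

module Powers {v} (G : FinAbGroup v) where
  open FinAbGroup G public

  abelianGroup : AbelianGroup _ _
  abelianGroup = record { isAbelianGroup = isAbelianGroup }

  open AbelianGroup abelianGroup public using (assoc; comm; identityˡ; identityʳ; inverseˡ; inverseʳ; group; commutativeMonoid)
  open GroupProperties group public using (∙-cancelˡ; ∙-cancelʳ)
  open CommutativeMonoidSolver commutativeMonoid using (solve; _⊕_; _⊜_)

  pow-+ : ∀ g a b → pow g (a + b) ≡ pow g a ∙ pow g b
  pow-+ g zero    b = sym (identityˡ _)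
  pow-+ g (suc a) b = trans (cong (g ∙_) (pow-+ g a b)) (sym (assoc g _ _))

  pow-ε : ∀ n → pow ε n ≡ ε
  pow-ε zero    = refl
  pow-ε (suc n) = trans (identityˡ _) (pow-ε n)

  pow-* : ∀ g a b → pow g (a * b) ≡ pow (pow g b) a
  pow-* g zero    b = refl
  pow-* g (suc a) b = trans (pow-+ g b (a * b)) (cong (pow g b ∙_) (pow-* g a b))

  pow-∙ : ∀ g h n → pow (g ∙ h) n ≡ pow g n ∙ pow h n
  pow-∙ g h zero    = sym (identityˡ ε)
  pow-∙ g h (suc n) = trans (cong ((g ∙ h) ∙_) (pow-∙ g h n))
    (solve 4 (λ a b c d → (a ⊕ b) ⊕ (c ⊕ d) ⊜ (a ⊕ c) ⊕ (b ⊕ d)) refl g h (pow g n) (pow h n))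

  pow≡ε-* : ∀ {g n} a → pow g n ≡ ε → pow g (a * n) ≡ ε
  pow≡ε-* {g} {n} a e = trans (pow-* g a n) (trans (cong (λ h → pow h a) e) (pow-ε a))

  pow-order : ∀ g → pow g v ≡ ε
  pow-order g = sym (∙-cancelʳ total ε (pow g v) (begin
    ε ∙ total ≡⟨ identityˡ total ⟩
    total ≡⟨ sum-permute (λ h → h) (permutation (g ∙_) ((g ⁻¹) ∙_) (λ h → cancel g (g ⁻¹) h (inverseʳ g)) (λ h → cancel (g ⁻¹) g h (inverseˡ g))) ⟩
    sum {v} (λ h → g ∙ h) ≡⟨ ∑-distrib-+ {v} (λ _ → g) (λ h → h) ⟩
    sum {v} (λ _ → g) ∙ total ≡⟨ cong (_∙ total) (constant v) ⟩
    pow g v ∙ total ∎))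
    where
    open ≡.≡-Reasoning
    open Sum commutativeMonoid using (sum; sum-permute; ∑-distrib-+)
    total = sum {v} (λ h → h)
    cancel : ∀ a b h → a ∙ b ≡ ε → a ∙ (b ∙ h) ≡ h
    cancel a b h e = trans (sym (assoc a b h)) (trans (cong (_∙ h) e) (identityˡ h))
    constant : ∀ n → sum {n} (λ _ → g) ≡ pow g n
    constant zero    = refl
    constant (suc n) = cong (g ∙_) (constant n)

  module _ (H : Fin v → Set) (H-ε : H ε) (H-∙ : ∀ {x y} → H x → H y → H (x ∙ y)) (H-÷ : ∀ {x y} → H (x ∙ y) → H y → H x) where

    H-pow : ∀ {x} n → H x → H (pow x n)
    H-pow zero    h = H-ε
    H-pow (suc n) h = H-∙ h (H-pow n h)

    coprime-powers : ∀ {g a b} → Coprime a b → H (pow g a) → H (pow g b) → H g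
    coprime-powers {g} {a} {b} cop ha hb with coprime-Bézout cop
    ... | Bézout.+- x y e = H-÷ (subst H (trans (sym (pow-* g x a)) (cong (pow g) (sym e))) (H-pow x ha))
                                (subst H (sym (pow-* g y b)) (H-pow y hb))
    ... | Bézout.-+ x y e = H-÷ (subst H (trans (sym (pow-* g y b)) (cong (pow g) (sym e))) (H-pow y hb))
                                (subst H (sym (pow-* g x a)) (H-pow x ha))

  module _ {p} (pr : Prime p) where

    order-divides : ∀ k {g d} → pow g (p ^ k) ≢ ε → pow g (p ^ suc k) ≡ ε → pow g d ≡ ε → p ^ suc k ℕ∣.∣ d
    order-divides k {g} {d} ≢ε ≡ε gd≡ε with p ℕ∣.∣? d
    ... | no ¬p∣d = contradiction (trans (cong (λ h → pow h (p ^ k)) g≡ε) (pow-ε (p ^ k))) ≢ε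
      where
      g≡ε : g ≡ ε
      g≡ε = coprime-powers (_≡ ε) refl (λ e f → trans (cong₂ _∙_ e f) (identityˡ ε))
        (λ {x} {y} e f → trans (sym (identityʳ x)) (trans (cong (x ∙_) (sym f)) e))
        (coprime-^ (suc k) (ndivides⇒coprime pr ¬p∣d)) gd≡ε ≡ε
    order-divides zero    {g} {d} ≢ε ≡ε gd≡ε | yes p∣d = subst (ℕ∣._∣ d) (sym (ℕₚ.*-identityʳ p)) p∣d
    order-divides (suc k) {g} {d} ≢ε ≡ε gd≡ε | yes (divides d′ d≡) =
      subst (p ^ suc (suc k) ℕ∣.∣_) (trans (ℕₚ.*-comm p d′) (sym d≡)) (ℕ∣.*-monoʳ-∣ p
        (order-divides k {pow g p} {d′} (λ e → ≢ε (trans (swap k) e)) (trans (sym (swap (suc k))) ≡ε)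
          (trans (sym (pow-* g d′ p)) (trans (cong (pow g) (sym d≡)) gd≡ε))))
      where
      swap : ∀ k → pow g (p ^ suc k) ≡ pow (pow g p) (p ^ k)
      swap k = trans (cong (pow g) (ℕₚ.*-comm p (p ^ k))) (pow-* g (p ^ k) p)

    pow-mod : ∀ k {g} → pow g (p ^ k) ≢ ε → pow g (p ^ suc k) ≡ ε → ∀ a b → pow g a ≡ pow g b → a ≡ b mod (p ^ suc k)
    pow-mod k {g} ≢ε ≡ε a b e with ℕₚ.≤-total a b
    ... | inj₁ a≤b with ℕₚ.m≤n⇒∃[o]m+o≡n a≤b
    ...   | d , refl with order-divides k {g} {d} ≢ε ≡ε (sym (∙-cancelˡ (pow g a) ε (pow g d) (trans (identityʳ _) (trans e (pow-+ g a d)))))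
    ...     | divides q d≡ = q , 0 , trans (cong (a ℕ.+_) (sym d≡)) (sym (ℕₚ.+-identityʳ _))
    pow-mod k {g} ≢ε ≡ε a b e | inj₂ b≤a with ℕₚ.m≤n⇒∃[o]m+o≡n b≤a
    ...   | d , refl with order-divides k {g} {d} ≢ε ≡ε (sym (∙-cancelˡ (pow g b) ε (pow g d) (trans (identityʳ _) (trans (sym e) (pow-+ g b d)))))
    ...     | divides q d≡ = 0 , q , trans (ℕₚ.+-identityʳ _) (cong (b ℕ.+_) d≡)

  ldiv : Fin v → Fin v → Fin v
  ldiv h g = (h ⁻¹) ∙ g

  ldiv-∙ : ∀ h g → ldiv h g ∙ h ≡ g
  ldiv-∙ h g = trans (comm _ h) (trans (sym (assoc h (h ⁻¹) g)) (trans (cong (_∙ g) (inverseʳ h)) (identityˡ g)))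

  ldiv-involutive : ∀ h g → ldiv (ldiv h g) g ≡ h
  ldiv-involutive h g = ∙-cancelʳ (ldiv h g) _ _ (trans (ldiv-∙ (ldiv h g) g) (trans (sym (ldiv-∙ h g)) (comm _ h)))

-- A group of order p^(k+2) in which some element g has g^(p^k) ≠ 1 is cyclic or the direct product
-- of ⟨g⟩ with a group of order p; either way it maps to a cyclic group with fibres of size ≤ p.
module LargeExponent {p} (pr : Prime p) (k : ℕ) (G : FinAbGroup (p ^ suc (suc k))) {n : ℕ} (weight : IW G n) where
  open Powers G

  private
    N = p ^ suc k
    instance
      p≢0 : NonZero p
      p≢0 = prime⇒nonZero pr
      N≢0 : NonZero N
      N≢0 = ℕₚ.m^n≢0 p (suc k)
      v≢0 : NonZero (p ^ suc (suc k))
      v≢0 = ℕₚ.m^n≢0 p (suc (suc k))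

    p-zero : ∀ {p} → NonZero p → Fin p
    p-zero {suc p} _ = Fin.zero

  cyclic-case : ∀ h → pow h N ≢ ε → BoundedWeighing (p ^ suc (suc k)) p n
  cyclic-case h ≢ε = record
    { ldiv = ldiv ; e = ε ; a = proj₁ weight ; weighing = proj₂ weight ; involutive = ldiv-involutive
    ; χ = log ; χ-ldiv = λ x y → same-exponent (toℕ (log (ldiv x y)) + toℕ (log x)) (toℕ (log y))
        (trans (pow-+ h (toℕ (log (ldiv x y))) (toℕ (log x))) (trans (cong₂ _∙_ (pow-log (ldiv x y)) (pow-log x)) (trans (ldiv-∙ x y) (sym (pow-log y)))))
    ; χ-e = mod-unique (Finₚ.toℕ<n (log ε)) (ℕ.>-nonZero⁻¹ _) (same-exponent (toℕ (log ε)) 0 (pow-log ε))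
    ; ψ = λ _ → p-zero p≢0
    ; χψ-injective = λ {x} {y} e _ → trans (sym (pow-log x)) (trans (cong (λ i → pow h (toℕ i)) e) (pow-log y)) }
    where
    same-exponent = pow-mod pr (suc k) ≢ε (pow-order h)
    surjective = injective⇒surjective {f = λ i → pow h (toℕ i)}
      (λ {i} {j} e → Finₚ.toℕ-injective (mod-unique (Finₚ.toℕ<n i) (Finₚ.toℕ<n j) (same-exponent (toℕ i) (toℕ j) e)))
    log : Fin (p ^ suc (suc k)) → Fin (p ^ suc (suc k))
    log y = proj₁ (surjective y)
    pow-log : ∀ y → pow h (toℕ (log y)) ≡ y
    pow-log y = proj₂ (surjective y)

  module Split (g : Fin (p ^ suc (suc k))) (g≢ε : pow g (p ^ k) ≢ ε) (exponent : ∀ y → pow y N ≡ ε) where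

    ⟨g⟩ : Fin (p ^ suc (suc k)) → Set
    ⟨g⟩ y = ∃ λ i → pow g i ≡ y

    same-exponent : ∀ a b → pow g a ≡ pow g b → a ≡ b mod N
    same-exponent = pow-mod pr k g≢ε (exponent g)

    ε∈ : ⟨g⟩ ε
    ε∈ = 0 , refl

    ∙∈ : ∀ {x y} → ⟨g⟩ x → ⟨g⟩ y → ⟨g⟩ (x ∙ y)
    ∙∈ (i , e) (j , f) = i + j , trans (pow-+ g i j) (cong₂ _∙_ e f)

    inverse∈ : ∀ {y} → ⟨g⟩ y → ∃ λ z → ⟨g⟩ z × y ∙ z ≡ ε
    inverse∈ {y} (i , refl) = pow (pow g i) (ℕ.pred N) , (ℕ.pred N * i , pow-* g (ℕ.pred N) i) ,
      trans (cong (pow (pow g i)) (ℕₚ.suc-pred N)) (exponent (pow g i))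

    ÷∈ : ∀ {x y} → ⟨g⟩ (x ∙ y) → ⟨g⟩ y → ⟨g⟩ x
    ÷∈ {x} {y} xy∈ y∈ with inverse∈ y∈
    ... | z , z∈ , yz≡ε = subst ⟨g⟩ (trans (assoc x y z) (trans (cong (x ∙_) yz≡ε) (identityʳ x))) (∙∈ xy∈ z∈)

    module Complement (s : Fin (p ^ suc (suc k))) (s∉ : ¬ ⟨g⟩ s) where

      p∣exponent : ∀ d → ⟨g⟩ (pow s d) → p ℕ∣.∣ d
      p∣exponent d h with p ℕ∣.∣? d
      ... | yes p∣d = p∣d
      ... | no ¬p∣d = contradiction (coprime-powers ⟨g⟩ ε∈ ∙∈ ÷∈ (coprime-^ (suc k) (ndivides⇒coprime pr ¬p∣d)) h
                        (subst ⟨g⟩ (sym (exponent s)) ε∈)) s∉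

      private
        unequal : ∀ {a b} → a < b → b < p → ∀ {x y} → ⟨g⟩ x → ⟨g⟩ y → pow s a ∙ x ≢ pow s b ∙ y
        unequal {a} {b} a<b b<p {x} {y} x∈ y∈ e with ℕₚ.m≤n⇒∃[o]m+o≡n (ℕₚ.<⇒≤ a<b)
        ... | zero , refl = contradiction (sym (ℕₚ.+-identityʳ a)) (ℕₚ.<⇒≢ a<b)
        ... | d@(suc _) , refl = contradiction (ℕ∣.∣⇒≤ (p∣exponent d (÷∈ (subst ⟨g⟩ x≡ x∈) y∈)))
            (ℕₚ.<⇒≱ (ℕₚ.≤-<-trans (ℕₚ.m≤n+m d a) b<p))
          where
          x≡ : x ≡ pow s d ∙ y
          x≡ = ∙-cancelˡ (pow s a) _ _ (trans e (trans (cong (_∙ y) (pow-+ s a d)) (assoc _ _ y)))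

      equal : ∀ {a b x y} → a < p → b < p → ⟨g⟩ x → ⟨g⟩ y → pow s a ∙ x ≡ pow s b ∙ y → a ≡ b
      equal {a} {b} a<p b<p x∈ y∈ e with ℕₚ.<-cmp a b
      ... | tri< a<b _ _ = contradiction e (unequal a<b b<p x∈ y∈)
      ... | tri≈ _ a≡b _ = a≡b
      ... | tri> _ _ b<a = contradiction (sym e) (unequal b<a a<p y∈ x∈)

      element : Fin p × Fin N → Fin (p ^ suc (suc k))
      element (a , i) = pow s (toℕ a) ∙ pow g (toℕ i)

      element-injective : ∀ {x y} → element x ≡ element y → x ≡ y
      element-injective {a , i} {b , j} e with Finₚ.toℕ-injective (equal (Finₚ.toℕ<n a) (Finₚ.toℕ<n b) (toℕ i , refl) (toℕ j , refl) e)
      ... | refl = cong (a ,_) (Finₚ.toℕ-injective (mod-unique (Finₚ.toℕ<n i) (Finₚ.toℕ<n j)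
                     (same-exponent (toℕ i) (toℕ j) (∙-cancelˡ (pow s (toℕ a)) _ _ e))))

      coordinates : ∀ y → ∃ λ x → element x ≡ y
      coordinates y = remQuot {p} N (proj₁ hit) , proj₂ hit
        where
        hit : ∃ λ i → element (remQuot {p} N i) ≡ y
        hit = injective⇒surjective {f = λ i → element (remQuot {p} N i)}
          (λ {i} {j} e → trans (sym (Finₚ.combine-remQuot {p} N i)) (trans (cong (λ (a , b) → combine a b) (element-injective e)) (Finₚ.combine-remQuot {p} N j))) y

      s^p∈ : ⟨g⟩ (pow s p)
      s^p∈ with coordinates (pow s p)
      ... | (a , i) , e = subst ⟨g⟩ (trans (cong (λ b → pow s b ∙ pow g (toℕ i)) (sym a≡0)) e) (toℕ i , sym (identityˡ _))
        where
        a≡0 : toℕ a ≡ 0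
        a≡0 with ℕₚ.m≤n⇒∃[o]m+o≡n (ℕₚ.<⇒≤ (Finₚ.toℕ<n a))
        ... | d , a+d≡p with p∣exponent d (subst ⟨g⟩ (∙-cancelˡ (pow s (toℕ a)) _ _ (trans e (trans (cong (pow s) (sym a+d≡p)) (pow-+ s (toℕ a) d)))) (toℕ i , refl))
        ...   | divides zero    refl = contradiction (trans (sym (ℕₚ.+-identityʳ _)) a+d≡p) (ℕₚ.<⇒≢ (Finₚ.toℕ<n a))
        ...   | divides (suc q) refl = ℕₚ.n≤0⇒n≡0 (ℕₚ.+-cancelʳ-≤ p (toℕ a) 0 (ℕₚ.≤-trans (ℕₚ.+-monoʳ-≤ (toℕ a) (ℕₚ.m≤m+n p (q * p))) (ℕₚ.≤-reflexive a+d≡p)))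

      product-case : pow s p ≡ ε → BoundedWeighing N p n
      product-case s^p≡ε = record
        { ldiv = ldiv ; e = ε ; a = proj₁ weight ; weighing = proj₂ weight ; involutive = ldiv-involutive
        ; χ = χ ; χ-ldiv = λ h y → additive (proj₁ (coordinates (ldiv h y))) (proj₁ (coordinates h)) (proj₁ (coordinates y)) (trans (cong₂ _∙_ (proj₂ (coordinates (ldiv h y))) (proj₂ (coordinates h))) (trans (ldiv-∙ h y) (sym (proj₂ (coordinates y)))))
        ; χ-e = trans (cong (λ x → toℕ (proj₂ x)) at-ε) (Finₚ.toℕ-fromℕ< (ℕ.>-nonZero⁻¹ N))
        ; ψ = λ y → proj₁ (proj₁ (coordinates y))
        ; χψ-injective = λ {x} {y} e f → trans (sym (proj₂ (coordinates x))) (trans (cong₂ (λ a b → element (a , b)) f e) (proj₂ (coordinates y))) }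
        where
        χ : Fin (p ^ suc (suc k)) → Fin N
        χ y = proj₂ (proj₁ (coordinates y))
        zero-p : Fin p
        zero-p = fromℕ< (ℕ.>-nonZero⁻¹ p)
        zero-N : Fin N
        zero-N = fromℕ< (ℕ.>-nonZero⁻¹ N)
        at-ε : proj₁ (coordinates ε) ≡ (zero-p , zero-N)
        at-ε = element-injective (trans (proj₂ (coordinates ε)) (sym (trans (cong₂ (λ a b → pow s a ∙ pow g b) (Finₚ.toℕ-fromℕ< (ℕ.>-nonZero⁻¹ p)) (Finₚ.toℕ-fromℕ< (ℕ.>-nonZero⁻¹ N))) (identityˡ ε))))
        additive : ∀ x y z → element x ∙ element y ≡ element z → toℕ (proj₂ x) + toℕ (proj₂ y) ≡ toℕ (proj₂ z) mod N
        additive (a , i) (b , j) (c , l) e = same-exponent (toℕ i + toℕ j) (toℕ l)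
          (∙-cancelˡ (pow s (toℕ c)) _ _ (trans (cong (_∙ pow g (toℕ i + toℕ j)) (sym s^a+b)) main))
          where
          main : pow s (toℕ a + toℕ b) ∙ pow g (toℕ i + toℕ j) ≡ pow s (toℕ c) ∙ pow g (toℕ l)
          main = trans (cong₂ _∙_ (pow-+ s (toℕ a) (toℕ b)) (pow-+ g (toℕ i) (toℕ j)))
            (trans (interchange (pow s (toℕ a)) (pow s (toℕ b)) (pow g (toℕ i)) (pow g (toℕ j)))
              e)
            where
            open CommutativeMonoidSolver commutativeMonoid using (solve; _⊕_; _⊜_)
            interchange : ∀ a b c d → (a ∙ b) ∙ (c ∙ d) ≡ (a ∙ c) ∙ (b ∙ d)
            interchange = solve 4 (λ a b c d → (a ⊕ b) ⊕ (c ⊕ d) ⊜ (a ⊕ c) ⊕ (b ⊕ d)) refl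
          c′ = ℕ.pred p * toℕ c
          E = toℕ a + toℕ b + c′
          c+c′ : toℕ c + c′ ≡ toℕ c * p
          c+c′ = trans (cong (ℕ._* toℕ c) (ℕₚ.suc-pred p)) (ℕₚ.*-comm p (toℕ c))
          s^cp≡ε : pow s (toℕ c + c′) ≡ ε
          s^cp≡ε = trans (cong (pow s) c+c′) (pow≡ε-* {s} {p} (toℕ c) s^p≡ε)
          p∣E : p ℕ∣.∣ E
          p∣E = p∣exponent E (÷∈ (subst ⟨g⟩ (sym (begin
              pow s E ∙ pow g (toℕ i + toℕ j) ≡⟨ cong (_∙ pow g (toℕ i + toℕ j)) (trans (pow-+ s (toℕ a + toℕ b) c′) (comm _ _)) ⟩
              (pow s c′ ∙ pow s (toℕ a + toℕ b)) ∙ pow g (toℕ i + toℕ j) ≡⟨ assoc _ _ _ ⟩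
              pow s c′ ∙ (pow s (toℕ a + toℕ b) ∙ pow g (toℕ i + toℕ j)) ≡⟨ cong (pow s c′ ∙_) main ⟩
              pow s c′ ∙ (pow s (toℕ c) ∙ pow g (toℕ l)) ≡⟨ sym (assoc _ _ _) ⟩
              (pow s c′ ∙ pow s (toℕ c)) ∙ pow g (toℕ l) ≡⟨ cong (_∙ pow g (toℕ l)) (trans (comm _ _) (trans (sym (pow-+ s (toℕ c) c′)) s^cp≡ε)) ⟩
              ε ∙ pow g (toℕ l) ≡⟨ identityˡ _ ⟩
              pow g (toℕ l) ∎)) (toℕ l , refl)) (toℕ i + toℕ j , refl))
            where open ≡.≡-Reasoning
          s^a+b : pow s (toℕ a + toℕ b) ≡ pow s (toℕ c)
          s^a+b = ∙-cancelʳ (pow s c′) _ _ (trans (sym (pow-+ s (toℕ a + toℕ b) c′)) (trans (s^E p∣E) (trans (sym s^cp≡ε) (pow-+ s (toℕ c) c′))))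
            where
            s^E : p ℕ∣.∣ E → pow s E ≡ ε
            s^E (divides q e) = trans (cong (pow s) e) (pow≡ε-* {s} {p} q s^p≡ε)

    split-case : ∀ s → ¬ ⟨g⟩ s → BoundedWeighing N p n
    split-case s s∉ = Complement.product-case s′ s′∉ s′^p≡ε
      where
      r = proj₁ (Complement.s^p∈ s s∉)
      g^r≡s^p = proj₂ (Complement.s^p∈ s s∉)
      g^rp^k≡ε : pow g (p ^ k * r) ≡ ε
      g^rp^k≡ε = trans (pow-* g (p ^ k) r) (trans (cong (λ h → pow h (p ^ k)) g^r≡s^p)
        (trans (sym (pow-* s (p ^ k) p)) (trans (cong (pow s) (ℕₚ.*-comm (p ^ k) p)) (exponent s))))
      p∣r : p ℕ∣.∣ r
      p∣r = ℕ∣.*-cancelˡ-∣ (p ^ k) ⦃ ℕₚ.m^n≢0 p k ⦄ (subst (ℕ∣._∣ (p ^ k * r)) (ℕₚ.*-comm p (p ^ k))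
        (order-divides pr k g≢ε (exponent g) g^rp^k≡ε))
      r′ = ℕ∣.quotient p∣r
      inv = inverse∈ (r′ , refl)
      z = proj₁ inv
      s′ = s ∙ z
      s′∉ : ¬ ⟨g⟩ s′
      s′∉ h = s∉ (÷∈ h (proj₁ (proj₂ inv)))
      s′^p≡ε : pow s′ p ≡ ε
      s′^p≡ε = trans (pow-∙ s z p) (trans (cong (_∙ pow z p) (trans (sym g^r≡s^p) (trans (cong (pow g) (trans (ℕ∣._∣_.equality p∣r) (ℕₚ.*-comm r′ p))) (pow-* g p r′))))
        (trans (sym (pow-∙ (pow g r′) z p)) (trans (cong (λ h → pow h p) (proj₂ (proj₂ inv))) (pow-ε p))))

  bounded : (g : Fin (p ^ suc (suc k))) → pow g (p ^ k) ≢ ε → ∃ λ j → BoundedWeighing (p ^ j) p n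
  bounded g g≢ε with Finₚ.any? (λ h → ¬? (pow h N Fin.≟ ε))
  ... | yes (h , h≢ε) = suc (suc k) , cyclic-case h h≢ε
  ... | no all≡ε with Finₚ.any? (λ s → ¬? (Finₚ.any? (λ (i : Fin N) → pow g (toℕ i) Fin.≟ s)))
  ...   | yes (s , s∉) = suc k , Split.split-case g g≢ε exponent s (λ (i , e) → s∉ (fromℕ< (m%n<n i N) , trans (cong (pow g) (Finₚ.toℕ-fromℕ< (m%n<n i N))) (trans (reduce i) e)))
    where
    exponent : ∀ y → pow y N ≡ ε
    exponent y = decidable-stable (pow y N Fin.≟ ε) (λ ne → all≡ε (y , ne))
    reduce : ∀ i → pow g (i ℕ.% N) ≡ pow g i
    reduce i = sym (trans (cong (pow g) (m≡m%n+[m/n]*n i N)) (trans (pow-+ g (i ℕ.% N) _)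
      (trans (cong (pow g (i ℕ.% N) ∙_) (pow≡ε-* (i ℕ./ N) (exponent g))) (identityʳ _))))
  ...   | no all∈ = contradiction (Finₚ.injective⇒≤ {f = λ s → proj₁ (index s)}
            (λ {x} {y} e → trans (sym (proj₂ (index x))) (trans (cong (λ i → pow g (toℕ i)) e) (proj₂ (index y)))))
          (ℕₚ.<⇒≱ (subst (N ℕ.<_) (ℕₚ.*-comm N p) (ℕₚ.m<m*n N p (ℕ.nonTrivial⇒n>1 p ⦃ prime⇒nonTrivial pr ⦄))))
    where
    index : ∀ s → ∃ λ (i : Fin N) → pow g (toℕ i) ≡ s
    index s = decidable-stable (Finₚ.any? (λ i → pow g (toℕ i) Fin.≟ s)) (λ ne → all∈ (s , ne))

-- If every g^(p^(c-2)) were trivial the exponent would be at most p^(c-2).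
bounded-weighing : ∀ {p} → Prime p → ∀ c → 1 ≤ c → (G : FinAbGroup (p ^ c)) → ExponentDivisibleBy G (p ^ (c ∸ 1)) →
  ∀ {n} → IW G n → ∃ λ j → BoundedWeighing (p ^ j) p n
bounded-weighing {p} pr (suc zero) _ G _ (a , weighing) = 0 , record
  { ldiv = ldiv ; e = ε ; a = a ; weighing = weighing ; involutive = ldiv-involutive
  ; χ = λ _ → Fin.zero ; χ-ldiv = λ _ _ → 0 , 0 , refl ; χ-e = refl
  ; ψ = subst Fin (ℕₚ.*-identityʳ p) ; χψ-injective = λ _ → ≡.subst-injective (ℕₚ.*-identityʳ p) }
  where open Powers G
bounded-weighing {p} pr (suc (suc k)) _ G (m , (m>0 , _ , minimal) , N∣m) weight
  with Finₚ.any? (λ g → ¬? (FinAbGroup.pow G g (p ^ k) Fin.≟ FinAbGroup.ε G))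
... | yes (g , g≢ε) = LargeExponent.bounded pr k G weight g g≢ε
... | no all≡ε = contradiction (ℕₚ.≤-trans (ℕ∣.∣⇒≤ ⦃ ℕ.>-nonZero m>0 ⦄ N∣m)
      (minimal (p ^ k) (ℕₚ.m^n>0 p k) (λ g → decidable-stable (pow g (p ^ k) Fin.≟ ε) (λ ne → all≡ε (g , ne)))))
    (ℕₚ.<⇒≱ (subst (p ^ k ℕ.<_) (ℕₚ.*-comm (p ^ k) p) (ℕₚ.m<m*n (p ^ k) p (ℕ.nonTrivial⇒n>1 p ⦃ prime⇒nonTrivial pr ⦄))))
  where
  open FinAbGroup G
  instance
    p≢0 : NonZero p
    p≢0 = prime⇒nonZero pr
    p^k≢0 : NonZero (p ^ k)
    p^k≢0 = ℕₚ.m^n≢0 p k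

mainTheorem6 : (∀ (c d e f : ℕ) →
    ¬ CW (2 ^ c) (7 ^ (2 * e + 2)) ×
    ¬ CW (3 * 7 ^ d) (2 ^ (2 * e + 6)) ×
    ¬ CW (3 ^ c * 13 ^ d) (3 ^ (2 * f + 4)) ×
    ¬ CW (2 ^ c * 5 ^ d) (2 ^ (2 * e + 2) * 5 ^ (2 * f + 2)) ×
    ¬ CW (2 ^ c * 11 ^ d) (2 ^ (2 * e + 2) * 5 ^ (2 * f + 2)) ×
    ¬ CW (2 ^ c * 3 ^ d) (2 ^ (2 * e + 2) * 5 ^ (2 * f + 2)))
    ×
    (∀ (c e : ℕ) → 1 ≤ c →
    (∀ (G : FinAbGroup (2 ^ c)) → ExponentDivisibleBy G (2 ^ (c ∸ 1)) →
    ¬ IW G (2 ^ (2 * e + 6))) ×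
    (∀ (G : FinAbGroup (3 ^ c)) → ExponentDivisibleBy G (3 ^ (c ∸ 1)) →
    ¬ IW G (7 ^ (2 * e + 2))))
mainTheorem6 =
  (λ c d e f → no-CW-7 c e , no-CW-3·7^d d e , no-CW-3^c13^d c d f , no-CW-2^c5^d c d e f , no-CW-2^c11^d c d e f , no-CW-2^c3^d c d e f) ,
  (λ c e 1≤c →
    (λ G exponent weight → let (j , B) = bounded-weighing prime-2 c 1≤c G exponent weight in no-weighing-2^j j e B) ,
    (λ G exponent weight → let (j , B) = bounded-weighing prime-3 c 1≤c G exponent weight in no-weighing-3^j j e B))
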